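{- Let $q$ be a power of an odd prime, $d\geq 3$, $t\in\mathbb{F}_q$ with $t\neq 0$, and $E\subseteq \mathbb{F}_q^d$. Let $N_d(E)$ be the number of non-degenerate $d$-prisms in $E$. If $|E| > \frac{4}{\log 2} q^{\frac{d+1}{2}}$, then $N_d(E) \geq c_d \frac{|E|^{d+2}}{q^{2d}}$ for a constant $c_d>0$ depending only on $d$.
   Context: For $x\in\mathbb{F}_q^d$, $\|x\| = x_1^2+\cdots+x_d^2$. An $n$-prism in $E$ is an $(n+2)$-tuple $(y,z,x^1,\dots,x^n)\in E^{n+2}$ with $\|x^i-y\|=\|x^i-z\|=t$ for all $i\leq n$; it is non-degenerate if all its $n+2$ components are distinct points. The dimension $d$ is treated as a constant with $q$ large relative to $d$. -}

module Defs where

open import Data.Nat as ℕ using (ℕ; zero; suc)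
open import Data.Fin using (Fin)
open import Data.Product using (Σ; _×_; _,_)
open import Data.Vec as V using (Vec; []; _∷_)
open import Data.Vec.Properties using (≡-dec)
open import Data.Vec.Relation.Unary.All as VA using ()
open import Data.List as L using (List; []; _∷_; length; filter; concatMap)
open import Data.List.Relation.Unary.Unique.Propositional using (Unique)
open import Data.List.Relation.Unary.AllPairs using (allPairs?)
open import Data.Rational as ℚ using (ℚ; _/_; ½; 0ℚ; 1ℚ)
open import Data.Integer using (+_)
open import Algebra.Core using (Op₁; Op₂)
open import Algebra.Structures using (IsCommutativeRing)
open import Relation.Binary.PropositionalEquality using (_≡_)
open import Relation.Binary.Definitions using (DecidableEquality)
open import Relation.Nullary using (¬_; Dec; yes; no; ¬?; _×-dec_)
open import Function.Bundles using (_↔_)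

record FiniteField (q : ℕ) : Set₁ where
  infixl 7 _*_
  infixl 6 _+_
  field
    Carrier           : Set
    _+_ _*_           : Op₂ Carrier
    -_                : Op₁ Carrier
    0# 1#             : Carrier
    isCommutativeRing : IsCommutativeRing _≡_ _+_ _*_ -_ 0# 1#
    0≢1               : ¬ (0# ≡ 1#)
    inverse           : ∀ x → ¬ (x ≡ 0#) → Σ Carrier (λ y → x * y ≡ 1#)
    _≟_               : DecidableEquality Carrier
    enumeration       : Carrier ↔ Fin q

module _ {q : ℕ} (F : FiniteField q) where
  open FiniteField F

  Point : ℕ → Set
  Point d = Vec Carrier d

  ‖_‖ : ∀ {d} → Point d → Carrier
  ‖ x ‖ = V.foldr _ _+_ 0# (V.map (λ a → a * a) x)

  _-ᵥ_ : ∀ {d} → Point d → Point d → Point d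
  x -ᵥ y = V.zipWith (λ a b → a + (- b)) x y

  tuples : ∀ {A : Set} (n : ℕ) → List A → List (Vec A n)
  tuples zero    E = [] ∷ []
  tuples (suc n) E = concatMap (λ x → L.map (x ∷_) (tuples n E)) E

  IsNonDegPrism : ∀ {d} (t : Carrier) (n : ℕ) → Vec (Point d) (suc (suc n)) → Set
  IsNonDegPrism t n (y ∷ z ∷ xs) =
    VA.All (λ x → (‖ x -ᵥ y ‖ ≡ t) × (‖ x -ᵥ z ‖ ≡ t)) xs
    × Unique (y ∷ z ∷ V.toList xs)

  isNonDegPrism? : ∀ {d} (t : Carrier) (n : ℕ) (v : Vec (Point d) (suc (suc n))) → Dec (IsNonDegPrism t n v)
  isNonDegPrism? {d} t n (y ∷ z ∷ xs) =
    VA.all? (λ x → (‖ x -ᵥ y ‖ ≟ t) ×-dec (‖ x -ᵥ z ‖ ≟ t)) xs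
    ×-dec allPairs? (λ a b → ¬? (≡-dec _≟_ a b)) (y ∷ z ∷ V.toList xs)

  prismCount : ∀ {d} (t : Carrier) (n : ℕ) → List (Point d) → ℕ
  prismCount t n E = length (filter (isNonDegPrism? t n) (tuples (suc (suc n)) E))

-- Rational partial sums of  log 2 = Σ_{k≥1} 1 / (k 2^k).

halfPow : ℕ → ℚ
halfPow zero    = 1ℚ
halfPow (suc k) = ½ ℚ.* halfPow k

log2Partial : ℕ → ℚ
log2Partial zero    = 0ℚ
log2Partial (suc N) = log2Partial N ℚ.+ ((+ 1 / suc N) ℚ.* halfPow (suc N))

ℕ→ℚ : ℕ → ℚ
ℕ→ℚ n = + n / 1

-- |E| > (4 / log 2) q^((d+1)/2)  ⇔  16 q^(d+1) < |E|² (log 2)²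
--   ⇔ ∃ N. 16 q^(d+1) < |E|² (L_N)²   (partial sums increase strictly to log 2)
AboveThreshold : (q d e : ℕ) → Set
AboveThreshold q d e =
  Σ ℕ (λ N → ℕ→ℚ (16 ℕ.* q ℕ.^ suc d) ℚ.< ℕ→ℚ (e ℕ.* e) ℚ.* log2Partial N ℚ.* log2Partial N)

{-# OPTIONS --safe #-}
module Submission where

-- Counting over hyperplane slices reduces the number of pairs of E at distance t to one-dimensional sums: for
-- each direction ξ a quadratic form in the slice counts whose kernel is η (d odd) or φ₀ (d even) of a quadratic
-- polynomial.  For d odd the kernel is explicit; for d even it is a Kloosterman sum.  Its square-root bound comes
-- from a tower of quadratic extensions: the sums there satisfy K′ = 2q − K², so a sum above 2√q would grow doubly
-- exponentially, while Stepanov's method bounds it by a fixed multiple of the square root of the field size.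
-- A point of degree δ carries δ(δ−1) pairs of distinct neighbours, so the distance count yields many apexes over an
-- average pair (y , z), and the pairs with at least max(d, e/3q²) apexes supply the prisms.

-- Every sum is an integer: complex characters never occur, and bounds on absolute values are stated
-- for squares. `φ₀` is the sum of the nontrivial additive characters, and the autocorrelation of a
-- function g with sum 0 has Fourier weights |ĝ|², which are nonnegative and vanish at the trivial
-- character. The square-root bound for Kloosterman sums thus takes the form |Σ corr(x + c/x)| ≤ 2
-- √q Σ g² for all such g. Squaring a Kloosterman sum becomes a Cauchy-Schwarz inequality, which
-- points in the direction that the growth argument needs. Directions and distances are linked by
-- ‖wξ + v‖ = ‖ξ‖ w² + 2 (v·ξ) w + ‖v‖: for fixed w ≠ 0 the point wξ + v runs through the whole
-- space with ξ, so summing over ξ detects ‖v‖ = t. The threshold enters through the bound 7/10 on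
-- the partial sums of log 2. With e = |E| it gives 40 q^((d+1)/2) < 7 e, so the deviation 2
-- q^((d+1)/2) e of q times the distance count from e² is below 7/20 of e². The later constants come
-- from the remaining 13/20.

module PrismBound where
  open import Level using (0ℓ)
  open import Data.Nat.Base as ℕ using (ℕ; zero; suc)
  import Data.Nat.Properties as ℕₚ
  import Data.Nat.DivMod as DM
  import Data.Nat.Tactic.RingSolver as ℕ-Solver
  open import Data.Integer.Base hiding (suc; ∣_∣)
  open import Data.Integer.Properties hiding (_≟_; module ≤-Reasoning)
  import Data.Integer.Properties as ℤₚ
  open import Data.Integer.Tactic.RingSolver using (solve-∀)
  import Data.Rational.Base as ℚ
  import Data.Rational.Properties as ℚₚ
  import Data.Rational.Unnormalised.Base as ℚᵘ
  import Data.Rational.Unnormalised.Properties as ℚᵘₚ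
  open import Data.Fin.Base as Fin using (Fin; zero; suc; punchIn)
  open import Data.Fin.Properties as Finₚ using (any?)
  open import Data.Fin.Permutation using (permutation)
  open import Data.List.Base using (List; []; _∷_; length; _++_; concatMap; filter; allFin; tabulate) renaming (map to mapᴸ)
  open import Data.List.Properties using (length-map; length-tabulate)
  open import Data.List.Relation.Unary.Unique.Propositional using (Unique)
  open import Data.List.Relation.Unary.Unique.Propositional.Properties using () renaming (filter⁺ to Unique-filter)
  import Data.List.Relation.Unary.AllPairs as AP
  import Data.List.Relation.Unary.All as All
  open import Data.List.Relation.Unary.All.Properties using (all-filter)
  open import Data.Vec.Base as Vec using (Vec; []; _∷_; zipWith; _∷ʳ_; replicate)
  open import Data.Vec.Properties using () renaming (≡-dec to Vec-≡-dec)
  import Data.Vec.Relation.Unary.All as VA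
  open import Data.Vec.Functional using (insertAt)
  open import Data.Vec.Functional.Properties using (insertAt-lookup; insertAt-punchIn)
  open import Data.Maybe.Base using (Maybe; just; nothing)
  open import Data.Product.Base using (Σ; _×_; _,_; proj₁; proj₂; ∃)
  open import Data.Product.Properties using () renaming (≡-dec to ×-≡-dec)
  open import Data.Sum.Base using (_⊎_; inj₁; inj₂)
  open import Data.Empty using (⊥; ⊥-elim)
  open import Function.Bundles using (Inverse)
  open import Relation.Nullary using (¬_; Dec; yes; no; ¬?; _×-dec_; map′)
  open import Relation.Nullary.Decidable using (from-yes)
  open import Relation.Binary.Definitions using (DecidableEquality; tri<; tri≈; tri>)
  open import Relation.Binary.PropositionalEquality hiding ([_])
  open import Algebra.Core using (Op₁; Op₂)
  open import Algebra.Bundles using (CommutativeRing; CommutativeMonoid)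
  open import Algebra.Structures using (IsCommutativeRing)
  import Algebra.Solver.Ring
  import Algebra.Solver.Ring.AlmostCommutativeRing as ACR
  import Algebra.Properties.Ring
  import Algebra.Properties.Monoid.Mult
  import Algebra.Properties.Semiring.Mult.TCOptimised
  import Algebra.Properties.Semiring.Sum
  import Algebra.Properties.Semiring.Exp
  import Algebra.Properties.CommutativeSemiring.Exp
  import Algebra.Properties.CommutativeMonoid.Sum
  import Defs
  open Defs using (FiniteField; AboveThreshold; prismCount; isNonDegPrism?; IsNonDegPrism; halfPow; log2Partial; ℕ→ℚ)

  -- Finite sums

  ∑ : {A : Set} → List A → (A → ℤ) → ℤ
  ∑ []       f = 0ℤ
  ∑ (x ∷ xs) f = f x + ∑ xs f

  syntax ∑ xs (λ x → e) = ∑[ x ∈ xs ] e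
  infix 5 ∑

  χ : {P : Set} → Dec P → ℤ
  χ (yes _) = 1ℤ
  χ (no  _) = 0ℤ

  χ-⇔ : {P Q : Set} (p : Dec P) (q : Dec Q) → (P → Q) → (Q → P) → χ p ≡ χ q
  χ-⇔ (yes _) (yes _) _ _ = refl
  χ-⇔ (yes p) (no ¬q) f _ = ⊥-elim (¬q (f p))
  χ-⇔ (no ¬p) (yes q) _ g = ⊥-elim (¬p (g q))
  χ-⇔ (no _)  (no _)  _ _ = refl

  χ-yes : {P : Set} (p : Dec P) → P → χ p ≡ 1ℤ
  χ-yes (yes _) _ = refl
  χ-yes (no ¬p) p = ⊥-elim (¬p p)

  χ-no : {P : Set} (p : Dec P) → ¬ P → χ p ≡ 0ℤ
  χ-no (yes p) ¬p = ⊥-elim (¬p p)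
  χ-no (no _)  _  = refl

  χ-guard : {P : Set} (p : Dec P) {a b : ℤ} → (P → a ≡ b) → χ p * a ≡ χ p * b
  χ-guard (yes p) h = cong (1ℤ *_) (h p)
  χ-guard (no _)  h = refl

  0≤χ : {P : Set} (p : Dec P) → 0ℤ ≤ χ p
  0≤χ (yes _) = +≤+ ℕ.z≤n
  0≤χ (no _)  = ≤-refl

  0≤+ : ∀ {a b} → 0ℤ ≤ a → 0ℤ ≤ b → 0ℤ ≤ a + b
  0≤+ = +-mono-≤

  0≤* : ∀ {a b} → 0ℤ ≤ a → 0ℤ ≤ b → 0ℤ ≤ a * b
  0≤* {+ m} {+ n} _ _ = subst (0ℤ ≤_) (pos-* m n) (+≤+ ℕ.z≤n)

  0≤² : ∀ a → 0ℤ ≤ a * a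
  0≤² (+ n)    = 0≤* {+ n} {+ n} (+≤+ ℕ.z≤n) (+≤+ ℕ.z≤n)
  0≤² -[1+ n ] = +≤+ ℕ.z≤n

  0≤-⇒≤ : ∀ {a b} → 0ℤ ≤ b - a → a ≤ b
  0≤-⇒≤ = 0≤i-j⇒j≤i

  ≤⇒0≤- : ∀ {a b} → a ≤ b → 0ℤ ≤ b - a
  ≤⇒0≤- = i≤j⇒0≤j-i

  *ˡ-≤ : ∀ {c a b} → 0ℤ ≤ c → a ≤ b → c * a ≤ c * b
  *ˡ-≤ {+ c} _ = *-monoˡ-≤-nonNeg (+ c)

  *ʳ-≤ : ∀ {c a b} → 0ℤ ≤ c → a ≤ b → a * c ≤ b * c
  *ʳ-≤ {+ c} _ = *-monoʳ-≤-nonNeg (+ c)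

  *-≤-* : ∀ {a b c d} → 0ℤ ≤ a → 0ℤ ≤ d → a ≤ b → c ≤ d → a * c ≤ b * d
  *-≤-* {a} {b} {c} {d} 0≤a 0≤d a≤b c≤d = ≤-trans (*ˡ-≤ 0≤a c≤d) (*ʳ-≤ 0≤d a≤b)

  module _ {A : Set} where
    ∑-cong : (xs : List A) {f g : A → ℤ} → (∀ x → f x ≡ g x) → ∑ xs f ≡ ∑ xs g
    ∑-cong []       h = refl
    ∑-cong (x ∷ xs) h = cong₂ _+_ (h x) (∑-cong xs h)

    ∑-0 : (xs : List A) → ∑ xs (λ _ → 0ℤ) ≡ 0ℤ
    ∑-0 []       = refl
    ∑-0 (x ∷ xs) = trans (+-identityˡ _) (∑-0 xs)

    ∑-+ : (xs : List A) (f g : A → ℤ) → ∑ xs (λ x → f x + g x) ≡ ∑ xs f + ∑ xs g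
    ∑-+ []       f g = refl
    ∑-+ (x ∷ xs) f g = trans (cong (λ z → f x + g x + z) (∑-+ xs f g)) (lem (f x) (g x) (∑ xs f) (∑ xs g))
      where
      lem : ∀ a b c d → a + b + (c + d) ≡ a + c + (b + d)
      lem = solve-∀

    ∑-*ˡ : (xs : List A) (c : ℤ) (f : A → ℤ) → ∑ xs (λ x → c * f x) ≡ c * ∑ xs f
    ∑-*ˡ []       c f = sym (*-zeroʳ c)
    ∑-*ˡ (x ∷ xs) c f = trans (cong (λ z → c * f x + z) (∑-*ˡ xs c f)) (sym (*-distribˡ-+ c (f x) (∑ xs f)))

    ∑-*ʳ : (xs : List A) (f : A → ℤ) (c : ℤ) → ∑ xs (λ x → f x * c) ≡ ∑ xs f * c
    ∑-*ʳ xs f c = trans (∑-cong xs (λ x → *-comm (f x) c)) (trans (∑-*ˡ xs c f) (*-comm c _))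

    ∑-neg : (xs : List A) (f : A → ℤ) → ∑ xs (λ x → - f x) ≡ - ∑ xs f
    ∑-neg xs f = trans (∑-cong xs (λ x → sym (-1*i≡-i (f x)))) (trans (∑-*ˡ xs -1ℤ f) (-1*i≡-i _))

    ∑-- : (xs : List A) (f g : A → ℤ) → ∑ xs (λ x → f x - g x) ≡ ∑ xs f - ∑ xs g
    ∑-- xs f g = trans (∑-+ xs f (λ x → - g x)) (cong (λ z → ∑ xs f + z) (∑-neg xs g))

    ∑-mono : (xs : List A) {f g : A → ℤ} → (∀ x → f x ≤ g x) → ∑ xs f ≤ ∑ xs g
    ∑-mono []       h = ≤-refl
    ∑-mono (x ∷ xs) h = +-mono-≤ (h x) (∑-mono xs h)

    ∑-≥0 : (xs : List A) {f : A → ℤ} → (∀ x → 0ℤ ≤ f x) → 0ℤ ≤ ∑ xs f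
    ∑-≥0 xs h = subst (_≤ ∑ xs _) (∑-0 xs) (∑-mono xs h)

    ∑-++ : (xs ys : List A) (f : A → ℤ) → ∑ (xs ++ ys) f ≡ ∑ xs f + ∑ ys f
    ∑-++ []       ys f = sym (+-identityˡ _)
    ∑-++ (x ∷ xs) ys f = trans (cong (λ z → f x + z) (∑-++ xs ys f)) (sym (+-assoc (f x) _ _))

    ∑-length : (xs : List A) → ∑ xs (λ _ → 1ℤ) ≡ + length xs
    ∑-length []       = refl
    ∑-length (x ∷ xs) = cong (λ z → 1ℤ + z) (∑-length xs)

    ∑-filter : (xs : List A) {P : A → Set} (P? : ∀ x → Dec (P x)) → ∑ xs (λ x → χ (P? x)) ≡ + length (filter P? xs)
    ∑-filter []       P? = refl
    ∑-filter (x ∷ xs) P? with P? x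
    ... | yes _ = cong (λ z → 1ℤ + z) (∑-filter xs P?)
    ... | no  _ = trans (+-identityˡ _) (∑-filter xs P?)

  module _ {A B : Set} where
    ∑-swap : (xs : List A) (ys : List B) (f : A → B → ℤ) →
             ∑[ x ∈ xs ] ∑[ y ∈ ys ] f x y ≡ ∑[ y ∈ ys ] ∑[ x ∈ xs ] f x y
    ∑-swap []       ys f = sym (∑-0 ys)
    ∑-swap (x ∷ xs) ys f = trans (cong (λ z → ∑ ys (f x) + z) (∑-swap xs ys f)) (sym (∑-+ ys (f x) _))

    ∑-map : (h : A → B) (xs : List A) (f : B → ℤ) → ∑ (mapᴸ h xs) f ≡ ∑ xs (λ x → f (h x))
    ∑-map h []       f = refl
    ∑-map h (x ∷ xs) f = cong (λ z → f (h x) + z) (∑-map h xs f)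

    ∑-concatMap : (h : A → List B) (xs : List A) (f : B → ℤ) →
                  ∑ (concatMap h xs) f ≡ ∑[ x ∈ xs ] ∑ (h x) f
    ∑-concatMap h []       f = refl
    ∑-concatMap h (x ∷ xs) f = trans (∑-++ (h x) _ f) (cong (λ z → ∑ (h x) f + z) (∑-concatMap h xs f))

    ∑-product : (xs : List A) (ys : List B) (f : A → ℤ) (g : B → ℤ) →
                ∑[ x ∈ xs ] ∑[ y ∈ ys ] f x * g y ≡ ∑ xs f * ∑ ys g
    ∑-product xs ys f g = trans (∑-cong xs (λ x → ∑-*ˡ ys (f x) g)) (∑-*ʳ xs f (∑ ys g))

  -- `once` expresses membership and absence of repetition as one count, so that a sum against an
  -- indicator collapses without any induction on the list.
  record Enum (A : Set) : Set where
    infix 4 _≟_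
    field
      _≟_   : DecidableEquality A
      elems : List A
      once  : ∀ a → ∑[ x ∈ elems ] χ (x ≟ a) ≡ 1ℤ

    size : ℤ
    size = ∑[ x ∈ elems ] 1ℤ

    ∑-δ : (a : A) (f : A → ℤ) → ∑[ x ∈ elems ] χ (x ≟ a) * f x ≡ f a
    ∑-δ a f = begin
      ∑[ x ∈ elems ] χ (x ≟ a) * f x ≡⟨ ∑-cong elems (λ x → χ-guard (x ≟ a) (cong f)) ⟩
      ∑[ x ∈ elems ] χ (x ≟ a) * f a ≡⟨ ∑-*ʳ elems _ (f a) ⟩
      ∑ elems (λ x → χ (x ≟ a)) * f a ≡⟨ cong (_* f a) (once a) ⟩
      1ℤ * f a ≡⟨ *-identityˡ (f a) ⟩
      f a ∎
      where open ≡-Reasoning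

    ∑-const : (c : ℤ) → ∑[ x ∈ elems ] c ≡ size * c
    ∑-const c = trans (∑-cong elems (λ _ → sym (*-identityˡ c))) (∑-*ʳ elems _ c)

    ∑-term≤ : (a : A) (f : A → ℤ) → (∀ x → 0ℤ ≤ f x) → f a ≤ ∑ elems f
    ∑-term≤ a f 0≤f = subst (_≤ ∑ elems f) (∑-δ a f) (∑-mono elems h)
      where
      h : ∀ x → χ (x ≟ a) * f x ≤ f x
      h x with x ≟ a
      ... | yes _ = ≤-reflexive (*-identityˡ (f x))
      ... | no  _ = 0≤f x

  module _ {A B : Set} (EA : Enum A) (EB : Enum B) where
    private
      module EA = Enum EA
      module EB = Enum EB

    ∑-fibres : (xs : List A) (φ : A → B) (f : B → ℤ) →
               ∑[ a ∈ xs ] f (φ a) ≡ ∑[ b ∈ EB.elems ] (∑[ a ∈ xs ] χ (φ a EB.≟ b)) * f b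
    ∑-fibres xs φ f = begin
      ∑[ a ∈ xs ] f (φ a)
        ≡⟨ ∑-cong xs (λ a → sym (EB.∑-δ (φ a) f)) ⟩
      ∑[ a ∈ xs ] ∑[ b ∈ EB.elems ] χ (b EB.≟ φ a) * f b
        ≡⟨ ∑-swap xs EB.elems _ ⟩
      ∑[ b ∈ EB.elems ] ∑[ a ∈ xs ] χ (b EB.≟ φ a) * f b
        ≡⟨ ∑-cong EB.elems (λ b → trans (∑-*ʳ xs _ (f b))
             (cong (_* f b) (∑-cong xs (λ a → χ-⇔ (b EB.≟ φ a) (φ a EB.≟ b) sym sym)))) ⟩
      ∑[ b ∈ EB.elems ] (∑[ a ∈ xs ] χ (φ a EB.≟ b)) * f b ∎
      where open ≡-Reasoning

    ∑-reindex : (φ : A → B) (ψ : B → A) → (∀ a → ψ (φ a) ≡ a) → (∀ b → φ (ψ b) ≡ b) →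
                (f : B → ℤ) → ∑[ a ∈ EA.elems ] f (φ a) ≡ ∑ EB.elems f
    ∑-reindex φ ψ ψφ φψ f = trans (∑-fibres EA.elems φ f) (∑-cong EB.elems λ b →
      trans (cong (_* f b) (trans (∑-cong EA.elems λ a →
               χ-⇔ (φ a EB.≟ b) (a EA.≟ ψ b)
                 (λ p → trans (sym (ψφ a)) (cong ψ p)) (λ p → trans (cong φ p) (φψ b)))
             (EA.once (ψ b))))
      (*-identityˡ (f b)))

  tuples : {A : Set} (n : ℕ) → List A → List (Vec A n)
  tuples zero    xs = [] ∷ []
  tuples (suc n) xs = concatMap (λ x → mapᴸ (x ∷_) (tuples n xs)) xs

  ∑-tuples : {A : Set} (n : ℕ) (xs : List A) (f : Vec A (suc n) → ℤ) →
             ∑ (tuples (suc n) xs) f ≡ ∑[ x ∈ xs ] ∑[ v ∈ tuples n xs ] f (x ∷ v)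
  ∑-tuples n xs f = trans (∑-concatMap _ xs f) (∑-cong xs λ x → ∑-map (x ∷_) (tuples n xs) f)

  pairs : {A B : Set} → List A → List B → List (A × B)
  pairs xs ys = concatMap (λ x → mapᴸ (x ,_) ys) xs

  ∑-pairs : {A B : Set} (xs : List A) (ys : List B) (f : A × B → ℤ) →
            ∑ (pairs xs ys) f ≡ ∑[ x ∈ xs ] ∑[ y ∈ ys ] f (x , y)
  ∑-pairs xs ys f = trans (∑-concatMap _ xs f) (∑-cong xs λ x → ∑-map (x ,_) ys f)

  χ-× : {P Q R : Set} (r : Dec R) (p : Dec P) (q : Dec Q) → (R → P × Q) → (P → Q → R) → χ r ≡ χ p * χ q
  χ-× (yes r) p q f g rewrite χ-yes p (proj₁ (f r)) | χ-yes q (proj₂ (f r)) = refl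
  χ-× (no ¬r) (no _) q f g = refl
  χ-× (no ¬r) (yes p) (no _) f g = refl
  χ-× (no ¬r) (yes p) (yes q) f g = ⊥-elim (¬r (g p q))

  module _ {A B : Set} (EA : Enum A) (EB : Enum B) where
    private
      module EA = Enum EA
      module EB = Enum EB

    pairEnum : Enum (A × B)
    pairEnum = record
      { _≟_   = ×-≡-dec EA._≟_ EB._≟_
      ; elems = pairs EA.elems EB.elems
      ; once  = λ { (a , b) → begin
          ∑ (pairs EA.elems EB.elems) (λ x → χ (×-≡-dec EA._≟_ EB._≟_ x (a , b)))
            ≡⟨ ∑-pairs EA.elems EB.elems _ ⟩
          ∑[ x ∈ EA.elems ] ∑[ y ∈ EB.elems ] χ (×-≡-dec EA._≟_ EB._≟_ (x , y) (a , b))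
            ≡⟨ ∑-cong EA.elems (λ x → ∑-cong EB.elems (λ y →
                 χ-× (×-≡-dec EA._≟_ EB._≟_ (x , y) (a , b)) (x EA.≟ a) (y EB.≟ b) (λ { refl → refl , refl }) (cong₂ _,_))) ⟩
          ∑[ x ∈ EA.elems ] ∑[ y ∈ EB.elems ] χ (x EA.≟ a) * χ (y EB.≟ b)
            ≡⟨ ∑-product EA.elems EB.elems _ _ ⟩
          ∑ EA.elems (λ x → χ (x EA.≟ a)) * ∑ EB.elems (λ y → χ (y EB.≟ b))
            ≡⟨ cong₂ _*_ (EA.once a) (EB.once b) ⟩
          1ℤ ∎ }
      }
      where open ≡-Reasoning

  module _ {A : Set} (EA : Enum A) where
    private module EA = Enum EA

    vecEnum : (n : ℕ) → Enum (Vec A n)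
    vecEnum n = record
      { _≟_   = Vec-≡-dec EA._≟_
      ; elems = tuples n EA.elems
      ; once  = go n
      }
      where
      open ≡-Reasoning
      go : (n : ℕ) (v : Vec A n) → ∑[ x ∈ tuples n EA.elems ] χ (Vec-≡-dec EA._≟_ x v) ≡ 1ℤ
      go zero    []      = refl
      go (suc n) (a ∷ v) = begin
        ∑[ x ∈ tuples (suc n) EA.elems ] χ (Vec-≡-dec EA._≟_ x (a ∷ v))
          ≡⟨ ∑-tuples n EA.elems _ ⟩
        ∑[ x ∈ EA.elems ] ∑[ y ∈ tuples n EA.elems ] χ (Vec-≡-dec EA._≟_ (x ∷ y) (a ∷ v))
          ≡⟨ ∑-cong EA.elems (λ x → ∑-cong (tuples n EA.elems) λ y →
               χ-× (Vec-≡-dec EA._≟_ (x ∷ y) (a ∷ v)) (x EA.≟ a) (Vec-≡-dec EA._≟_ y v) (λ { refl → refl , refl }) (cong₂ _∷_)) ⟩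
        ∑[ x ∈ EA.elems ] ∑[ y ∈ tuples n EA.elems ] χ (x EA.≟ a) * χ (Vec-≡-dec EA._≟_ y v)
          ≡⟨ ∑-product EA.elems (tuples n EA.elems) _ _ ⟩
        ∑ EA.elems (λ x → χ (x EA.≟ a)) * ∑ (tuples n EA.elems) (λ y → χ (Vec-≡-dec EA._≟_ y v))
          ≡⟨ cong₂ _*_ (EA.once a) (go n v) ⟩
        1ℤ ∎

  -- Enumerated fields

  -- Ring normalisation with integer coefficients, so that cancellations are recognised in an abstract ring.
  module IntegerCoefficients (R : CommutativeRing 0ℓ 0ℓ) where
    private
      module R = CommutativeRing R
      open R using (_≈_) renaming (_+_ to _⊕_; _*_ to _⊗_; -_ to ⊝_)
      open Algebra.Properties.Semiring.Mult.TCOptimised R.semiring renaming (_×_ to _·_)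
      open Algebra.Properties.Ring R.ring
      open import Relation.Binary.Reasoning.Setoid R.setoid

      ⟦_⟧ᶻ : ℤ → R.Carrier
      ⟦ + n ⟧ᶻ      = n · R.1#
      ⟦ -[1+ n ] ⟧ᶻ = ⊝ (suc n · R.1#)

      ⟦⟧-⊖ : ∀ m n → ⟦ m ⊖ n ⟧ᶻ ≈ m · R.1# ⊕ ⊝ (n · R.1#)
      ⟦⟧-⊖ m       zero    = R.sym (R.trans (R.+-congˡ -0#≈0#) (R.+-identityʳ _))
      ⟦⟧-⊖ zero    (suc n) = R.sym (R.+-identityˡ _)
      ⟦⟧-⊖ (suc m) (suc n) = begin
        ⟦ suc m ⊖ suc n ⟧ᶻ ≡⟨ cong ⟦_⟧ᶻ ([1+m]⊖[1+n]≡m⊖n m n) ⟩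
        ⟦ m ⊖ n ⟧ᶻ ≈⟨ ⟦⟧-⊖ m n ⟩
        a ⊕ ⊝ b ≈⟨ R.+-congʳ (R.+-identityˡ a) ⟨
        R.0# ⊕ a ⊕ ⊝ b ≈⟨ R.+-congʳ (R.+-congʳ (R.-‿inverseʳ R.1#)) ⟨
        R.1# ⊕ ⊝ R.1# ⊕ a ⊕ ⊝ b ≈⟨ R.+-congʳ (R.+-assoc _ _ _) ⟩
        R.1# ⊕ (⊝ R.1# ⊕ a) ⊕ ⊝ b ≈⟨ R.+-congʳ (R.+-congˡ (R.+-comm _ _)) ⟩
        R.1# ⊕ (a ⊕ ⊝ R.1#) ⊕ ⊝ b ≈⟨ R.+-congʳ (R.+-assoc _ _ _) ⟨
        R.1# ⊕ a ⊕ ⊝ R.1# ⊕ ⊝ b ≈⟨ R.+-assoc _ _ _ ⟩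
        R.1# ⊕ a ⊕ (⊝ R.1# ⊕ ⊝ b) ≈⟨ R.+-congˡ (-‿+-comm R.1# b) ⟩
        R.1# ⊕ a ⊕ ⊝ (R.1# ⊕ b) ≈⟨ R.+-cong (R.sym (1+× m R.1#)) (R.-‿cong (R.sym (1+× n R.1#))) ⟩
        suc m · R.1# ⊕ ⊝ (suc n · R.1#) ∎
        where
        a = m · R.1#
        b = n · R.1#

      +-homo : ∀ i j → ⟦ i + j ⟧ᶻ ≈ ⟦ i ⟧ᶻ ⊕ ⟦ j ⟧ᶻ
      +-homo (+ m)    (+ n)    = ×-homo-+ R.1# m n
      +-homo (+ m)    -[1+ n ] = ⟦⟧-⊖ m (suc n)
      +-homo -[1+ m ] (+ n)    = R.trans (⟦⟧-⊖ n (suc m)) (R.+-comm _ _)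
      +-homo -[1+ m ] -[1+ n ] = R.trans (R.-‿cong (R.trans
          (R.reflexive (cong (λ z → suc z · R.1#) (sym (ℕₚ.+-suc m n)))) (×-homo-+ R.1# (suc m) (suc n))))
          (R.sym (-‿+-comm _ _))
        where import Data.Nat.Properties as ℕₚ

      -‿homo : ∀ i → ⟦ - i ⟧ᶻ ≈ ⊝ ⟦ i ⟧ᶻ
      -‿homo (+ zero)  = R.sym -0#≈0#
      -‿homo (+ suc n) = R.refl
      -‿homo -[1+ n ]  = R.sym (-‿involutive _)

      *⁺-homo : ∀ m n → ⟦ + m * + n ⟧ᶻ ≈ ⟦ + m ⟧ᶻ ⊗ ⟦ + n ⟧ᶻ
      *⁺-homo m n = R.trans (R.reflexive (cong ⟦_⟧ᶻ (sym (pos-* m n)))) (×1-homo-* m n)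

      *-homo : ∀ i j → ⟦ i * j ⟧ᶻ ≈ ⟦ i ⟧ᶻ ⊗ ⟦ j ⟧ᶻ
      *-homo (+ m)    (+ n)    = *⁺-homo m n
      *-homo (+ m)    -[1+ n ] = begin
        ⟦ + m * -[1+ n ] ⟧ᶻ ≡⟨ cong ⟦_⟧ᶻ (sym (neg-distribʳ-* (+ m) (+ suc n))) ⟩
        ⟦ - (+ m * + suc n) ⟧ᶻ ≈⟨ R.trans (-‿homo (+ m * + suc n)) (R.-‿cong (*⁺-homo m (suc n))) ⟩
        ⊝ (⟦ + m ⟧ᶻ ⊗ ⟦ + suc n ⟧ᶻ) ≈⟨ -‿distribʳ-* _ _ ⟩
        ⟦ + m ⟧ᶻ ⊗ ⊝ ⟦ + suc n ⟧ᶻ ∎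
      *-homo -[1+ m ] (+ n)    = begin
        ⟦ -[1+ m ] * + n ⟧ᶻ ≡⟨ cong ⟦_⟧ᶻ (sym (neg-distribˡ-* (+ suc m) (+ n))) ⟩
        ⟦ - (+ suc m * + n) ⟧ᶻ ≈⟨ R.trans (-‿homo (+ suc m * + n)) (R.-‿cong (*⁺-homo (suc m) n)) ⟩
        ⊝ (⟦ + suc m ⟧ᶻ ⊗ ⟦ + n ⟧ᶻ) ≈⟨ -‿distribˡ-* _ _ ⟩
        ⊝ ⟦ + suc m ⟧ᶻ ⊗ ⟦ + n ⟧ᶻ ∎
      *-homo -[1+ m ] -[1+ n ] = begin
        ⟦ + suc m * + suc n ⟧ᶻ ≈⟨ *⁺-homo (suc m) (suc n) ⟩
        a ⊗ b ≈⟨ -‿involutive _ ⟨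
        ⊝ ⊝ (a ⊗ b) ≈⟨ R.-‿cong (-‿distribʳ-* a b) ⟩
        ⊝ (a ⊗ ⊝ b) ≈⟨ -‿distribˡ-* a _ ⟩
        ⊝ a ⊗ ⊝ b ∎
        where
        a = ⟦ + suc m ⟧ᶻ
        b = ⟦ + suc n ⟧ᶻ

      _coeff≟_ : ∀ i j → Maybe (⟦ i ⟧ᶻ ≈ ⟦ j ⟧ᶻ)
      i coeff≟ j with i ℤₚ.≟ j
      ... | yes refl = just R.refl
      ... | no  _    = nothing

      homomorphism : +-*-rawRing ACR.-Raw-AlmostCommutative⟶ ACR.fromCommutativeRing R
      homomorphism = record { ⟦_⟧ = ⟦_⟧ᶻ ; +-homo = +-homo ; *-homo = *-homo ; -‿homo = -‿homo ; 0-homo = R.refl ; 1-homo = R.refl }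

    open Algebra.Solver.Ring +-*-rawRing (ACR.fromCommutativeRing R) homomorphism _coeff≟_
      public using (solve; _:=_; _:+_; _:*_; _:-_; :-_; con)

  record EnumField : Set₁ where
    infixl 7 _⊗_
    infixl 6 _⊕_
    infix  8 ⊝_
    field
      Carrier           : Set
      _⊕_ _⊗_           : Op₂ Carrier
      ⊝_                : Op₁ Carrier
      𝟘 𝟙               : Carrier
      isCommutativeRing : IsCommutativeRing _≡_ _⊕_ _⊗_ ⊝_ 𝟘 𝟙
      𝟘≢𝟙               : ¬ 𝟘 ≡ 𝟙
      inv               : Carrier → Carrier
      inv-right         : ∀ x → ¬ x ≡ 𝟘 → x ⊗ inv x ≡ 𝟙
      enum              : Enum Carrier

    commutativeRing : CommutativeRing 0ℓ 0ℓ
    commutativeRing = record { isCommutativeRing = isCommutativeRing }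

    open Enum enum public

  module FieldKit (K : EnumField) where
    open EnumField K public
    open IntegerCoefficients commutativeRing public
    module R = CommutativeRing commutativeRing
    private module RP = Algebra.Properties.Ring R.ring

    infixl 6 _⊖ᶠ_
    _⊖ᶠ_ : Carrier → Carrier → Carrier
    a ⊖ᶠ b = a ⊕ ⊝ b

    𝟚 : Carrier
    𝟚 = 𝟙 ⊕ 𝟙

    inv-left : ∀ {x} → ¬ x ≡ 𝟘 → inv x ⊗ x ≡ 𝟙
    inv-left {x} x≢0 = trans (R.*-comm _ _) (inv-right x x≢0)

    ⊗-cancelˡ : ∀ {a x y} → ¬ a ≡ 𝟘 → a ⊗ x ≡ a ⊗ y → x ≡ y
    ⊗-cancelˡ {a} {x} {y} a≢0 h = begin
      x ≡⟨ sym (R.*-identityˡ x) ⟩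
      𝟙 ⊗ x ≡⟨ cong (_⊗ x) (sym (inv-left a≢0)) ⟩
      inv a ⊗ a ⊗ x ≡⟨ R.*-assoc _ _ _ ⟩
      inv a ⊗ (a ⊗ x) ≡⟨ cong (inv a ⊗_) h ⟩
      inv a ⊗ (a ⊗ y) ≡⟨ sym (R.*-assoc _ _ _) ⟩
      inv a ⊗ a ⊗ y ≡⟨ cong (_⊗ y) (inv-left a≢0) ⟩
      𝟙 ⊗ y ≡⟨ R.*-identityˡ y ⟩
      y ∎
      where open ≡-Reasoning

    ⊗≡𝟘ʳ : ∀ {a b} → ¬ a ≡ 𝟘 → a ⊗ b ≡ 𝟘 → b ≡ 𝟘
    ⊗≡𝟘ʳ {a} a≢0 h = ⊗-cancelˡ a≢0 (trans h (sym (R.zeroʳ a)))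

    ⊗≢𝟘 : ∀ {a b} → ¬ a ≡ 𝟘 → ¬ b ≡ 𝟘 → ¬ a ⊗ b ≡ 𝟘
    ⊗≢𝟘 a≢0 b≢0 h = b≢0 (⊗≡𝟘ʳ a≢0 h)

    inv≢𝟘 : ∀ {a} → ¬ a ≡ 𝟘 → ¬ inv a ≡ 𝟘
    inv≢𝟘 {a} a≢0 h = 𝟘≢𝟙 (trans (sym (R.zeroʳ a)) (trans (cong (a ⊗_) (sym h)) (inv-right a a≢0)))

    inv-unique : ∀ {a b} → a ⊗ b ≡ 𝟙 → inv a ≡ b
    inv-unique {a} {b} h = ⊗-cancelˡ a≢0 (trans (inv-right a a≢0) (sym h))
      where
      a≢0 : ¬ a ≡ 𝟘
      a≢0 e = 𝟘≢𝟙 (trans (sym (R.zeroˡ b)) (trans (cong (_⊗ b) (sym e)) h))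

    inv-inv : ∀ {a} → ¬ a ≡ 𝟘 → inv (inv a) ≡ a
    inv-inv a≢0 = inv-unique (inv-left a≢0)

    a⊗[inv-a⊗b] : ∀ {a} b → ¬ a ≡ 𝟘 → a ⊗ (inv a ⊗ b) ≡ b
    a⊗[inv-a⊗b] b a≢0 = trans (sym (R.*-assoc _ _ _)) (trans (cong (_⊗ b) (inv-right _ a≢0)) (R.*-identityˡ b))

    inv-a⊗[a⊗b] : ∀ {a} b → ¬ a ≡ 𝟘 → inv a ⊗ (a ⊗ b) ≡ b
    inv-a⊗[a⊗b] b a≢0 = trans (sym (R.*-assoc _ _ _)) (trans (cong (_⊗ b) (inv-left a≢0)) (R.*-identityˡ b))

    ⊖≡𝟘 : ∀ {a b} → a ⊖ᶠ b ≡ 𝟘 → a ≡ b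
    ⊖≡𝟘 {a} {b} h = trans (solve 2 (λ a b → a := (a :- b) :+ b) refl a b) (trans (cong (_⊕ b) h) (R.+-identityˡ b))

    ⊝≡𝟘 : ∀ {a} → ⊝ a ≡ 𝟘 → a ≡ 𝟘
    ⊝≡𝟘 {a} h = trans (solve 1 (λ a → a := :- (:- a)) refl a) (trans (cong ⊝_ h) RP.-0#≈0#)

    Σᶠ : (Carrier → ℤ) → ℤ
    Σᶠ = ∑ elems

    Σᶠ-shift : ∀ c f → Σᶠ (λ x → f (x ⊕ c)) ≡ Σᶠ f
    Σᶠ-shift c = ∑-reindex enum enum (_⊕ c) (_⊕ ⊝ c)
      (λ a → solve 2 (λ a c → a :+ c :+ :- c := a) refl a c)
      (λ a → solve 2 (λ a c → a :+ :- c :+ c := a) refl a c)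

    Σᶠ-neg : ∀ f → Σᶠ (λ x → f (⊝ x)) ≡ Σᶠ f
    Σᶠ-neg = ∑-reindex enum enum ⊝_ ⊝_ RP.-‿involutive RP.-‿involutive

    Σᶠ-scale : ∀ {c} → ¬ c ≡ 𝟘 → ∀ f → Σᶠ (λ x → f (c ⊗ x)) ≡ Σᶠ f
    Σᶠ-scale {c} c≢0 = ∑-reindex enum enum (c ⊗_) (inv c ⊗_) (λ a → inv-a⊗[a⊗b] a c≢0) (λ a → a⊗[inv-a⊗b] a c≢0)

    nz : Carrier → ℤ
    nz x = 1ℤ - χ (x ≟ 𝟘)

    nz-≢ : ∀ {x} → ¬ x ≡ 𝟘 → nz x ≡ 1ℤ
    nz-≢ {x} h = cong (λ z → 1ℤ - z) (χ-no (x ≟ 𝟘) h)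

    nz-𝟘 : nz 𝟘 ≡ 0ℤ
    nz-𝟘 = cong (λ z → 1ℤ - z) (χ-yes (𝟘 ≟ 𝟘) refl)

    nz-guard : ∀ x {a b} → (¬ x ≡ 𝟘 → a ≡ b) → nz x * a ≡ nz x * b
    nz-guard x h with x ≟ 𝟘
    ... | yes _   = refl
    ... | no  x≢0 = cong (1ℤ *_) (h x≢0)

    Σᶠ-nz : ∀ (f : Carrier → ℤ) → Σᶠ (λ x → nz x * f x) ≡ Σᶠ f - f 𝟘
    Σᶠ-nz f = begin
      Σᶠ (λ x → nz x * f x) ≡⟨ ∑-cong elems (λ x → lem (χ (x ≟ 𝟘)) (f x)) ⟩
      Σᶠ (λ x → f x - χ (x ≟ 𝟘) * f x) ≡⟨ ∑-- elems f _ ⟩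
      Σᶠ f - Σᶠ (λ x → χ (x ≟ 𝟘) * f x) ≡⟨ cong (λ z → Σᶠ f - z) (∑-δ 𝟘 f) ⟩
      Σᶠ f - f 𝟘 ∎
      where
      open ≡-Reasoning
      open import Data.Integer.Tactic.RingSolver using (solve-∀)
      lem : ∀ a b → (1ℤ - a) * b ≡ b - a * b
      lem = solve-∀

    -- A total involution that agrees with `inv` off `𝟘`. The value `inv 𝟘` is unspecified, so `inv`
    -- itself need not be a permutation by which a sum can be reindexed.
    inv-nz : Carrier → Carrier
    inv-nz x with x ≟ 𝟘
    ... | yes _ = 𝟘
    ... | no  _ = inv x

    inv-nz-≡ : ∀ {x} → ¬ x ≡ 𝟘 → inv-nz x ≡ inv x
    inv-nz-≡ {x} x≢0 with x ≟ 𝟘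
    ... | yes e = ⊥-elim (x≢0 e)
    ... | no  _ = refl

    inv-nz-involutive : ∀ x → inv-nz (inv-nz x) ≡ x
    inv-nz-involutive x with x ≟ 𝟘
    ... | no x≢0 = trans (inv-nz-≡ (inv≢𝟘 x≢0)) (inv-inv x≢0)
    ... | yes refl with 𝟘 ≟ 𝟘
    ...   | yes _ = refl
    ...   | no n  = ⊥-elim (n refl)

    Σᶠ-inv : ∀ (f : Carrier → ℤ) → Σᶠ (λ x → nz x * f (inv x)) ≡ Σᶠ (λ x → nz x * f x)
    Σᶠ-inv f = trans (∑-cong elems {λ x → nz x * f (inv x)} {λ x → nz (inv-nz x) * f (inv-nz x)} h)
      (∑-reindex enum enum inv-nz inv-nz inv-nz-involutive inv-nz-involutive (λ x → nz x * f x))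
      where
      h : ∀ x → nz x * f (inv x) ≡ nz (inv-nz x) * f (inv-nz x)
      h x with x ≟ 𝟘
      ... | yes _  = sym (cong (_* f 𝟘) nz-𝟘)
      ... | no x≢0 = sym (cong (_* f (inv x)) (nz-≢ (inv≢𝟘 x≢0)))

  -- The quadratic character

  ∑-χ≥1 : {A : Set} (xs : List A) {P : A → Set} (P? : ∀ x → Dec (P x)) → (∃ P) ⊎ (∑[ x ∈ xs ] χ (P? x) ≡ 0ℤ)
  ∑-χ≥1 []       P? = inj₂ refl
  ∑-χ≥1 (x ∷ xs) P? with P? x | ∑-χ≥1 xs P?
  ... | yes p | _      = inj₁ (x , p)
  ... | no _  | inj₁ e = inj₁ e
  ... | no _  | inj₂ e = inj₂ (trans (+-identityˡ _) e)

  -- If the indicators of `P?` sum to 0 over the enumeration, `∑-term≤` rules out every single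
  -- element, listed or not.
  search : {A : Set} (E : Enum A) {P : A → Set} (P? : ∀ x → Dec (P x)) → (∃ P) ⊎ (∀ x → ¬ P x)
  search E P? with ∑-χ≥1 (Enum.elems E) P?
  ... | inj₁ e = inj₁ e
  ... | inj₂ e = inj₂ λ x p → 1≰0 (subst₂ _≤_ (χ-yes (P? x) p) e (Enum.∑-term≤ E x (λ y → χ (P? y)) (λ y → 0≤χ (P? y))))
    where
    1≰0 : ¬ 1ℤ ≤ 0ℤ
    1≰0 (+≤+ ())

  module QuadraticCharacter (K : EnumField) (𝟚≢𝟘 : ¬ FieldKit.𝟚 K ≡ FieldKit.𝟘 K) where
    open FieldKit K public

    -- The quadratic character, read off from the number of square roots of a, which is 1 + `η a`.
    η : Carrier → ℤ
    η a = Σᶠ (λ x → χ (x ⊗ x ≟ a)) - 1ℤ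

    -- The sum of all nontrivial additive characters.
    φ₀ : Carrier → ℤ
    φ₀ a = size * χ (a ≟ 𝟘) - 1ℤ

    ⊝-fixed : ∀ {x} → x ≡ ⊝ x → x ≡ 𝟘
    ⊝-fixed {x} h = ⊗≡𝟘ʳ 𝟚≢𝟘 (trans (solve 1 (λ x → con (+ 2) :* x := x :+ x) refl x)
      (trans (cong (x ⊕_) h) (R.-‿inverseʳ x)))

    ²≡² : ∀ {x y} → x ⊗ x ≡ y ⊗ y → (x ≡ y) ⊎ (x ≡ ⊝ y)
    ²≡² {x} {y} h with x ≟ y
    ... | yes e = inj₁ e
    ... | no  n = inj₂ (⊖≡𝟘 (⊗≡𝟘ʳ {x ⊖ᶠ y} (λ e → n (⊖≡𝟘 e))
        (trans (solve 2 (λ x y → (x :- y) :* (x :- (:- y)) := x :* x :- y :* y) refl x y)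
          (trans (cong (_⊖ᶠ (y ⊗ y)) h) (R.-‿inverseʳ _)))))

    data ηCase (a : Carrier) : Set where
      isZero      : a ≡ 𝟘 → η a ≡ 0ℤ → ηCase a
      isSquare    : ∀ x → ¬ x ≡ 𝟘 → x ⊗ x ≡ a → η a ≡ 1ℤ → ηCase a
      isNonsquare : (∀ x → ¬ x ⊗ x ≡ a) → η a ≡ -1ℤ → ηCase a

    ηcase : ∀ a → ηCase a
    ηcase a with search enum (λ x → x ⊗ x ≟ a)
    ... | inj₂ none = isNonsquare none (cong (λ z → z - 1ℤ)
            (trans (∑-cong elems (λ x → χ-no (x ⊗ x ≟ a) (none x))) (∑-0 elems)))
    ... | inj₁ (x , refl) with x ≟ 𝟘
    ...   | yes refl = isZero (R.zeroˡ 𝟘) (cong (λ z → z - 1ℤ) (trans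
              (∑-cong elems (λ y → χ-⇔ (y ⊗ y ≟ 𝟘 ⊗ 𝟘) (y ≟ 𝟘) (root y) (cong (λ z → z ⊗ z))))
              (once 𝟘)))
      where
      root : ∀ y → y ⊗ y ≡ 𝟘 ⊗ 𝟘 → y ≡ 𝟘
      root y h with ²≡² h
      ... | inj₁ e = e
      ... | inj₂ e = trans e (trans (solve 0 (:- con (+ 0) := con (+ 0)) refl) refl)
    ...   | no x≢0 = isSquare x x≢0 refl (cong (λ z → z - 1ℤ) (trans
              (∑-cong elems two)
              (trans (∑-+ elems _ _) (cong₂ _+_ (once x) (once (⊝ x))))))
      where
      two : ∀ y → χ (y ⊗ y ≟ x ⊗ x) ≡ χ (y ≟ x) + χ (y ≟ ⊝ x)
      two y with y ≟ x | y ≟ ⊝ x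
      ... | yes refl | yes e = ⊥-elim (x≢0 (⊝-fixed e))
      ... | yes refl | no _  = χ-yes (y ⊗ y ≟ y ⊗ y) refl
      ... | no _ | yes refl  = χ-yes (⊝ x ⊗ ⊝ x ≟ x ⊗ x) (solve 1 (λ x → :- x :* :- x := x :* x) refl x)
      ... | no n₁ | no n₂ = χ-no (y ⊗ y ≟ x ⊗ x) λ h → case (²≡² h) n₁ n₂
        where
        case : (y ≡ x) ⊎ (y ≡ ⊝ x) → ¬ y ≡ x → ¬ y ≡ ⊝ x → ⊥
        case (inj₁ e) n _ = n e
        case (inj₂ e) _ n = n e

    η-𝟘 : η 𝟘 ≡ 0ℤ
    η-𝟘 with ηcase 𝟘
    ... | isZero _ e          = e
    ... | isSquare x x≢0 e _  = ⊥-elim (⊗≢𝟘 x≢0 x≢0 e)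
    ... | isNonsquare none _  = ⊥-elim (none 𝟘 (R.zeroˡ 𝟘))

    η-square : ∀ {s} → ¬ s ≡ 𝟘 → ∀ a → η (s ⊗ s ⊗ a) ≡ η a
    η-square {s} s≢0 a = cong (λ z → z - 1ℤ) (trans (sym (Σᶠ-scale s≢0 (λ x → χ (x ⊗ x ≟ s ⊗ s ⊗ a))))
      (∑-cong elems λ x → χ-⇔ (s ⊗ x ⊗ (s ⊗ x) ≟ s ⊗ s ⊗ a) (x ⊗ x ≟ a)
        (λ h → ⊗-cancelˡ (⊗≢𝟘 s≢0 s≢0) (trans (sym (sw x)) h))
        (λ h → trans (sw x) (cong (s ⊗ s ⊗_) h))))
      where
      sw : ∀ x → s ⊗ x ⊗ (s ⊗ x) ≡ s ⊗ s ⊗ (x ⊗ x)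
      sw x = solve 2 (λ s x → s :* x :* (s :* x) := s :* s :* (x :* x)) refl s x

    η-𝟙 : η 𝟙 ≡ 1ℤ
    η-𝟙 with ηcase 𝟙
    ... | isZero e _          = ⊥-elim (𝟘≢𝟙 (sym e))
    ... | isSquare x x≢0 _ e  = e
    ... | isNonsquare none _  = ⊥-elim (none 𝟙 (R.*-identityˡ 𝟙))

    -- Each x is a square root of exactly one a, so the root counts add up to `size`.
    Ση≡0 : Σᶠ η ≡ 0ℤ
    Ση≡0 = begin
      Σᶠ η ≡⟨ ∑-- elems _ _ ⟩
      Σᶠ (λ a → Σᶠ (λ x → χ (x ⊗ x ≟ a))) - size ≡⟨ cong (λ z → z - size) (∑-swap elems elems _) ⟩
      Σᶠ (λ x → Σᶠ (λ a → χ (x ⊗ x ≟ a))) - size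
        ≡⟨ cong (λ z → z - size) (∑-cong elems λ x → trans
             (∑-cong elems (λ a → χ-⇔ (x ⊗ x ≟ a) (a ≟ x ⊗ x) sym sym)) (once (x ⊗ x))) ⟩
      size - size ≡⟨ +-inverseʳ size ⟩
      0ℤ ∎
      where open ≡-Reasoning

    η≤1 : ∀ a → η a ≤ 1ℤ
    η≤1 a with ηcase a
    ... | isZero _ e        = subst (_≤ 1ℤ) (sym e) (+≤+ ℕ.z≤n)
    ... | isSquare _ _ _ e  = ≤-reflexive e
    ... | isNonsquare _ e   = subst (_≤ 1ℤ) (sym e) -≤+

    -- The sum of η(na) + η(a) over a vanishes although no term is positive.
    η-nonsquare : ∀ {n} → (∀ x → ¬ x ⊗ x ≡ n) → ∀ a → η (n ⊗ a) ≡ - η a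
    η-nonsquare {n} none a = +-cancelʳ-≡ (η a) (trans h≡0 (sym (+-inverseˡ (η a))))
      where
      +-cancelʳ-≡ : ∀ {x y} z → x + z ≡ y + z → x ≡ y
      +-cancelʳ-≡ {x} {y} z h = trans (lem x z) (trans (cong (λ w → w - z) h) (sym (lem y z)))
        where
        lem : ∀ a b → a ≡ a + b - b
        lem = solve-∀
      n≢0 : ¬ n ≡ 𝟘
      n≢0 e = none 𝟘 (trans (R.zeroˡ 𝟘) (sym e))
      h : Carrier → ℤ
      h b = η (n ⊗ b) + η b
      ηn : η n ≡ -1ℤ
      ηn with ηcase n
      ... | isZero e _        = ⊥-elim (n≢0 e)
      ... | isSquare x _ e _  = ⊥-elim (none x e)
      ... | isNonsquare _ e   = e
      h≤0 : ∀ b → h b ≤ 0ℤ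
      h≤0 b with ηcase b
      ... | isZero refl e = ≤-reflexive (cong₂ _+_ (trans (cong η (R.zeroʳ n)) η-𝟘) e)
      ... | isSquare x x≢0 refl e = ≤-reflexive (cong₂ _+_ (trans (cong η (R.*-comm n _)) (trans (η-square x≢0 n) ηn)) e)
      ... | isNonsquare _ e = subst (λ z → η (n ⊗ b) + z ≤ 0ℤ) (sym e) (+-monoˡ-≤ -1ℤ (η≤1 (n ⊗ b)))
      Σh : Σᶠ h ≡ 0ℤ
      Σh = trans (∑-+ elems _ _) (cong₂ _+_ (trans (Σᶠ-scale n≢0 η) Ση≡0) Ση≡0)
      h≡0 : h a ≡ 0ℤ
      h≡0 = ≤-antisym (h≤0 a) (subst₂ _≤_ refl (neg-involutive (h a))
        (neg-mono-≤ (subst (- h a ≤_) (trans (∑-neg elems h) (cong -_ Σh))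
          (∑-term≤ a (λ b → - h b) (λ b → neg-mono-≤ (h≤0 b))))))

    η-⊗ : ∀ a b → η (a ⊗ b) ≡ η a * η b
    η-⊗ a b with ηcase a
    ... | isZero refl e         = trans (cong η (R.zeroˡ b)) (trans η-𝟘 (sym (cong (_* η b) e)))
    ... | isSquare x x≢0 refl e = trans (η-square x≢0 b) (sym (trans (cong (_* η b) e) (*-identityˡ (η b))))
    ... | isNonsquare none e    = trans (η-nonsquare none b) (sym (trans (cong (_* η b) e) (-1*i≡-i (η b))))

    η²≡1 : ∀ {a} → ¬ a ≡ 𝟘 → η a * η a ≡ 1ℤ
    η²≡1 {a} a≢0 with ηcase a
    ... | isZero e _       = ⊥-elim (a≢0 e)
    ... | isSquare _ _ _ e = cong₂ _*_ e e
    ... | isNonsquare _ e  = cong₂ _*_ e e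

    κ : ℤ
    κ = η (⊝ 𝟙)

    κ²≡1 : κ * κ ≡ 1ℤ
    κ²≡1 = η²≡1 (λ e → 𝟘≢𝟙 (sym (⊝≡𝟘 e)))

    Σᶠ-squares : ∀ (f : Carrier → ℤ) → Σᶠ (λ y → f (y ⊗ y)) ≡ Σᶠ f + Σᶠ (λ u → η u * f u)
    Σᶠ-squares f = trans (∑-fibres enum enum elems (λ y → y ⊗ y) f)
      (trans (∑-cong elems (λ u → lem (Σᶠ (λ x → χ (x ⊗ x ≟ u))) (f u))) (∑-+ elems _ _))
      where
      lem : ∀ n f → n * f ≡ f + (n - 1ℤ) * f
      lem = solve-∀

    -- The values y² and ν y² together hit every u exactly twice, because `η` changes sign under
    -- multiplication by ν. This is what pairs a field with its quadratic extension in `Doubling`.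
    Σᶠ-nonsquares : ∀ {ν} → (∀ x → ¬ x ⊗ x ≡ ν) → ∀ (f : Carrier → ℤ) →
                    Σᶠ (λ y → f (y ⊗ y)) + Σᶠ (λ y → f (ν ⊗ (y ⊗ y))) ≡ + 2 * Σᶠ f
    Σᶠ-nonsquares {ν} none f = begin
      Σᶠ (λ y → f (y ⊗ y)) + Σᶠ (λ y → f (ν ⊗ (y ⊗ y)))
        ≡⟨ cong₂ _+_ (Σᶠ-squares f) (Σᶠ-squares (λ u → f (ν ⊗ u))) ⟩
      (Σᶠ f + A) + (Σᶠ (λ u → f (ν ⊗ u)) + Σᶠ (λ u → η u * f (ν ⊗ u)))
        ≡⟨ cong₂ (λ x y → (Σᶠ f + A) + (x + y)) (Σᶠ-scale ν≢0 f) twist ⟩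
      (Σᶠ f + A) + (Σᶠ f + - A) ≡⟨ lem (Σᶠ f) A ⟩
      + 2 * Σᶠ f ∎
      where
      open ≡-Reasoning
      ν≢0 : ¬ ν ≡ 𝟘
      ν≢0 e = none 𝟘 (trans (R.zeroˡ 𝟘) (sym e))
      A = Σᶠ (λ u → η u * f u)
      lem : ∀ x y → (x + y) + (x + - y) ≡ + 2 * x
      lem = solve-∀
      twist : Σᶠ (λ u → η u * f (ν ⊗ u)) ≡ - A
      twist = begin
        Σᶠ (λ u → η u * f (ν ⊗ u))
          ≡⟨ ∑-cong elems (λ u → trans (cong (_* f (ν ⊗ u)) (trans (sym (neg-involutive (η u))) (cong -_ (sym (η-nonsquare none u)))))
               (sym (neg-distribˡ-* (η (ν ⊗ u)) _))) ⟩
        Σᶠ (λ u → - (η (ν ⊗ u) * f (ν ⊗ u))) ≡⟨ Σᶠ-scale ν≢0 (λ u → - (η u * f u)) ⟩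
        Σᶠ (λ u → - (η u * f u)) ≡⟨ ∑-neg elems _ ⟩
        - A ∎

    ∃-nonsquare : ∃ λ ν → ∀ x → ¬ x ⊗ x ≡ ν
    ∃-nonsquare with search enum (λ a → η a ℤₚ.≟ -1ℤ)
    ... | inj₂ none = ⊥-elim (1≰0 (subst₂ _≤_ η-𝟙 Ση≡0 (∑-term≤ 𝟙 η 0≤η)))
      where
      1≰0 : ¬ 1ℤ ≤ 0ℤ
      1≰0 (+≤+ ())
      0≤η : ∀ a → 0ℤ ≤ η a
      0≤η a with ηcase a
      ... | isZero _ e       = ≤-reflexive (sym e)
      ... | isSquare _ _ _ e = subst (0ℤ ≤_) (sym e) (+≤+ ℕ.z≤n)
      ... | isNonsquare _ e  = ⊥-elim (none a e)
    ... | inj₁ (ν , e) with ηcase ν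
    ...   | isZero _ e′       = ⊥-elim (bad (trans (sym e) e′)) where bad : ¬ -1ℤ ≡ 0ℤ ; bad ()
    ...   | isSquare _ _ _ e′ = ⊥-elim (bad (trans (sym e) e′)) where bad : ¬ -1ℤ ≡ 1ℤ ; bad ()
    ...   | isNonsquare ns _  = ν , ns

    -- Summation over one coordinate of the norm form. `T` sends `η` to `φ₀` and `φ₀` to κ q `η`;
    -- the factor κ q is the square of the quadratic Gauss sum.
    T : (Carrier → ℤ) → Carrier → ℤ
    T ψ c = Σᶠ (λ y → ψ (y ⊗ y ⊕ c))

    Σφ₀ : ∀ (f : Carrier → ℤ) → Σᶠ (λ u → φ₀ u * f u) ≡ size * f 𝟘 - Σᶠ f
    Σφ₀ f = begin
      Σᶠ (λ u → φ₀ u * f u) ≡⟨ ∑-cong elems (λ u → lem size (χ (u ≟ 𝟘)) (f u)) ⟩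
      Σᶠ (λ u → size * (χ (u ≟ 𝟘) * f u) - f u) ≡⟨ ∑-- elems _ f ⟩
      Σᶠ (λ u → size * (χ (u ≟ 𝟘) * f u)) - Σᶠ f
        ≡⟨ cong (λ z → z - Σᶠ f) (trans (∑-*ˡ elems size _) (cong (size *_) (∑-δ 𝟘 f))) ⟩
      size * f 𝟘 - Σᶠ f ∎
      where
      open ≡-Reasoning
      lem : ∀ q c f → (q * c - 1ℤ) * f ≡ q * (c * f) - f
      lem = solve-∀

    Σφ₀≡0 : Σᶠ φ₀ ≡ 0ℤ
    Σφ₀≡0 = trans (trans (∑-cong elems (λ u → sym (*-identityʳ (φ₀ u)))) (Σφ₀ (λ _ → 1ℤ))) (lem size)
      where
      lem : ∀ q → q * 1ℤ - q ≡ 0ℤ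
      lem = solve-∀

    T-mean0 : ∀ ψ → Σᶠ ψ ≡ 0ℤ → ∀ c → T ψ c ≡ Σᶠ (λ u → η u * ψ (u ⊕ c))
    T-mean0 ψ h c = trans (Σᶠ-squares (λ u → ψ (u ⊕ c)))
      (trans (cong (λ z → z + Σᶠ (λ u → η u * ψ (u ⊕ c))) (trans (Σᶠ-shift c ψ) h)) (+-identityˡ _))

    -- For u ≠ 0, η(u) η(u + c) = η(1 + c/u) because η(u)² = 1. When c ≠ 0, inverting u leaves a
    -- complete sum of `η` from which only the value η(1) = 1 is missing.
    Tη : ∀ c → T η c ≡ φ₀ c
    Tη c = trans (T-mean0 η Ση≡0 c) (go (c ≟ 𝟘))
      where
      open ≡-Reasoning
      η² : ∀ x → η x * η x ≡ nz x * 1ℤ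
      η² x with x ≟ 𝟘
      ... | yes refl = cong₂ _*_ η-𝟘 η-𝟘
      ... | no x≢0   = η²≡1 x≢0
      term : ∀ u → η u * η (u ⊕ c) ≡ nz u * η (𝟙 ⊕ inv u ⊗ c)
      term u with u ≟ 𝟘
      ... | yes refl = cong (_* η (𝟘 ⊕ c)) η-𝟘
      ... | no u≢0 = begin
        η u * η (u ⊕ c) ≡⟨ cong (λ z → η u * η z) (sym (trans (solve 3 (λ u v c → u :* (con (+ 1) :+ v :* c) := u :+ (u :* v) :* c) refl u (inv u) c)
            (cong (u ⊕_) (trans (cong (_⊗ c) (inv-right u u≢0)) (R.*-identityˡ c))))) ⟩
        η u * η (u ⊗ (𝟙 ⊕ inv u ⊗ c)) ≡⟨ cong (η u *_) (η-⊗ u _) ⟩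
        η u * (η u * η (𝟙 ⊕ inv u ⊗ c)) ≡⟨ sym (*-assoc (η u) (η u) _) ⟩
        η u * η u * η (𝟙 ⊕ inv u ⊗ c) ≡⟨ cong (_* η (𝟙 ⊕ inv u ⊗ c)) (η²≡1 u≢0) ⟩
        1ℤ * η (𝟙 ⊕ inv u ⊗ c) ∎
      go : Dec (c ≡ 𝟘) → Σᶠ (λ u → η u * η (u ⊕ c)) ≡ φ₀ c
      go (yes refl) = begin
        Σᶠ (λ u → η u * η (u ⊕ 𝟘)) ≡⟨ ∑-cong elems (λ u → trans (cong (λ z → η u * η z) (R.+-identityʳ u)) (η² u)) ⟩
        Σᶠ (λ u → nz u * 1ℤ) ≡⟨ Σᶠ-nz (λ _ → 1ℤ) ⟩
        size - 1ℤ ≡⟨ cong (λ z → z - 1ℤ) (sym (trans (cong (size *_) (χ-yes (𝟘 ≟ 𝟘) refl)) (*-identityʳ size))) ⟩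
        φ₀ 𝟘 ∎
      go (no c≢0) = begin
        Σᶠ (λ u → η u * η (u ⊕ c)) ≡⟨ ∑-cong elems term ⟩
        Σᶠ (λ u → nz u * η (𝟙 ⊕ inv u ⊗ c)) ≡⟨ Σᶠ-inv (λ v → η (𝟙 ⊕ v ⊗ c)) ⟩
        Σᶠ (λ v → nz v * η (𝟙 ⊕ v ⊗ c)) ≡⟨ Σᶠ-nz _ ⟩
        Σᶠ (λ v → η (𝟙 ⊕ v ⊗ c)) - η (𝟙 ⊕ 𝟘 ⊗ c)
          ≡⟨ cong₂ _-_ (trans (∑-cong elems (λ v → cong η (solve 2 (λ v c → con (+ 1) :+ v :* c := c :* v :+ con (+ 1)) refl v c)))
               (trans (Σᶠ-scale c≢0 (λ x → η (x ⊕ 𝟙))) (trans (Σᶠ-shift 𝟙 η) Ση≡0)))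
               (trans (cong η (solve 1 (λ c → con (+ 1) :+ con (+ 0) :* c := con (+ 1)) refl c)) η-𝟙) ⟩
        -1ℤ ≡⟨ cong (λ z → z - 1ℤ) (sym (trans (cong (size *_) (χ-no (c ≟ 𝟘) c≢0)) (*-zeroʳ size))) ⟩
        φ₀ c ∎

    -- After a shift the point mass of `φ₀` picks out η(-c) = κ η(c), and its constant part meets
    -- the complete sum of `η`.
    Tφ₀≡η : ∀ c → T φ₀ c ≡ κ * (size * η c)
    Tφ₀≡η c = begin
      T φ₀ c ≡⟨ T-mean0 φ₀ Σφ₀≡0 c ⟩
      Σᶠ (λ u → η u * φ₀ (u ⊕ c)) ≡⟨ sym (Σᶠ-shift (⊝ c) _) ⟩
      Σᶠ (λ u → η (u ⊖ᶠ c) * φ₀ (u ⊖ᶠ c ⊕ c))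
        ≡⟨ ∑-cong elems (λ u → trans (*-comm (η (u ⊖ᶠ c)) _) (cong (λ z → φ₀ z * η (u ⊖ᶠ c)) (solve 2 (λ u c → u :- c :+ c := u) refl u c))) ⟩
      Σᶠ (λ u → φ₀ u * η (u ⊖ᶠ c)) ≡⟨ Σφ₀ (λ u → η (u ⊖ᶠ c)) ⟩
      size * η (𝟘 ⊖ᶠ c) - Σᶠ (λ u → η (u ⊖ᶠ c))
        ≡⟨ cong₂ (λ x y → size * x - y)
             (trans (cong η (solve 1 (λ c → con (+ 0) :- c := :- con (+ 1) :* c) refl c)) (η-⊗ (⊝ 𝟙) c))
             (trans (Σᶠ-shift (⊝ c) η) Ση≡0) ⟩
      size * (κ * η c) - 0ℤ ≡⟨ lem size κ (η c) ⟩
      κ * (size * η c) ∎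
      where
      open ≡-Reasoning
      lem : ∀ a b c → a * (b * c) - 0ℤ ≡ b * (a * c)
      lem = solve-∀

  -- Correlations of a function on the line

  ²-mono : ∀ {y b} → - b ≤ y → y ≤ b → y * y ≤ b * b
  ²-mono {y} {b} l u = 0≤-⇒≤ (subst (0ℤ ≤_) (lem y b) (0≤* (≤⇒0≤- u) (≤⇒0≤- l)))
    where
    lem : ∀ y b → (b - y) * (y - - b) ≡ b * b - y * y
    lem = solve-∀

  n≤4*n : ∀ {n} → 0ℤ ≤ n → n ≤ + 4 * n
  n≤4*n {n} h = 0≤-⇒≤ (subst (0ℤ ≤_) (lem n) (0≤* {+ 3} (+≤+ ℕ.z≤n) h))
    where
    lem : ∀ n → + 3 * n ≡ + 4 * n - n
    lem = solve-∀

  module Correlation (K : EnumField) (g : EnumField.Carrier K → ℤ) where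
    open FieldKit K

    norm : ℤ
    norm = Σᶠ (λ b → g b * g b)

    corr : Carrier → ℤ
    corr u = Σᶠ (λ b → g b * g (b ⊕ u))

    0≤norm : 0ℤ ≤ norm
    0≤norm = ∑-≥0 elems (λ b → 0≤² (g b))

    corr-𝟘 : corr 𝟘 ≡ norm
    corr-𝟘 = ∑-cong elems (λ b → cong (λ z → g b * g z) (R.+-identityʳ b))

    corr-⊝ : ∀ u → corr (⊝ u) ≡ corr u
    corr-⊝ u = trans (sym (Σᶠ-shift u (λ b → g b * g (b ⊕ ⊝ u))))
      (∑-cong elems λ b → trans (cong (λ z → g (b ⊕ u) * g z) (solve 2 (λ b u → b :+ u :+ :- u := b) refl b u)) (*-comm (g (b ⊕ u)) (g b)))

    corr-sum : Σᶠ corr ≡ Σᶠ g * Σᶠ g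
    corr-sum = begin
      Σᶠ (λ u → Σᶠ (λ b → g b * g (b ⊕ u))) ≡⟨ ∑-swap elems elems _ ⟩
      Σᶠ (λ b → Σᶠ (λ u → g b * g (b ⊕ u)))
        ≡⟨ ∑-cong elems (λ b → trans (∑-*ˡ elems (g b) _) (cong (g b *_)
             (trans (∑-cong elems (λ u → cong g (R.+-comm b u))) (Σᶠ-shift b g)))) ⟩
      Σᶠ (λ b → g b * Σᶠ g) ≡⟨ ∑-*ʳ elems g (Σᶠ g) ⟩
      Σᶠ g * Σᶠ g ∎
      where open ≡-Reasoning

    private
      half : ∀ {x} → 0ℤ ≤ + 2 * x → 0ℤ ≤ x
      half {x} h = *-cancelˡ-≤-pos 0ℤ x (+ 2) h

      normʳ : ∀ u → Σᶠ (λ b → g (b ⊕ u) * g (b ⊕ u)) ≡ norm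
      normʳ u = Σᶠ-shift u (λ b → g b * g b)

    corr≤norm : ∀ u → corr u ≤ norm
    corr≤norm u = 0≤-⇒≤ (half (subst (0ℤ ≤_) eq (∑-≥0 elems (λ b → 0≤² (g b - g (b ⊕ u))))))
      where
      open ≡-Reasoning
      lem₁ : ∀ x y → (x - y) * (x - y) ≡ (x * x + y * y) - + 2 * (x * y)
      lem₁ = solve-∀
      lem₂ : ∀ n c → (n + n) - + 2 * c ≡ + 2 * (n - c)
      lem₂ = solve-∀
      eq : Σᶠ (λ b → (g b - g (b ⊕ u)) * (g b - g (b ⊕ u))) ≡ + 2 * (norm - corr u)
      eq = begin
        Σᶠ (λ b → (g b - g (b ⊕ u)) * (g b - g (b ⊕ u))) ≡⟨ ∑-cong elems (λ b → lem₁ (g b) (g (b ⊕ u))) ⟩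
        Σᶠ (λ b → (g b * g b + g (b ⊕ u) * g (b ⊕ u)) - + 2 * (g b * g (b ⊕ u))) ≡⟨ ∑-- elems _ _ ⟩
        Σᶠ (λ b → g b * g b + g (b ⊕ u) * g (b ⊕ u)) - Σᶠ (λ b → + 2 * (g b * g (b ⊕ u)))
          ≡⟨ cong₂ _-_ (trans (∑-+ elems _ _) (cong (λ z → norm + z) (normʳ u))) (∑-*ˡ elems (+ 2) _) ⟩
        (norm + norm) - + 2 * corr u ≡⟨ lem₂ norm (corr u) ⟩
        + 2 * (norm - corr u) ∎

    -norm≤corr : ∀ u → - norm ≤ corr u
    -norm≤corr u = 0≤-⇒≤ (half (subst (0ℤ ≤_) eq (∑-≥0 elems (λ b → 0≤² (g b + g (b ⊕ u))))))
      where
      open ≡-Reasoning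
      lem₁ : ∀ x y → (x + y) * (x + y) ≡ (x * x + y * y) + + 2 * (x * y)
      lem₁ = solve-∀
      lem₂ : ∀ n c → (n + n) + + 2 * c ≡ + 2 * (c - - n)
      lem₂ = solve-∀
      eq : Σᶠ (λ b → (g b + g (b ⊕ u)) * (g b + g (b ⊕ u))) ≡ + 2 * (corr u - - norm)
      eq = begin
        Σᶠ (λ b → (g b + g (b ⊕ u)) * (g b + g (b ⊕ u))) ≡⟨ ∑-cong elems (λ b → lem₁ (g b) (g (b ⊕ u))) ⟩
        Σᶠ (λ b → (g b * g b + g (b ⊕ u) * g (b ⊕ u)) + + 2 * (g b * g (b ⊕ u))) ≡⟨ ∑-+ elems _ _ ⟩
        Σᶠ (λ b → g b * g b + g (b ⊕ u) * g (b ⊕ u)) + Σᶠ (λ b → + 2 * (g b * g (b ⊕ u)))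
          ≡⟨ cong₂ _+_ (trans (∑-+ elems _ _) (cong (λ z → norm + z) (normʳ u))) (∑-*ˡ elems (+ 2) _) ⟩
        (norm + norm) + + 2 * corr u ≡⟨ lem₂ norm (corr u) ⟩
        + 2 * (corr u - - norm) ∎

    -- On the Fourier side this is an average, with nonnegative weights proportional to |ĝ(a)|², of
    -- the Kloosterman sums of the characters e(a(x + c/x)).
    kloosterman : Carrier → ℤ
    kloosterman c = Σᶠ (λ x → nz x * corr (x ⊕ c ⊗ inv x))

  module LineKernels (K : EnumField) (𝟚≢𝟘 : ¬ FieldKit.𝟚 K ≡ FieldKit.𝟘 K)
                     (g : EnumField.Carrier K → ℤ) (Σg≡0 : ∑ (EnumField.elems K) g ≡ 0ℤ) where
    open QuadraticCharacter K 𝟚≢𝟘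
    open Correlation K g

    Σcorr≡0 : Σᶠ corr ≡ 0ℤ
    Σcorr≡0 = trans corr-sum (cong₂ _*_ Σg≡0 Σg≡0)

    -- The contribution of a single direction of norm r; u is the difference of the positions of two
    -- slices.
    lineSum : (ψ : Carrier → ℤ) (t r : Carrier) → ℤ
    lineSum ψ t r = Σᶠ (λ u → Σᶠ (λ w → nz w * ψ (r ⊗ (w ⊗ w) ⊕ u ⊗ w ⊕ t)) * corr u)

    private
      𝟜 : Carrier
      𝟜 = 𝟚 ⊗ 𝟚

      -- Completing the square: 4r (r w² + u w + t) = (2 r w + u)² + 4 r t - u². Since η(4) = 1 and
      -- η(r)² = 1, `Tη` evaluates what is left.
      Ση-quadratic : ∀ {r} → ¬ r ≡ 𝟘 → ∀ u t →
        Σᶠ (λ w → η (r ⊗ (w ⊗ w) ⊕ u ⊗ w ⊕ t)) ≡ η r * φ₀ (𝟜 ⊗ r ⊗ t ⊖ᶠ u ⊗ u)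
      Ση-quadratic {r} r≢0 u t = begin
        Σᶠ (λ w → η (r ⊗ (w ⊗ w) ⊕ u ⊗ w ⊕ t)) ≡⟨ ∑-cong elems twist ⟩
        Σᶠ (λ w → η r * η (y w ⊗ y w ⊕ D)) ≡⟨ ∑-*ˡ elems (η r) _ ⟩
        η r * Σᶠ (λ w → η (y w ⊗ y w ⊕ D)) ≡⟨ cong (η r *_) (Σᶠ-scale 2r≢0 (λ v → η ((v ⊕ u) ⊗ (v ⊕ u) ⊕ D))) ⟩
        η r * Σᶠ (λ v → η ((v ⊕ u) ⊗ (v ⊕ u) ⊕ D)) ≡⟨ cong (η r *_) (Σᶠ-shift u (λ v → η (v ⊗ v ⊕ D))) ⟩
        η r * T η D ≡⟨ cong (η r *_) (Tη D) ⟩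
        η r * φ₀ D ∎
        where
        open ≡-Reasoning
        D = 𝟜 ⊗ r ⊗ t ⊖ᶠ u ⊗ u
        2r≢0 : ¬ 𝟚 ⊗ r ≡ 𝟘
        2r≢0 = ⊗≢𝟘 𝟚≢𝟘 r≢0
        y : Carrier → Carrier
        y w = 𝟚 ⊗ r ⊗ w ⊕ u
        twist : ∀ w → η (r ⊗ (w ⊗ w) ⊕ u ⊗ w ⊕ t) ≡ η r * η (y w ⊗ y w ⊕ D)
        twist w = sym (begin
          η r * η (y w ⊗ y w ⊕ D) ≡⟨ cong (λ z → η r * η z) (solve 4 (λ r u w t →
            (con (+ 2) :* r :* w :+ u) :* (con (+ 2) :* r :* w :+ u) :+ (con (+ 2) :* con (+ 2) :* r :* t :- u :* u)
            := con (+ 2) :* con (+ 2) :* (r :* (r :* (w :* w) :+ u :* w :+ t))) refl r u w t) ⟩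
          η r * η (𝟜 ⊗ (r ⊗ z)) ≡⟨ cong (η r *_) (trans (η-square 𝟚≢𝟘 _) (η-⊗ r z)) ⟩
          η r * (η r * η z) ≡⟨ sym (*-assoc (η r) (η r) (η z)) ⟩
          η r * η r * η z ≡⟨ cong (_* η z) (η²≡1 r≢0) ⟩
          1ℤ * η z ≡⟨ *-identityˡ (η z) ⟩
          η z ∎)
          where z = r ⊗ (w ⊗ w) ⊕ u ⊗ w ⊕ t

      Ση-linear : ∀ u t → Σᶠ (λ w → η (u ⊗ w ⊕ t)) ≡ χ (u ≟ 𝟘) * (size * η t)
      Ση-linear u t with u ≟ 𝟘
      ... | yes refl = trans (∑-cong elems (λ w → cong η (solve 2 (λ w t → con (+ 0) :* w :+ t := t) refl w t)))
                         (trans (∑-const (η t)) (sym (*-identityˡ _)))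
      ... | no u≢0   = trans (Σᶠ-scale u≢0 (λ v → η (v ⊕ t))) (trans (Σᶠ-shift t η) Ση≡0)

      -- The omitted term w = 0 has the value η(t) for every u, so `Σcorr≡0` kills it and w may
      -- range over the whole field.
      lineSum-η : ∀ t r → lineSum η t r ≡ Σᶠ (λ u → Σᶠ (λ w → η (r ⊗ (w ⊗ w) ⊕ u ⊗ w ⊕ t)) * corr u)
      lineSum-η t r = begin
        lineSum η t r ≡⟨ ∑-cong elems (λ u → trans (cong (_* corr u) (trans (Σᶠ-nz _) (cong (λ z → A u - η z) (at0 u)))) (dist (A u) (η t) (corr u))) ⟩
        Σᶠ (λ u → A u * corr u - η t * corr u) ≡⟨ ∑-- elems _ _ ⟩
        Σᶠ (λ u → A u * corr u) - Σᶠ (λ u → η t * corr u) ≡⟨ cong (λ z → Σᶠ (λ u → A u * corr u) - z) (trans (∑-*ˡ elems (η t) corr) (trans (cong (η t *_) Σcorr≡0) (*-zeroʳ (η t)))) ⟩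
        Σᶠ (λ u → A u * corr u) - 0ℤ ≡⟨ +-identityʳ _ ⟩
        Σᶠ (λ u → A u * corr u) ∎
        where
        open ≡-Reasoning
        A : Carrier → ℤ
        A u = Σᶠ (λ w → η (r ⊗ (w ⊗ w) ⊕ u ⊗ w ⊕ t))
        at0 : ∀ u → r ⊗ (𝟘 ⊗ 𝟘) ⊕ u ⊗ 𝟘 ⊕ t ≡ t
        at0 u = solve 3 (λ r u t → r :* (con (+ 0) :* con (+ 0)) :+ u :* con (+ 0) :+ t := t) refl r u t
        dist : ∀ a b c → (a - b) * c ≡ a * c - b * c
        dist = solve-∀

    -- For r ≠ 0 only the u with u² = 4 r t survive, at most two of them, each with |corr u| ≤
    -- `norm`; for r = 0 only u = 0 survives.
    lineSum-η-bound : ∀ {t} → ¬ t ≡ 𝟘 → ∀ r →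
      lineSum η t r * lineSum η t r ≤ + 4 * (size * size) * (norm * norm)
    lineSum-η-bound {t} t≢0 r with r ≟ 𝟘
    ... | yes refl = subst₂ _≤_ (sym (trans (cong₂ _*_ eq eq) ss)) (sym (*-assoc (+ 4) (size * size) (norm * norm)))
        (n≤4*n (0≤* (0≤² size) (0≤² norm)))
      where
      open ≡-Reasoning
      s = size * η t * norm
      sq : ∀ a b c → a * b * c * (a * b * c) ≡ b * b * (a * a * (c * c))
      sq = solve-∀
      ss : s * s ≡ size * size * (norm * norm)
      ss = trans (sq size (η t) norm) (trans (cong (_* (size * size * (norm * norm))) (η²≡1 t≢0)) (*-identityˡ _))
      eq : lineSum η t 𝟘 ≡ s
      eq = begin
        lineSum η t 𝟘 ≡⟨ lineSum-η t 𝟘 ⟩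
        Σᶠ (λ u → Σᶠ (λ w → η (𝟘 ⊗ (w ⊗ w) ⊕ u ⊗ w ⊕ t)) * corr u)
          ≡⟨ ∑-cong elems (λ u → trans (cong (_* corr u) (trans (∑-cong elems (λ w → cong η (solve 3 (λ w u t → con (+ 0) :* (w :* w) :+ u :* w :+ t := u :* w :+ t) refl w u t))) (Ση-linear u t))) (*-assoc (χ (u ≟ 𝟘)) (size * η t) (corr u))) ⟩
        Σᶠ (λ u → χ (u ≟ 𝟘) * (size * η t * corr u)) ≡⟨ ∑-δ 𝟘 _ ⟩
        size * η t * corr 𝟘 ≡⟨ cong (size * η t *_) corr-𝟘 ⟩
        s ∎
    ... | no r≢0 = subst₂ _≤_ (sym lhs) (rhs size norm) (*ˡ-≤ (0≤² size) (²-mono {Y} {+ 2 * norm} lower upper))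
      where
      open ≡-Reasoning
      Y = Σᶠ (λ u → χ (u ⊗ u ≟ 𝟜 ⊗ r ⊗ t) * corr u)
      N = Σᶠ (λ u → χ (u ⊗ u ≟ 𝟜 ⊗ r ⊗ t))
      rhs : ∀ q n → q * q * (+ 2 * n * (+ 2 * n)) ≡ + 4 * (q * q) * (n * n)
      rhs = solve-∀
      N≤2 : N ≤ + 2
      N≤2 = subst (_≤ + 2) (lem N) (+-monoˡ-≤ 1ℤ (η≤1 (𝟜 ⊗ r ⊗ t)))
        where
        lem : ∀ a → (a - 1ℤ) + 1ℤ ≡ a
        lem = solve-∀
      upper : Y ≤ + 2 * norm
      upper = ≤-trans (∑-mono elems (λ u → *ˡ-≤ (0≤χ (u ⊗ u ≟ 𝟜 ⊗ r ⊗ t)) (corr≤norm u)))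
        (≤-trans (≤-reflexive (∑-*ʳ elems _ norm)) (*ʳ-≤ 0≤norm N≤2))
      lower : - (+ 2 * norm) ≤ Y
      lower = ≤-trans (≤-reflexive (neg-distribʳ-* (+ 2) norm))
        (≤-trans (subst₂ _≤_ (n1 norm) (n2 N norm) (neg-mono-≤ (*ʳ-≤ 0≤norm N≤2)))
         (≤-trans (≤-reflexive (sym (∑-*ʳ elems _ (- norm))))
           (∑-mono elems (λ u → *ˡ-≤ (0≤χ (u ⊗ u ≟ 𝟜 ⊗ r ⊗ t)) (-norm≤corr u)))))
        where
        n1 : ∀ n → - (+ 2 * n) ≡ + 2 * - n
        n1 = solve-∀
        n2 : ∀ m n → - (m * n) ≡ m * - n
        n2 = solve-∀
      eq : lineSum η t r ≡ η r * (size * Y)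
      eq = begin
        lineSum η t r ≡⟨ lineSum-η t r ⟩
        Σᶠ (λ u → Σᶠ (λ w → η (r ⊗ (w ⊗ w) ⊕ u ⊗ w ⊕ t)) * corr u)
          ≡⟨ ∑-cong elems (λ u → trans (cong (_* corr u) (trans (Ση-quadratic r≢0 u t) (cong (λ z → η r * (size * z - 1ℤ)) (χ-⇔ (𝟜 ⊗ r ⊗ t ⊖ᶠ u ⊗ u ≟ 𝟘) (u ⊗ u ≟ 𝟜 ⊗ r ⊗ t) (λ h → sym (⊖≡𝟘 h)) (λ h → trans (cong (λ z → 𝟜 ⊗ r ⊗ t ⊖ᶠ z) h) (R.-‿inverseʳ _))))))
               (ex (η r) size (χ (u ⊗ u ≟ 𝟜 ⊗ r ⊗ t)) (corr u))) ⟩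
        Σᶠ (λ u → η r * (size * (χ (u ⊗ u ≟ 𝟜 ⊗ r ⊗ t) * corr u) - corr u)) ≡⟨ ∑-*ˡ elems (η r) _ ⟩
        η r * Σᶠ (λ u → size * (χ (u ⊗ u ≟ 𝟜 ⊗ r ⊗ t) * corr u) - corr u)
          ≡⟨ cong (η r *_) (trans (∑-- elems _ _) (trans (cong₂ _-_ (∑-*ˡ elems size _) Σcorr≡0) (+-identityʳ _))) ⟩
        η r * (size * Y) ∎
        where
        ex : ∀ a q c y → a * (q * c - 1ℤ) * y ≡ a * (q * (c * y) - y)
        ex = solve-∀
      lhs : lineSum η t r * lineSum η t r ≡ size * size * (Y * Y)
      lhs = begin
        lineSum η t r * lineSum η t r ≡⟨ cong₂ _*_ eq eq ⟩
        η r * (size * Y) * (η r * (size * Y)) ≡⟨ sq (η r) size Y ⟩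
        η r * η r * (size * size * (Y * Y)) ≡⟨ cong (_* (size * size * (Y * Y))) (η²≡1 r≢0) ⟩
        1ℤ * (size * size * (Y * Y)) ≡⟨ *-identityˡ _ ⟩
        size * size * (Y * Y) ∎
        where
        sq : ∀ a q y → a * (q * y) * (a * (q * y)) ≡ a * a * (q * q * (y * y))
        sq = solve-∀

    private
      -- For w ≠ 0 the quadratic vanishes at the single point u = -(r w + t/w). The constant part of
      -- `φ₀` disappears by `Σcorr≡0`, and the sign because `corr` is even.
      lineSum-φ₀ : ∀ t r → lineSum φ₀ t r ≡ size * Σᶠ (λ w → nz w * corr (r ⊗ w ⊕ t ⊗ inv w))
      lineSum-φ₀ t r = begin
        Σᶠ (λ u → Σᶠ (λ w → nz w * φ₀ (f u w)) * corr u)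
          ≡⟨ ∑-cong elems (λ u → trans (sym (∑-*ʳ elems _ (corr u))) (∑-cong elems (λ w → *-assoc (nz w) _ _))) ⟩
        Σᶠ (λ u → Σᶠ (λ w → nz w * (φ₀ (f u w) * corr u))) ≡⟨ ∑-swap elems elems _ ⟩
        Σᶠ (λ w → Σᶠ (λ u → nz w * (φ₀ (f u w) * corr u)))
          ≡⟨ ∑-cong elems (λ w → trans (∑-*ˡ elems (nz w) _) (nz-guard w (inner w))) ⟩
        Σᶠ (λ w → nz w * (size * corr (r ⊗ w ⊕ t ⊗ inv w)))
          ≡⟨ trans (∑-cong elems (λ w → comm (nz w) size (corr (r ⊗ w ⊕ t ⊗ inv w)))) (∑-*ˡ elems size _) ⟩
        size * Σᶠ (λ w → nz w * corr (r ⊗ w ⊕ t ⊗ inv w)) ∎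
        where
        open ≡-Reasoning
        comm : ∀ a b c → a * (b * c) ≡ b * (a * c)
        comm = solve-∀
        f : Carrier → Carrier → Carrier
        f u w = r ⊗ (w ⊗ w) ⊕ u ⊗ w ⊕ t
        ex : ∀ q c y → (q * c - 1ℤ) * y ≡ q * (c * y) - y
        ex = solve-∀
        inner : ∀ w → ¬ w ≡ 𝟘 → Σᶠ (λ u → φ₀ (f u w) * corr u) ≡ size * corr (r ⊗ w ⊕ t ⊗ inv w)
        inner w w≢0 = begin
          Σᶠ (λ u → φ₀ (f u w) * corr u) ≡⟨ ∑-cong elems (λ u → trans (cong (λ z → (size * z - 1ℤ) * corr u)
              (χ-⇔ (f u w ≟ 𝟘) (u ≟ u₀) (to u) (from u))) (ex size (χ (u ≟ u₀)) (corr u))) ⟩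
          Σᶠ (λ u → size * (χ (u ≟ u₀) * corr u) - corr u)
            ≡⟨ trans (∑-- elems _ _) (trans (cong₂ _-_ (trans (∑-*ˡ elems size _) (cong (size *_) (∑-δ u₀ corr))) Σcorr≡0) (+-identityʳ _)) ⟩
          size * corr u₀ ≡⟨ cong (size *_) (corr-⊝ _) ⟩
          size * corr (r ⊗ w ⊕ t ⊗ inv w) ∎
          where
          u₀ = ⊝ (r ⊗ w ⊕ t ⊗ inv w)
          expand : ∀ u → w ⊗ (u ⊖ᶠ u₀) ≡ f u w ⊕ t ⊗ (w ⊗ inv w ⊖ᶠ 𝟙)
          expand u = solve 5 (λ r u w t v → w :* (u :- (:- (r :* w :+ t :* v))) := r :* (w :* w) :+ u :* w :+ t :+ t :* (w :* v :- con (+ 1))) refl r u w t (inv w)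
          key : ∀ u → w ⊗ (u ⊖ᶠ u₀) ≡ f u w
          key u = trans (expand u) (trans (cong (λ z → f u w ⊕ t ⊗ (z ⊖ᶠ 𝟙)) (inv-right w w≢0))
            (solve 2 (λ a t → a :+ t :* (con (+ 1) :- con (+ 1)) := a) refl (f u w) t))
          to : ∀ u → f u w ≡ 𝟘 → u ≡ u₀
          to u h = ⊖≡𝟘 (⊗≡𝟘ʳ w≢0 (trans (key u) h))
          from : ∀ u → u ≡ u₀ → f u w ≡ 𝟘
          from u h = trans (sym (key u)) (trans (cong (λ z → w ⊗ (z ⊖ᶠ u₀)) h) (solve 2 (λ w u → w :* (u :- u) := con (+ 0)) refl w u₀))

    -- For r ≠ 0 the substitution x = r w produces the Kloosterman sum with parameter r t. For r = 0
    -- the argument t/w runs through the nonzero elements, so that the sum is just - `norm`.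
    lineSum-φ₀-bound :
      (∀ c → ¬ c ≡ 𝟘 → kloosterman c * kloosterman c ≤ + 4 * size * (norm * norm)) →
      1ℤ ≤ size → ∀ {t} → ¬ t ≡ 𝟘 → ∀ r →
      lineSum φ₀ t r * lineSum φ₀ t r ≤ + 4 * (size * (size * size)) * (norm * norm)
    lineSum-φ₀-bound weil 1≤q {t} t≢0 r = subst₂ _≤_ (sym (trans (cong₂ _*_ (lineSum-φ₀ t r) (lineSum-φ₀ t r)) (sq size S)))
        (rhs size norm) (*ˡ-≤ (0≤² size) S²≤)
      where
      open ≡-Reasoning
      S = Σᶠ (λ w → nz w * corr (r ⊗ w ⊕ t ⊗ inv w))
      sq : ∀ q s → q * s * (q * s) ≡ q * q * (s * s)
      sq = solve-∀
      rhs : ∀ q n → q * q * (+ 4 * q * (n * n)) ≡ + 4 * (q * (q * q)) * (n * n)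
      rhs = solve-∀
      S²≤ : S * S ≤ + 4 * size * (norm * norm)
      S²≤ with r ≟ 𝟘
      ... | yes refl = subst (_≤ + 4 * size * (norm * norm)) (sym (trans (cong₂ _*_ S≡ S≡) (neg² norm)))
            (*ʳ-≤ (0≤² norm) (≤-trans 1≤q (n≤4*n (≤-trans (+≤+ ℕ.z≤n) 1≤q))))
        where
        neg² : ∀ n → - n * - n ≡ 1ℤ * (n * n)
        neg² = solve-∀
        S≡ : Σᶠ (λ w → nz w * corr (𝟘 ⊗ w ⊕ t ⊗ inv w)) ≡ - norm
        S≡ = begin
          Σᶠ (λ w → nz w * corr (𝟘 ⊗ w ⊕ t ⊗ inv w)) ≡⟨ ∑-cong elems (λ w → cong (λ z → nz w * corr z) (solve 2 (λ w y → con (+ 0) :* w :+ y := y) refl w (t ⊗ inv w))) ⟩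
          Σᶠ (λ w → nz w * corr (t ⊗ inv w)) ≡⟨ Σᶠ-inv (λ v → corr (t ⊗ v)) ⟩
          Σᶠ (λ w → nz w * corr (t ⊗ w)) ≡⟨ Σᶠ-nz _ ⟩
          Σᶠ (λ w → corr (t ⊗ w)) - corr (t ⊗ 𝟘) ≡⟨ cong₂ _-_ (trans (Σᶠ-scale t≢0 corr) Σcorr≡0) (trans (cong corr (R.zeroʳ t)) corr-𝟘) ⟩
          0ℤ - norm ≡⟨ +-identityˡ _ ⟩
          - norm ∎
      ... | no r≢0 = subst (λ z → z * z ≤ + 4 * size * (norm * norm)) (sym S≡) (weil (r ⊗ t) (⊗≢𝟘 r≢0 t≢0))
        where
        S≡ : S ≡ kloosterman (r ⊗ t)
        S≡ = begin
          S ≡⟨ ∑-cong elems step ⟩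
          Σᶠ (λ w → nz (r ⊗ w) * corr (r ⊗ w ⊕ r ⊗ t ⊗ inv (r ⊗ w))) ≡⟨ Σᶠ-scale r≢0 (λ x → nz x * corr (x ⊕ r ⊗ t ⊗ inv x)) ⟩
          kloosterman (r ⊗ t) ∎
          where
          step : ∀ w → nz w * corr (r ⊗ w ⊕ t ⊗ inv w) ≡ nz (r ⊗ w) * corr (r ⊗ w ⊕ r ⊗ t ⊗ inv (r ⊗ w))
          step w with w ≟ 𝟘
          ... | yes refl = sym (trans (cong (λ z → nz z * corr (r ⊗ 𝟘 ⊕ r ⊗ t ⊗ inv (r ⊗ 𝟘))) (R.zeroʳ r)) (cong (_* corr (r ⊗ 𝟘 ⊕ r ⊗ t ⊗ inv (r ⊗ 𝟘))) nz-𝟘))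
          ... | no w≢0 = cong₂ _*_ (sym (nz-≢ (⊗≢𝟘 r≢0 w≢0))) (cong (λ z → corr (r ⊗ w ⊕ z)) (begin
            t ⊗ inv w ≡⟨ cong (t ⊗_) (sym (R.*-identityˡ (inv w))) ⟩
            t ⊗ (𝟙 ⊗ inv w) ≡⟨ cong (λ z → t ⊗ (z ⊗ inv w)) (sym (inv-right r r≢0)) ⟩
            t ⊗ (r ⊗ inv r ⊗ inv w) ≡⟨ solve 4 (λ t r a b → t :* (r :* a :* b) := r :* t :* (a :* b)) refl t r (inv r) (inv w) ⟩
            r ⊗ t ⊗ (inv r ⊗ inv w) ≡⟨ cong (r ⊗ t ⊗_) (sym (inv-unique (begin
              r ⊗ w ⊗ (inv r ⊗ inv w) ≡⟨ solve 4 (λ r w a b → r :* w :* (a :* b) := r :* a :* (w :* b)) refl r w (inv r) (inv w) ⟩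
              r ⊗ inv r ⊗ (w ⊗ inv w) ≡⟨ cong₂ _⊗_ (inv-right r r≢0) (inv-right w w≢0) ⟩
              𝟙 ⊗ 𝟙 ≡⟨ R.*-identityˡ 𝟙 ⟩
              𝟙 ∎))) ⟩
            r ⊗ t ⊗ inv (r ⊗ w) ∎))

  -- Counting pairs at a given distance

  ²≤²⇒≤ : ∀ {a b} → 0ℤ ≤ b → a * a ≤ b * b → a ≤ b
  ²≤²⇒≤ {a} {b} 0≤b h with ℤₚ.<-cmp a b
  ... | tri< a<b _ _  = <⇒≤ a<b
  ... | tri≈ _ refl _ = ≤-refl
  ... | tri> _ _ b<a  = ⊥-elim (<-irrefl refl (<-≤-trans (≤-<-trans (*ˡ-≤ 0≤b (<⇒≤ b<a)) (*-monoʳ-<-pos a ⦃ positive (≤-<-trans 0≤b b<a) ⦄ b<a)) h))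

  -- The triangle inequality for |X x| ≤ √c · n x, kept free of square roots: the cross terms are
  -- compared through the product of two squared bounds.
  ∑-²≤ : {A : Set} (xs : List A) {X n : A → ℤ} {c : ℤ} → 0ℤ ≤ c → (∀ x → 0ℤ ≤ n x) →
         (∀ x → X x * X x ≤ c * (n x * n x)) → ∑ xs X * ∑ xs X ≤ c * (∑ xs n * ∑ xs n)
  ∑-²≤ []       {c = c} _ _ _ = ≤-reflexive (sym (*-zeroʳ c))
  ∑-²≤ (i ∷ xs) {X} {n} {c} 0≤c 0≤n h = subst₂ _≤_ (sym (sq (X i) (∑ xs X))) (sym (sqc c (n i) (∑ xs n)))
      (+-mono-≤ (+-mono-≤ (h i) (*ˡ-≤ {+ 2} (+≤+ ℕ.z≤n) cross)) IH)
    where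
    IH = ∑-²≤ xs {X} {n} 0≤c 0≤n h
    sq : ∀ a b → (a + b) * (a + b) ≡ a * a + + 2 * (a * b) + b * b
    sq = solve-∀
    sqc : ∀ c a b → c * ((a + b) * (a + b)) ≡ c * (a * a) + + 2 * (c * (a * b)) + c * (b * b)
    sqc = solve-∀
    p1 : ∀ a b → a * a * (b * b) ≡ a * b * (a * b)
    p1 = solve-∀
    p2 : ∀ c a b → c * (a * a) * (c * (b * b)) ≡ c * (a * b) * (c * (a * b))
    p2 = solve-∀
    0≤N : 0ℤ ≤ ∑ xs n
    0≤N = ∑-≥0 xs 0≤n
    cross : X i * ∑ xs X ≤ c * (n i * ∑ xs n)
    cross = ²≤²⇒≤ (0≤* 0≤c (0≤* (0≤n i) 0≤N)) (subst₂ _≤_ (p1 (X i) (∑ xs X)) (p2 c (n i) (∑ xs n))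
      (*-≤-* (0≤² (X i)) (0≤* 0≤c (0≤² (∑ xs n))) (h i) IH))

  module _ {A : Set} (EA : Enum A) where
    open Enum EA

    ∑-unique : ∀ {xs} → Unique xs → ∑[ x ∈ xs ] ∑[ y ∈ xs ] χ (y ≟ x) ≡ ∑[ x ∈ xs ] 1ℤ
    ∑-unique AP.[] = refl
    ∑-unique {x ∷ xs} (x∉ AP.∷ u) = begin
      χ (x ≟ x) + (∑[ y ∈ xs ] χ (y ≟ x)) + (∑[ z ∈ xs ] (χ (x ≟ z) + (∑[ y ∈ xs ] χ (y ≟ z))))
        ≡⟨ cong₂ _+_ (cong₂ _+_ (χ-yes (x ≟ x) refl) (zeroˡ x∉)) (trans (∑-+ xs _ _) (cong₂ _+_ (zeroʳ x∉) (∑-unique u))) ⟩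
      1ℤ + 0ℤ + (0ℤ + (∑[ z ∈ xs ] 1ℤ)) ≡⟨ lem (∑[ z ∈ xs ] 1ℤ) ⟩
      1ℤ + (∑[ z ∈ xs ] 1ℤ) ∎
      where
      open ≡-Reasoning
      lem : ∀ a → 1ℤ + 0ℤ + (0ℤ + a) ≡ 1ℤ + a
      lem = solve-∀
      zeroˡ : ∀ {ys} → All.All (λ y → ¬ x ≡ y) ys → ∑[ y ∈ ys ] χ (y ≟ x) ≡ 0ℤ
      zeroˡ All.[] = refl
      zeroˡ (n All.∷ ns) = cong₂ _+_ (χ-no (_ ≟ x) (λ e → n (sym e))) (zeroˡ ns)
      zeroʳ : ∀ {ys} → All.All (λ y → ¬ x ≡ y) ys → ∑[ y ∈ ys ] χ (x ≟ y) ≡ 0ℤ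
      zeroʳ All.[] = refl
      zeroʳ (n All.∷ ns) = cong₂ _+_ (χ-no (x ≟ _) n) (zeroʳ ns)

  module Geometry (K : EnumField) where
    open FieldKit K public

    Pt : ℕ → Set
    Pt d = Vec Carrier d

    ptEnum : ∀ d → Enum (Pt d)
    ptEnum = vecEnum enum

    Σᵛ : ∀ d → (Pt d → ℤ) → ℤ
    Σᵛ d = ∑ (tuples d elems)

    nrm : ∀ {d} → Pt d → Carrier
    nrm []      = 𝟘
    nrm (x ∷ v) = x ⊗ x ⊕ nrm v

    infixl 6 _-ᵖ_
    _-ᵖ_ : ∀ {d} → Pt d → Pt d → Pt d
    []      -ᵖ []      = []
    (x ∷ v) -ᵖ (y ∷ w) = (x ⊖ᶠ y) ∷ (v -ᵖ w)

    0ᵖ : ∀ {d} → Pt d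
    0ᵖ {zero}  = []
    0ᵖ {suc d} = 𝟘 ∷ 0ᵖ

    -- The polar form of `nrm`, twice the inner product: the coefficient of w in `nrm-affine`.
    β : ∀ {d} → Pt d → Pt d → Carrier
    β []      []      = 𝟘
    β (x ∷ v) (ξ ∷ ζ) = 𝟚 ⊗ x ⊗ ξ ⊕ β v ζ

    -ᵖ≡0 : ∀ {d} (x y : Pt d) → x -ᵖ y ≡ 0ᵖ → x ≡ y
    -ᵖ≡0 []      []      _ = refl
    -ᵖ≡0 (x ∷ v) (y ∷ w) h = cong₂ _∷_ (⊖≡𝟘 (cong Vec.head h)) (-ᵖ≡0 v w (cong Vec.tail h))

    -ᵖ-self : ∀ {d} (x : Pt d) → x -ᵖ x ≡ 0ᵖ
    -ᵖ-self []      = refl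
    -ᵖ-self (x ∷ v) = cong₂ _∷_ (R.-‿inverseʳ x) (-ᵖ-self v)

    β-diff : ∀ {d} (x y ξ : Pt d) → β (x -ᵖ y) ξ ≡ β x ξ ⊖ᶠ β y ξ
    β-diff []      []      []      = sym (R.-‿inverseʳ 𝟘)
    β-diff (x ∷ v) (y ∷ w) (ξ ∷ ζ) = trans (cong (𝟚 ⊗ (x ⊖ᶠ y) ⊗ ξ ⊕_) (β-diff v w ζ))
      (solve 5 (λ x y ξ a b → con (+ 2) :* (x :- y) :* ξ :+ (a :- b) := (con (+ 2) :* x :* ξ :+ a) :- (con (+ 2) :* y :* ξ :+ b)) refl x y ξ (β v ζ) (β w ζ))

    affine : ∀ {d} → Carrier → Pt d → Pt d → Pt d
    affine w []      []      = []
    affine w (x ∷ v) (ξ ∷ ζ) = (w ⊗ ξ ⊕ x) ∷ affine w v ζ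

    unaffine : ∀ {d} → Carrier → Pt d → Pt d → Pt d
    unaffine w []      []      = []
    unaffine w (x ∷ v) (ξ ∷ ζ) = (inv w ⊗ (ξ ⊖ᶠ x)) ∷ unaffine w v ζ

    module _ {w} (w≢0 : ¬ w ≡ 𝟘) where
      unaffine-affine : ∀ {d} (v ξ : Pt d) → unaffine w v (affine w v ξ) ≡ ξ
      unaffine-affine []      []      = refl
      unaffine-affine (x ∷ v) (ξ ∷ ζ) = cong₂ _∷_ (trans (cong (inv w ⊗_) (solve 2 (λ a x → a :+ x :- x := a) refl (w ⊗ ξ) x)) (inv-a⊗[a⊗b] ξ w≢0)) (unaffine-affine v ζ)

      affine-unaffine : ∀ {d} (v ξ : Pt d) → affine w v (unaffine w v ξ) ≡ ξ
      affine-unaffine []      []      = refl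
      affine-unaffine (x ∷ v) (ξ ∷ ζ) = cong₂ _∷_ (trans (cong (_⊕ x) (a⊗[inv-a⊗b] (ξ ⊖ᶠ x) w≢0)) (solve 2 (λ a x → a :- x :+ x := a) refl ξ x)) (affine-unaffine v ζ)

      Σᵛ-affine : ∀ {d} (v : Pt d) (f : Pt d → ℤ) → Σᵛ d (λ ξ → f (affine w v ξ)) ≡ Σᵛ d f
      Σᵛ-affine {d} v = ∑-reindex (ptEnum d) (ptEnum d) (affine w v) (unaffine w v) (unaffine-affine v) (affine-unaffine v)

    nrm-affine : ∀ {d} w (v ξ : Pt d) → nrm (affine w v ξ) ≡ nrm ξ ⊗ (w ⊗ w) ⊕ β v ξ ⊗ w ⊕ nrm v
    nrm-affine w []      []      = solve 1 (λ w → con (+ 0) := con (+ 0) :* (w :* w) :+ con (+ 0) :* w :+ con (+ 0)) refl w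
    nrm-affine w (x ∷ v) (ξ ∷ ζ) = trans (cong ((w ⊗ ξ ⊕ x) ⊗ (w ⊗ ξ ⊕ x) ⊕_) (nrm-affine w v ζ))
      (solve 6 (λ w x ξ n b m → (w :* ξ :+ x) :* (w :* ξ :+ x) :+ (n :* (w :* w) :+ b :* w :+ m)
        := (ξ :* ξ :+ n) :* (w :* w) :+ (con (+ 2) :* x :* ξ :+ b) :* w :+ (x :* x :+ m)) refl w x ξ (nrm ζ) (β v ζ) (nrm v))

    Σᵛ-1 : ∀ d → Σᵛ d (λ _ → 1ℤ) ≡ size ^ d
    Σᵛ-1 zero    = refl
    Σᵛ-1 (suc d) = trans (∑-tuples d elems _) (trans (∑-const (Σᵛ d (λ _ → 1ℤ))) (cong (size *_) (Σᵛ-1 d)))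

    Σᵛ-const : ∀ d c → Σᵛ d (λ _ → c) ≡ size ^ d * c
    Σᵛ-const d c = trans (Enum.∑-const (ptEnum d) c) (cong (_* c) (Σᵛ-1 d))

    module _ (𝟚≢𝟘 : ¬ 𝟚 ≡ 𝟘) where
      -- At a nonzero coordinate of v the equation determines that coordinate of ξ from the others.
      -- The factor `size` stands in for the exponent d - 1.
      hyperplane : ∀ {d} (v : Pt d) → ¬ v ≡ 0ᵖ → ∀ c → size * Σᵛ d (λ ξ → χ (β v ξ ≟ c)) ≡ size ^ d
      hyperplane []      v≢0 c = ⊥-elim (v≢0 refl)
      hyperplane {suc d} (x ∷ v) v≢0 c with x ≟ 𝟘
      ... | no x≢0 = cong (size *_) (begin
        Σᵛ (suc d) (λ ξ → χ (β (x ∷ v) ξ ≟ c)) ≡⟨ ∑-tuples d elems _ ⟩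
        Σᶠ (λ ξ₁ → Σᵛ d (λ ζ → χ (𝟚 ⊗ x ⊗ ξ₁ ⊕ β v ζ ≟ c))) ≡⟨ ∑-swap elems (tuples d elems) _ ⟩
        Σᵛ d (λ ζ → Σᶠ (λ ξ₁ → χ (𝟚 ⊗ x ⊗ ξ₁ ⊕ β v ζ ≟ c)))
          ≡⟨ ∑-cong (tuples d elems) (λ ζ → trans (Σᶠ-scale (⊗≢𝟘 𝟚≢𝟘 x≢0) (λ a → χ (a ⊕ β v ζ ≟ c))) (trans (Σᶠ-shift (β v ζ) (λ a → χ (a ≟ c))) (once c))) ⟩
        Σᵛ d (λ _ → 1ℤ) ≡⟨ Σᵛ-1 d ⟩
        size ^ d ∎)
        where open ≡-Reasoning
      ... | yes refl = cong (size *_) (begin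
        Σᵛ (suc d) (λ ξ → χ (β (𝟘 ∷ v) ξ ≟ c)) ≡⟨ ∑-tuples d elems _ ⟩
        Σᶠ (λ ξ₁ → Σᵛ d (λ ζ → χ (𝟚 ⊗ 𝟘 ⊗ ξ₁ ⊕ β v ζ ≟ c)))
          ≡⟨ ∑-cong elems (λ ξ₁ → ∑-cong (tuples d elems) (λ ζ → cong (λ z → χ (z ≟ c)) (solve 2 (λ a b → con (+ 2) :* con (+ 0) :* a :+ b := b) refl ξ₁ (β v ζ)))) ⟩
        Σᶠ (λ ξ₁ → Σᵛ d (λ ζ → χ (β v ζ ≟ c))) ≡⟨ ∑-const _ ⟩
        size * Σᵛ d (λ ζ → χ (β v ζ ≟ c)) ≡⟨ hyperplane v (λ e → v≢0 (cong (𝟘 ∷_) e)) c ⟩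
        size ^ d ∎)
        where open ≡-Reasoning

      hyperplane′ : ∀ {d} (v : Pt d) → size * Σᵛ d (λ ξ → χ (β v ξ ≟ 𝟘)) ≡ size ^ d + χ (Enum._≟_ (ptEnum d) v 0ᵖ) * ((size - 1ℤ) * size ^ d)
      hyperplane′ {d} v with Enum._≟_ (ptEnum d) v 0ᵖ
      ... | no v≢0   = trans (hyperplane v v≢0 𝟘) (sym (+-identityʳ _))
      ... | yes refl = trans (cong (size *_) (trans (∑-cong (tuples d elems) (λ ξ → χ-yes (β 0ᵖ ξ ≟ 𝟘) (β0 ξ))) (Σᵛ-1 d))) (lem size (size ^ d))
        where
        β0 : ∀ {d} (ξ : Pt d) → β 0ᵖ ξ ≡ 𝟘
        β0 []      = refl
        β0 (x ∷ ξ) = trans (cong (𝟚 ⊗ 𝟘 ⊗ x ⊕_) (β0 ξ)) (solve 1 (λ x → con (+ 2) :* con (+ 0) :* x :+ con (+ 0) := con (+ 0)) refl x)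
        lem : ∀ q a → q * a ≡ a + 1ℤ * ((q - 1ℤ) * a)
        lem = solve-∀

  module DistanceCount (K : EnumField) (𝟚≢𝟘 : ¬ FieldKit.𝟚 K ≡ FieldKit.𝟘 K) where
    open Geometry K
    open QuadraticCharacter K 𝟚≢𝟘 using (η; φ₀; κ; κ²≡1; T; Tη; Tφ₀≡η; Σφ₀≡0; Ση≡0)

    1≤size : 1ℤ ≤ size
    1≤size = ∑-term≤ 𝟘 (λ _ → 1ℤ) (λ _ → +≤+ ℕ.z≤n)

    0≤size : 0ℤ ≤ size
    0≤size = ≤-trans (+≤+ ℕ.z≤n) 1≤size

    2≤size : + 2 ≤ size
    2≤size = subst₂ _≤_ (cong₂ _+_ (once 𝟘) (once 𝟙)) refl (subst (_≤ size) (∑-+ elems _ _) (∑-mono elems h))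
      where
      h : ∀ x → χ (x ≟ 𝟘) + χ (x ≟ 𝟙) ≤ 1ℤ
      h x with x ≟ 𝟘 | x ≟ 𝟙
      ... | yes refl | yes e = ⊥-elim (𝟘≢𝟙 e)
      ... | yes _ | no _ = ≤-refl
      ... | no _ | yes _ = ≤-refl
      ... | no _ | no _  = +≤+ ℕ.z≤n

    -- ψ d is chosen so that its average over the translated norms of F^d is a multiple of φ₀.
    ψ : ℕ → Carrier → ℤ
    ψ zero          = φ₀
    ψ (suc zero)    = η
    ψ (suc (suc d)) = ψ d

    -- What remains in front of `φ₀` after d applications of `T` to `ψ d`, two of which multiply by
    -- κ q.
    gauss : ℕ → ℤ
    gauss zero          = 1ℤ
    gauss (suc zero)    = 1ℤ
    gauss (suc (suc d)) = κ * size * gauss d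

    -- The constant in X² ≤ 4 `bound d` norm² for one direction: q² for the kernel of `η`, and q² ·
    -- q for that of `φ₀`, where the last q is the square-root bound for Kloosterman sums.
    bound : ℕ → ℤ
    bound zero          = size * (size * size)
    bound (suc zero)    = size * size
    bound (suc (suc d)) = bound d

    -- The extra q of even dimensions in `bound` is matched by the square of `gauss`, which is q^d
    -- there and q^(d-1) in odd dimensions. The final estimate is therefore the same for both
    -- parities.
    bound-gauss : ∀ d → bound d * size ^ d ≡ gauss d * gauss d * (size * (size * size))
    bound-gauss zero       = lem size
      where
      lem : ∀ q → q * (q * q) * 1ℤ ≡ 1ℤ * (q * (q * q))
      lem = solve-∀
    bound-gauss (suc zero) = lem size
      where
      lem : ∀ q → q * q * (q * 1ℤ) ≡ 1ℤ * (q * (q * q))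
      lem = solve-∀
    bound-gauss (suc (suc d)) = begin
      bound d * (size * (size * size ^ d)) ≡⟨ l₁ (bound d) size (size ^ d) ⟩
      size * size * (bound d * size ^ d) ≡⟨ cong (size * size *_) (bound-gauss d) ⟩
      size * size * (gauss d * gauss d * (size * (size * size))) ≡⟨ sym (*-identityˡ _) ⟩
      1ℤ * (size * size * (gauss d * gauss d * (size * (size * size)))) ≡⟨ cong (_* (size * size * (gauss d * gauss d * (size * (size * size))))) (sym κ²≡1) ⟩
      κ * κ * (size * size * (gauss d * gauss d * (size * (size * size)))) ≡⟨ l₂ κ size (gauss d) (size * (size * size)) ⟩
      gauss (suc (suc d)) * gauss (suc (suc d)) * (size * (size * size)) ∎
      where
      open ≡-Reasoning
      l₁ : ∀ b q z → b * (q * (q * z)) ≡ q * q * (b * z)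
      l₁ = solve-∀
      l₂ : ∀ k q g z → k * k * (q * q * (g * g * z)) ≡ k * q * g * (k * q * g) * z
      l₂ = solve-∀

    gauss²>0 : ∀ d → 0ℤ < gauss d * gauss d
    gauss²>0 zero          = +<+ (ℕ.s≤s ℕ.z≤n)
    gauss²>0 (suc zero)    = +<+ (ℕ.s≤s ℕ.z≤n)
    gauss²>0 (suc (suc d)) = subst (0ℤ <_) (sym eq) (*-mono-pos (*-mono-pos 0<size 0<size) (gauss²>0 d))
      where
      0<size : 0ℤ < size
      0<size = <-≤-trans (+<+ (ℕ.s≤s ℕ.z≤n)) 1≤size
      *-mono-pos : ∀ {a b} → 0ℤ < a → 0ℤ < b → 0ℤ < a * b
      *-mono-pos {a} {b} p q = subst (_< a * b) (*-zeroʳ a) (*-monoˡ-<-pos a ⦃ positive p ⦄ q)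
      l : ∀ k q g → k * q * g * (k * q * g) ≡ k * k * (q * q * (g * g))
      l = solve-∀
      eq : gauss (suc (suc d)) * gauss (suc (suc d)) ≡ size * size * (gauss d * gauss d)
      eq = trans (l κ size (gauss d)) (trans (cong (_* (size * size * (gauss d * gauss d))) κ²≡1) (*-identityˡ _))

    Σψ≡0 : ∀ d → Σᶠ (ψ d) ≡ 0ℤ
    Σψ≡0 zero          = Σφ₀≡0
    Σψ≡0 (suc zero)    = Ση≡0
    Σψ≡0 (suc (suc d)) = Σψ≡0 d

    normSum-suc : ∀ d f c → Σᵛ (suc d) (λ y → f (nrm y ⊕ c)) ≡ T (λ c′ → Σᵛ d (λ y → f (nrm y ⊕ c′))) c
    normSum-suc d f c = trans (∑-tuples d elems _) (∑-cong elems λ y → ∑-cong (tuples d elems) λ v →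
      cong f (solve 3 (λ a b c → a :+ b :+ c := b :+ (a :+ c)) refl (y ⊗ y) (nrm v) c))

    normSum : ∀ d c → Σᵛ d (λ y → ψ d (nrm y ⊕ c)) ≡ gauss d * φ₀ c
    normSum zero c = trans (+-identityʳ _) (trans (cong φ₀ (R.+-identityˡ c)) (sym (*-identityˡ (φ₀ c))))
    normSum (suc zero) c = begin
      Σᵛ 1 (λ y → η (nrm y ⊕ c)) ≡⟨ normSum-suc 0 η c ⟩
      T (λ c′ → Σᵛ 0 (λ y → η (nrm y ⊕ c′))) c ≡⟨ ∑-cong elems (λ y → trans (+-identityʳ _) (cong η (R.+-identityˡ _))) ⟩
      T η c ≡⟨ Tη c ⟩
      φ₀ c ≡⟨ sym (*-identityˡ (φ₀ c)) ⟩
      1ℤ * φ₀ c ∎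
      where open ≡-Reasoning
    normSum (suc (suc d)) c = begin
      Σᵛ (suc (suc d)) (λ y → ψ d (nrm y ⊕ c)) ≡⟨ normSum-suc (suc d) (ψ d) c ⟩
      T (λ c′ → Σᵛ (suc d) (λ y → ψ d (nrm y ⊕ c′))) c
        ≡⟨ ∑-cong elems (λ y → trans (normSum-suc d (ψ d) _) (trans (∑-cong elems (λ z → normSum d _)) (trans (∑-*ˡ elems (gauss d) _) (cong (gauss d *_) (Tφ₀≡η _))))) ⟩
      Σᶠ (λ y → gauss d * (κ * (size * η (y ⊗ y ⊕ c)))) ≡⟨ ∑-cong elems (λ y → l (gauss d) κ size (η (y ⊗ y ⊕ c))) ⟩
      Σᶠ (λ y → κ * size * gauss d * η (y ⊗ y ⊕ c)) ≡⟨ ∑-*ˡ elems (κ * size * gauss d) _ ⟩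
      κ * size * gauss d * T η c ≡⟨ cong (κ * size * gauss d *_) (Tη c) ⟩
      κ * size * gauss d * φ₀ c ∎
      where
      open ≡-Reasoning
      l : ∀ g k q e → g * (k * (q * e)) ≡ k * q * g * e
      l = solve-∀

    kernel : ℕ → Carrier → Carrier → Carrier → ℤ
    kernel d t r u = Σᶠ (λ w → nz w * ψ d (r ⊗ (w ⊗ w) ⊕ u ⊗ w ⊕ t))

    -- For each w ≠ 0 the argument of `ψ d` is a bijective function of u. Hence a constant added to
    -- the correlation does not change its sum against the kernel, which is how `X≡` undoes the
    -- recentring of the slice counts.
    Σkernel≡0 : ∀ d t r → Σᶠ (kernel d t r) ≡ 0ℤ
    Σkernel≡0 d t r = trans (∑-swap elems elems _) (trans (∑-cong elems (λ w → trans (∑-*ˡ elems (nz w) _) (trans (nz-guard w (h w)) (*-zeroʳ (nz w))))) (∑-0 elems))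
      where
      h : ∀ w → ¬ w ≡ 𝟘 → Σᶠ (λ u → ψ d (r ⊗ (w ⊗ w) ⊕ u ⊗ w ⊕ t)) ≡ 0ℤ
      h w w≢0 = trans (∑-cong elems (λ u → cong (ψ d) (solve 4 (λ r w u t → r :* (w :* w) :+ u :* w :+ t := w :* u :+ (r :* (w :* w) :+ t)) refl r w u t)))
        (trans (Σᶠ-scale w≢0 (λ v → ψ d (v ⊕ (r ⊗ (w ⊗ w) ⊕ t)))) (trans (Σᶠ-shift _ (ψ d)) (Σψ≡0 d)))

    -- By `nrm-affine` the argument of `ψ d` is ‖wξ + v‖ + (t - ‖v‖), and ξ ↦ wξ + v permutes the
    -- space for each of the q - 1 values w ≠ 0. `normSum` then leaves a point mass at ‖v‖ = t.
    Σ-kernel-β : ∀ {d} t (v : Pt d) → Σᵛ d (λ ξ → kernel d t (nrm ξ) (β v ξ)) ≡ (size - 1ℤ) * (gauss d * φ₀ (t ⊖ᶠ nrm v))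
    Σ-kernel-β {d} t v = begin
      Σᵛ d (λ ξ → Σᶠ (λ w → nz w * ψ d (nrm ξ ⊗ (w ⊗ w) ⊕ β v ξ ⊗ w ⊕ t))) ≡⟨ ∑-swap (tuples d elems) elems _ ⟩
      Σᶠ (λ w → Σᵛ d (λ ξ → nz w * ψ d (nrm ξ ⊗ (w ⊗ w) ⊕ β v ξ ⊗ w ⊕ t)))
        ≡⟨ ∑-cong elems (λ w → trans (∑-*ˡ (tuples d elems) (nz w) _) (nz-guard w (h w))) ⟩
      Σᶠ (λ w → nz w * Z) ≡⟨ Σᶠ-nz (λ _ → Z) ⟩
      Σᶠ (λ _ → Z) - Z ≡⟨ cong (λ z → z - Z) (∑-const Z) ⟩
      size * Z - Z ≡⟨ l size Z ⟩
      (size - 1ℤ) * Z ∎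
      where
      open ≡-Reasoning
      Z = gauss d * φ₀ (t ⊖ᶠ nrm v)
      l : ∀ q z → q * z - z ≡ (q - 1ℤ) * z
      l = solve-∀
      h : ∀ w → ¬ w ≡ 𝟘 → Σᵛ d (λ ξ → ψ d (nrm ξ ⊗ (w ⊗ w) ⊕ β v ξ ⊗ w ⊕ t)) ≡ Z
      h w w≢0 = trans (∑-cong (tuples d elems) (λ ξ → cong (ψ d) (trans
          (solve 3 (λ a m t → a :+ t := (a :+ m) :+ (t :- m)) refl (nrm ξ ⊗ (w ⊗ w) ⊕ β v ξ ⊗ w) (nrm v) t)
          (cong (_⊕ (t ⊖ᶠ nrm v)) (sym (nrm-affine w v ξ))))))
        (trans (Σᵛ-affine w≢0 v (λ y → ψ d (nrm y ⊕ (t ⊖ᶠ nrm v)))) (normSum d _))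

    module _ (weil : ∀ g → Σᶠ g ≡ 0ℤ → ∀ c → ¬ c ≡ 𝟘 →
                Correlation.kloosterman K g c * Correlation.kloosterman K g c ≤ + 4 * size * (Correlation.norm K g * Correlation.norm K g))
             {t : Carrier} (t≢0 : ¬ t ≡ 𝟘) where

      lineSum-bound : ∀ d g → Σᶠ g ≡ 0ℤ → ∀ r →
        let X = Σᶠ (λ u → kernel d t r u * Correlation.corr K g u) in
        X * X ≤ + 4 * bound d * (Correlation.norm K g * Correlation.norm K g)
      lineSum-bound zero          g h = LineKernels.lineSum-φ₀-bound K 𝟚≢𝟘 g h (weil g h) 1≤size t≢0
      lineSum-bound (suc zero)    g h = LineKernels.lineSum-η-bound K 𝟚≢𝟘 g h t≢0
      lineSum-bound (suc (suc d)) g h = lineSum-bound d g h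

      module _ (d : ℕ) (E : List (Pt d)) where
        e : ℤ
        e = ∑[ x ∈ E ] 1ℤ

        ν : ℤ
        ν = ∑[ x ∈ E ] ∑[ y ∈ E ] χ (nrm (y -ᵖ x) ≟ t)

        private
          ∑E-const : ∀ c → ∑[ x ∈ E ] c ≡ e * c
          ∑E-const c = trans (∑-cong E (λ _ → sym (*-identityˡ c))) (∑-*ʳ E _ c)

        module Slice (ξ : Pt d) where
          g : Carrier → ℤ
          g b = ∑[ x ∈ E ] χ (β x ξ ≟ b)

          Σg* : ∀ f → Σᶠ (λ b → g b * f b) ≡ ∑[ x ∈ E ] f (β x ξ)
          Σg* f = sym (∑-fibres (ptEnum d) enum E (λ x → β x ξ) f)

          Σg : Σᶠ g ≡ e
          Σg = trans (∑-cong elems (λ b → sym (*-identityʳ (g b)))) (Σg* (λ _ → 1ℤ))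

          -- The slice counts recentred to sum 0, multiplied by `size` to stay integral.
          g° : Carrier → ℤ
          g° b = size * g b - e

          Σg°≡0 : Σᶠ g° ≡ 0ℤ
          Σg°≡0 = trans (∑-- elems _ _) (trans (cong₂ _-_ (trans (∑-*ˡ elems size g) (cong (size *_) Σg)) (∑-const e)) (+-inverseʳ (size * e)))

          open Correlation K g° using (corr; norm)
          open Correlation K g using () renaming (corr to corr₀)

          corr≡ : ∀ u → corr u ≡ size * size * corr₀ u - size * (e * e)
          corr≡ u = begin
            Σᶠ (λ b → (size * g b - e) * (size * g (b ⊕ u) - e)) ≡⟨ ∑-cong elems (λ b → l₁ size e (g b) (g (b ⊕ u))) ⟩
            Σᶠ (λ b → size * size * (g b * g (b ⊕ u)) - (size * e * g b + size * e * g (b ⊕ u) - e * e))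
              ≡⟨ trans (∑-- elems _ _) (cong₂ _-_ (∑-*ˡ elems (size * size) _)
                   (trans (∑-- elems _ _) (cong₂ _-_ (trans (∑-+ elems _ _) (cong₂ _+_ (trans (∑-*ˡ elems (size * e) _) (cong (size * e *_) Σg))
                     (trans (∑-*ˡ elems (size * e) _) (cong (size * e *_) (trans (Σᶠ-shift u g) Σg))))) (∑-const (e * e))))) ⟩
            size * size * corr₀ u - (size * e * e + size * e * e - size * (e * e)) ≡⟨ l₂ size e (corr₀ u) ⟩
            size * size * corr₀ u - size * (e * e) ∎
            where
            open ≡-Reasoning
            l₁ : ∀ q e a b → (q * a - e) * (q * b - e) ≡ q * q * (a * b) - (q * e * a + q * e * b - e * e)
            l₁ = solve-∀
            l₂ : ∀ q e c → q * q * c - (q * e * e + q * e * e - q * (e * e)) ≡ q * q * c - q * (e * e)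
            l₂ = solve-∀

          norm≡ : norm ≡ size * size * (∑[ x ∈ E ] ∑[ y ∈ E ] χ (β (y -ᵖ x) ξ ≟ 𝟘)) - size * (e * e)
          norm≡ = trans (sym (Correlation.corr-𝟘 K g°)) (trans (corr≡ 𝟘) (cong (λ z → size * size * z - size * (e * e))
            (trans (Correlation.corr-𝟘 K g) (trans (Σg* g) (∑-cong E λ x → ∑-cong E λ y →
              χ-⇔ (β y ξ ≟ β x ξ) (β (y -ᵖ x) ξ ≟ 𝟘) (λ h → trans (β-diff y x ξ) (trans (cong (_⊖ᶠ β x ξ) h) (R.-‿inverseʳ _)))
                (λ h → ⊖≡𝟘 (trans (sym (β-diff y x ξ)) h)))))))

          X : ℤ
          X = Σᶠ (λ u → kernel d t (nrm ξ) u * corr u)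

          X≡ : X ≡ size * size * (∑[ x ∈ E ] ∑[ y ∈ E ] kernel d t (nrm ξ) (β (y -ᵖ x) ξ))
          X≡ = begin
            Σᶠ (λ u → k u * corr u) ≡⟨ ∑-cong elems (λ u → trans (cong (k u *_) (corr≡ u)) (l (k u) (size * size) (corr₀ u) (size * (e * e)))) ⟩
            Σᶠ (λ u → size * size * (k u * corr₀ u) - k u * (size * (e * e)))
              ≡⟨ trans (∑-- elems _ _) (cong₂ _-_ (∑-*ˡ elems (size * size) _) (trans (∑-*ʳ elems k _) (cong (_* (size * (e * e))) (Σkernel≡0 d t (nrm ξ))))) ⟩
            size * size * Σᶠ (λ u → k u * corr₀ u) - 0ℤ ≡⟨ +-identityʳ _ ⟩
            size * size * Σᶠ (λ u → k u * corr₀ u) ≡⟨ cong (size * size *_) (begin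
              Σᶠ (λ u → k u * corr₀ u) ≡⟨ ∑-cong elems (λ u → trans (cong (k u *_) (Σg* (λ b → g (b ⊕ u)))) (sym (∑-*ˡ E (k u) _))) ⟩
              Σᶠ (λ u → ∑[ x ∈ E ] k u * g (β x ξ ⊕ u)) ≡⟨ ∑-swap elems E _ ⟩
              ∑[ x ∈ E ] Σᶠ (λ u → k u * g (β x ξ ⊕ u)) ≡⟨ ∑-cong E (λ x → trans (sym (Σᶠ-shift (⊝ β x ξ) _))
                (trans (∑-cong elems (λ u → trans (cong (λ z → k (u ⊖ᶠ β x ξ) * g z) (solve 2 (λ b u → b :+ (u :- b) := u) refl (β x ξ) u)) (*-comm (k (u ⊖ᶠ β x ξ)) (g u))))
                (trans (Σg* (λ u → k (u ⊖ᶠ β x ξ))) (∑-cong E (λ y → cong k (sym (β-diff y x ξ))))))) ⟩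
              ∑[ x ∈ E ] ∑[ y ∈ E ] k (β (y -ᵖ x) ξ) ∎) ⟩
            size * size * (∑[ x ∈ E ] ∑[ y ∈ E ] k (β (y -ᵖ x) ξ)) ∎
            where
            open ≡-Reasoning
            k = kernel d t (nrm ξ)
            l : ∀ k s c z → k * (s * c - z) ≡ s * (k * c) - k * z
            l = solve-∀

          X²≤ : X * X ≤ + 4 * bound d * (norm * norm)
          X²≤ = lineSum-bound d g° Σg°≡0 (nrm ξ)

          0≤n : 0ℤ ≤ norm
          0≤n = Correlation.0≤norm K g°

        private
          sum-pairs : (f : Pt d → Pt d → Pt d → ℤ) →
            Σᵛ d (λ ξ → ∑[ x ∈ E ] ∑[ y ∈ E ] f ξ x y) ≡ ∑[ x ∈ E ] ∑[ y ∈ E ] Σᵛ d (λ ξ → f ξ x y)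
          sum-pairs f = trans (∑-swap (tuples d elems) E _) (∑-cong E (λ x → ∑-swap (tuples d elems) E _))

          ee : ∑[ x ∈ E ] ∑[ y ∈ E ] 1ℤ ≡ e * e
          ee = ∑E-const e

          ΣX : Σᵛ d Slice.X ≡ size * size * ((size - 1ℤ) * (gauss d * (size * ν - e * e)))
          ΣX = begin
            Σᵛ d Slice.X ≡⟨ ∑-cong (tuples d elems) Slice.X≡ ⟩
            Σᵛ d (λ ξ → size * size * (∑[ x ∈ E ] ∑[ y ∈ E ] kernel d t (nrm ξ) (β (y -ᵖ x) ξ)))
              ≡⟨ trans (∑-*ˡ (tuples d elems) (size * size) _) (cong (size * size *_) (trans (sum-pairs _) (∑-cong E (λ x → ∑-cong E (λ y → trans (Σ-kernel-β t (y -ᵖ x)) (term x y)))))) ⟩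
            size * size * (∑[ x ∈ E ] ∑[ y ∈ E ] c * (size * χ (nrm (y -ᵖ x) ≟ t) - 1ℤ))
              ≡⟨ cong (size * size *_) (trans (∑-cong E (λ x → ∑-*ˡ E c _)) (∑-*ˡ E c _)) ⟩
            size * size * (c * (∑[ x ∈ E ] ∑[ y ∈ E ] (size * χ (nrm (y -ᵖ x) ≟ t) - 1ℤ)))
              ≡⟨ cong (λ z → size * size * (c * z)) (trans (∑-cong E (λ x → ∑-- E _ _)) (trans (∑-- E _ _)
                   (cong₂ _-_ (trans (∑-cong E (λ x → ∑-*ˡ E size _)) (∑-*ˡ E size _)) ee))) ⟩
            size * size * (c * (size * ν - e * e)) ≡⟨ cong (size * size *_) (*-assoc (size - 1ℤ) (gauss d) _) ⟩
            size * size * ((size - 1ℤ) * (gauss d * (size * ν - e * e))) ∎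
            where
            open ≡-Reasoning
            c = (size - 1ℤ) * gauss d
            term : ∀ x y → (size - 1ℤ) * (gauss d * φ₀ (t ⊖ᶠ nrm (y -ᵖ x))) ≡ c * (size * χ (nrm (y -ᵖ x) ≟ t) - 1ℤ)
            term x y = trans (sym (*-assoc (size - 1ℤ) (gauss d) _)) (cong (λ z → c * (size * z - 1ℤ))
              (χ-⇔ (t ⊖ᶠ nrm (y -ᵖ x) ≟ 𝟘) (nrm (y -ᵖ x) ≟ t) (λ h → sym (⊖≡𝟘 h)) (λ h → trans (cong (t ⊖ᶠ_) h) (R.-‿inverseʳ t))))

          -- Two distinct points share a hyperplane in exactly the average number of directions, and
          -- the recentring cancels that average. Only the diagonal pairs remain, e of them because
          -- the points of E are distinct.
          Σnorm : Unique E → Σᵛ d (λ ξ → Correlation.norm K (Slice.g° ξ)) ≡ size * ((size - 1ℤ) * (size ^ d * e))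
          Σnorm uniq = begin
            Σᵛ d (λ ξ → Correlation.norm K (Slice.g° ξ)) ≡⟨ ∑-cong (tuples d elems) Slice.norm≡ ⟩
            Σᵛ d (λ ξ → size * size * (∑[ x ∈ E ] ∑[ y ∈ E ] χ (β (y -ᵖ x) ξ ≟ 𝟘)) - size * (e * e))
              ≡⟨ trans (∑-- (tuples d elems) _ _) (cong₂ _-_ (trans (∑-*ˡ (tuples d elems) (size * size) _) (cong (size * size *_) (sum-pairs _))) (Σᵛ-const d _)) ⟩
            size * size * (∑[ x ∈ E ] ∑[ y ∈ E ] Σᵛ d (λ ξ → χ (β (y -ᵖ x) ξ ≟ 𝟘))) - size ^ d * (size * (e * e))
              ≡⟨ cong (λ z → z - size ^ d * (size * (e * e))) (trans (*-assoc size size _) (cong (size *_) (trans (sym (trans (∑-cong E (λ x → ∑-*ˡ E size _)) (∑-*ˡ E size _)))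
                   (∑-cong E (λ x → ∑-cong E (λ y → trans (hyperplane′ 𝟚≢𝟘 (y -ᵖ x)) (cong (λ z → size ^ d + z * ((size - 1ℤ) * size ^ d)) (eqχ x y)))))))) ⟩
            size * (∑[ x ∈ E ] ∑[ y ∈ E ] (size ^ d + χ (Enum._≟_ (ptEnum d) y x) * c)) - size ^ d * (size * (e * e))
              ≡⟨ cong (λ z → size * z - size ^ d * (size * (e * e))) (trans (∑-cong E (λ x → ∑-+ E _ _)) (trans (∑-+ E _ _)
                   (cong₂ _+_ (trans (∑-cong E (λ x → ∑E-const (size ^ d))) (∑E-const (e * size ^ d)))
                     (trans (∑-cong E (λ x → ∑-*ʳ E _ c)) (trans (∑-*ʳ E _ c) (cong (_* c) (∑-unique (ptEnum d) uniq))))))) ⟩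
            size * (e * (e * size ^ d) + e * ((size - 1ℤ) * size ^ d)) - size ^ d * (size * (e * e)) ≡⟨ l size e (size ^ d) ⟩
            size * ((size - 1ℤ) * (size ^ d * e)) ∎
            where
            open ≡-Reasoning
            c = (size - 1ℤ) * size ^ d
            eqχ : ∀ x y → χ (Enum._≟_ (ptEnum d) (y -ᵖ x) 0ᵖ) ≡ χ (Enum._≟_ (ptEnum d) y x)
            eqχ x y = χ-⇔ (Enum._≟_ (ptEnum d) (y -ᵖ x) 0ᵖ) (Enum._≟_ (ptEnum d) y x) (-ᵖ≡0 y x) (λ { refl → -ᵖ-self y })
            l : ∀ q e z → q * (e * (e * z) + e * ((q - 1ℤ) * z)) - z * (q * (e * e)) ≡ q * ((q - 1ℤ) * (z * e))
            l = solve-∀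

        0≤bound : ∀ d → 0ℤ ≤ bound d
        0≤bound zero          = 0≤* 0≤size (0≤² size)
        0≤bound (suc zero)    = 0≤² size
        0≤bound (suc (suc d)) = 0≤bound d

        -- Summing the directional bounds with `∑-²≤` compares `ΣX` with `Σnorm`. The common factor
        -- M = q⁴ (q - 1)² gauss² is positive because q ≥ 2, and cancels. In other words |q ν - e²|
        -- ≤ 2 q^((d+1)/2) e.
        distance-count : Unique E → (size * ν - e * e) * (size * ν - e * e) ≤ + 4 * (size * size ^ d) * (e * e)
        distance-count uniq = *-cancelˡ-≤-pos _ _ M ⦃ positive 0<M ⦄ (subst₂ _≤_ lhs rhs
            (∑-²≤ (tuples d elems) {Slice.X} {λ ξ → Correlation.norm K (Slice.g° ξ)} (0≤* {+ 4} (+≤+ ℕ.z≤n) (0≤bound d)) Slice.0≤n Slice.X²≤))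
          where
          Z = size * ν - e * e
          M = size * size * (size * size) * ((size - 1ℤ) * (size - 1ℤ) * (gauss d * gauss d))
          0<*  : ∀ {a b} → 0ℤ < a → 0ℤ < b → 0ℤ < a * b
          0<* {a} {b} p q = subst (_< a * b) (*-zeroʳ a) (*-monoˡ-<-pos a ⦃ positive p ⦄ q)
          0<q : 0ℤ < size
          0<q = <-≤-trans (+<+ (ℕ.s≤s ℕ.z≤n)) 1≤size
          0<q-1 : 0ℤ < size - 1ℤ
          0<q-1 = <-≤-trans (+<+ (ℕ.s≤s ℕ.z≤n)) (+-monoˡ-≤ -1ℤ 2≤size)
          0<M : 0ℤ < M
          0<M = 0<* (0<* (0<* 0<q 0<q) (0<* 0<q 0<q)) (0<* (0<* 0<q-1 0<q-1) (gauss²>0 d))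
          lhs : Σᵛ d Slice.X * Σᵛ d Slice.X ≡ M * (Z * Z)
          lhs = trans (cong₂ _*_ ΣX ΣX) (l size (size - 1ℤ) (gauss d) Z)
            where
            l : ∀ q p g z → q * q * (p * (g * z)) * (q * q * (p * (g * z))) ≡ q * q * (q * q) * (p * p * (g * g)) * (z * z)
            l = solve-∀
          rhs : + 4 * bound d * (Σᵛ d (λ ξ → Correlation.norm K (Slice.g° ξ)) * Σᵛ d (λ ξ → Correlation.norm K (Slice.g° ξ))) ≡ M * (+ 4 * (size * size ^ d) * (e * e))
          rhs = begin
            + 4 * bound d * (N * N) ≡⟨ cong (λ z → + 4 * bound d * (z * z)) (Σnorm uniq) ⟩
            + 4 * bound d * (size * ((size - 1ℤ) * (size ^ d * e)) * (size * ((size - 1ℤ) * (size ^ d * e)))) ≡⟨ l₁ (bound d) size (size - 1ℤ) (size ^ d) e ⟩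
            bound d * size ^ d * (+ 4 * (size * size) * ((size - 1ℤ) * (size - 1ℤ)) * (size ^ d * (e * e))) ≡⟨ cong (_* (+ 4 * (size * size) * ((size - 1ℤ) * (size - 1ℤ)) * (size ^ d * (e * e)))) (bound-gauss d) ⟩
            gauss d * gauss d * (size * (size * size)) * (+ 4 * (size * size) * ((size - 1ℤ) * (size - 1ℤ)) * (size ^ d * (e * e))) ≡⟨ l₂ (gauss d) size (size - 1ℤ) (size ^ d) e ⟩
            M * (+ 4 * (size * size ^ d) * (e * e)) ∎
            where
            open ≡-Reasoning
            N = Σᵛ d (λ ξ → Correlation.norm K (Slice.g° ξ))
            l₁ : ∀ b q p z e → + 4 * b * (q * (p * (z * e)) * (q * (p * (z * e)))) ≡ b * z * (+ 4 * (q * q) * (p * p) * (z * (e * e)))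
            l₁ = solve-∀
            l₂ : ∀ g q p z e → g * g * (q * (q * q)) * (+ 4 * (q * q) * (p * p) * (z * (e * e))) ≡ q * q * (q * q) * (p * p * (g * g)) * (+ 4 * (q * z) * (e * e))
            l₂ = solve-∀

  -- Polynomial functions

  module Polynomials (K : EnumField) where
    open FieldKit K public
    open Algebra.Properties.Semiring.Exp R.semiring public
      using () renaming (_^_ to _↑_; ^-homo-* to ↑-+; ^-assocʳ to ↑-*)
    open Algebra.Properties.CommutativeSemiring.Exp R.commutativeSemiring public
      using () renaming (^-distrib-* to ↑-⊗)
    open Algebra.Properties.Semiring.Sum R.semiring public
      using () renaming (sum to Sum; *-distribˡ-sum to Sum-⊗ˡ; *-distribʳ-sum to Sum-⊗ʳ; sum-cong-≗ to Sum-cong)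
    open Algebra.Properties.CommutativeMonoid.Sum R.+-commutativeMonoid public
      using () renaming (∑-distrib-+ to Sum-⊕; sum-remove to Sum-remove)

    ↑≢𝟘 : ∀ {x} → ¬ x ≡ 𝟘 → ∀ n → ¬ x ↑ n ≡ 𝟘
    ↑≢𝟘 x≢0 zero    e = 𝟘≢𝟙 (sym e)
    ↑≢𝟘 x≢0 (suc n)   = ⊗≢𝟘 x≢0 (↑≢𝟘 x≢0 n)

    𝟙↑ : ∀ n → 𝟙 ↑ n ≡ 𝟙
    𝟙↑ zero    = refl
    𝟙↑ (suc n) = trans (R.*-identityˡ _) (𝟙↑ n)

    -- Lead ℓ n f: f is a polynomial function with coefficient ℓ (possibly 𝟘) in degree n and none above.
    data Lead (ℓ : Carrier) : ℕ → (Carrier → Carrier) → Set where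
      base : ∀ {f} → (∀ x → f x ≡ ℓ) → Lead ℓ 0 f
      step : ∀ {n f} c g → Lead ℓ n g → (∀ x → f x ≡ c ⊕ x ⊗ g x) → Lead ℓ (suc n) f

    Lead-≗ : ∀ {ℓ n f g} → (∀ x → g x ≡ f x) → Lead ℓ n f → Lead ℓ n g
    Lead-≗ h (base e)       = base (λ x → trans (h x) (e x))
    Lead-≗ h (step c g l e) = step c g l (λ x → trans (h x) (e x))

    Lead-coef : ∀ {a b n f} → a ≡ b → Lead a n f → Lead b n f
    Lead-coef refl l = l

    Lead-deg : ∀ {a n m f} → n ≡ m → Lead a n f → Lead a m f
    Lead-deg refl l = l

    Lead-⊕ : ∀ {a b n f g} → Lead a n f → Lead b n g → Lead (a ⊕ b) n (λ x → f x ⊕ g x)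
    Lead-⊕ (base e) (base e′) = base (λ x → cong₂ _⊕_ (e x) (e′ x))
    Lead-⊕ (step c g l e) (step c′ g′ l′ e′) = step (c ⊕ c′) _ (Lead-⊕ l l′) (λ x → trans (cong₂ _⊕_ (e x) (e′ x))
      (solve 5 (λ a x b c d → (a :+ x :* b) :+ (c :+ x :* d) := (a :+ c) :+ x :* (b :+ d)) refl c x (g x) c′ (g′ x)))

    Lead-scale : ∀ {a n f} c → Lead a n f → Lead (c ⊗ a) n (λ x → c ⊗ f x)
    Lead-scale c (base e) = base (λ x → cong (c ⊗_) (e x))
    Lead-scale c (step d g l e) = step (c ⊗ d) _ (Lead-scale c l) (λ x → trans (cong (c ⊗_) (e x))
      (solve 4 (λ c d x g → c :* (d :+ x :* g) := c :* d :+ x :* (c :* g)) refl c d x (g x)))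

    Lead-x : ∀ {a n f} → Lead a n f → Lead a (suc n) (λ x → x ⊗ f x)
    Lead-x l = step 𝟘 _ l (λ x → sym (R.+-identityˡ _))

    Lead-raise : ∀ {a n f} → Lead a n f → Lead 𝟘 (suc n) f
    Lead-raise {a} (base e) = step a (λ _ → 𝟘) (base (λ _ → refl)) (λ x → trans (e x) (solve 2 (λ a x → a := a :+ x :* con (+ 0)) refl a x))
    Lead-raise (step c g l e) = step c g (Lead-raise l) e

    Lead-raise+ : ∀ {a n f} m → Lead a n f → Lead 𝟘 (suc m ℕ.+ n) f
    Lead-raise+ zero    l = Lead-raise l
    Lead-raise+ (suc m) l = Lead-raise (Lead-raise+ m l)

    Lead-< : ∀ {a n m f} → n ℕ.< m → Lead a n f → Lead 𝟘 m f
    Lead-< {n = n} {m} n<m l = Lead-deg eq (Lead-raise+ (m ℕ.∸ suc n) l)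
      where
      eq : suc (m ℕ.∸ suc n) ℕ.+ n ≡ m
      eq = trans (sym (ℕₚ.+-suc (m ℕ.∸ suc n) n)) (ℕₚ.m∸n+n≡m n<m)

    Lead-⊗ : ∀ {a b n m f g} → Lead a n f → Lead b m g → Lead (a ⊗ b) (n ℕ.+ m) (λ x → f x ⊗ g x)
    Lead-⊗ (base e) l′ = Lead-≗ (λ x → cong (_⊗ _) (e x)) (Lead-scale _ l′)
    Lead-⊗ {a} {b} {suc n} {m} {g = h} (step c g l e) l′ = Lead-≗ (λ x → trans (cong (_⊗ h x) (e x))
        (solve 4 (λ c x g h → (c :+ x :* g) :* h := c :* h :+ x :* (g :* h)) refl c x (g x) (h x)))
      (Lead-coef (R.+-identityˡ _)
        (Lead-⊕ (Lead-raise+ n (Lead-scale c l′)) (Lead-x (Lead-⊗ l l′))))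

    Monic : ℕ → (Carrier → Carrier) → Set
    Monic = Lead 𝟙

    Monic-⊗ : ∀ {n m f g} → Monic n f → Monic m g → Monic (n ℕ.+ m) (λ x → f x ⊗ g x)
    Monic-⊗ l l′ = Lead-coef (R.*-identityˡ 𝟙) (Lead-⊗ l l′)

    Monic-⊕< : ∀ {a n m f g} → Monic n f → m ℕ.< n → Lead a m g → Monic n (λ x → f x ⊕ g x)
    Monic-⊕< l m<n l′ = Lead-coef (R.+-identityʳ 𝟙) (Lead-⊕ l (Lead-< m<n l′))

    Monic-x↑ : ∀ n → Monic n (_↑ n)
    Monic-x↑ zero    = base (λ _ → refl)
    Monic-x↑ (suc n) = Lead-x (Monic-x↑ n)

    Lead-↑ : ∀ {a n f} → Lead a n f → ∀ j → Lead (a ↑ j) (j ℕ.* n) (λ x → f x ↑ j)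
    Lead-↑ l zero    = base (λ _ → refl)
    Lead-↑ l (suc j) = Lead-⊗ l (Lead-↑ l j)

    Monic-↑ : ∀ {n f} → Monic n f → ∀ j → Monic (j ℕ.* n) (λ x → f x ↑ j)
    Monic-↑ l j = Lead-coef (𝟙↑ j) (Lead-↑ l j)

    factor : ∀ {ℓ n f} → Lead ℓ (suc n) f → ∀ a → ∃ λ g → Lead ℓ n g × (∀ x → f x ≡ f a ⊕ (x ⊖ᶠ a) ⊗ g x)
    factor {ℓ} {zero} {f} (step c g (base e) e′) a = g , base e , λ x → begin
      f x ≡⟨ trans (e′ x) (cong (λ z → c ⊕ x ⊗ z) (e x)) ⟩
      c ⊕ x ⊗ ℓ ≡⟨ solve 4 (λ c x l a → c :+ x :* l := (c :+ a :* l) :+ (x :- a) :* l) refl c x ℓ a ⟩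
      (c ⊕ a ⊗ ℓ) ⊕ (x ⊖ᶠ a) ⊗ ℓ ≡⟨ cong₂ (λ y z → y ⊕ (x ⊖ᶠ a) ⊗ z) (sym (trans (e′ a) (cong (λ z → c ⊕ a ⊗ z) (e a)))) (sym (e x)) ⟩
      f a ⊕ (x ⊖ᶠ a) ⊗ g x ∎
      where open ≡-Reasoning
    factor {ℓ} {suc n} {f} (step c g l e) a with factor l a
    ... | h , lh , eh = (λ x → g x ⊕ a ⊗ h x)
        , Lead-coef (R.+-identityʳ ℓ) (Lead-⊕ l (Lead-raise (Lead-scale a lh)))
        , λ x → begin
      f x ≡⟨ e x ⟩
      c ⊕ x ⊗ g x ≡⟨ solve 4 (λ c x a g → c :+ x :* g := c :+ (x :- a) :* g :+ a :* g) refl c x a (g x) ⟩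
      c ⊕ (x ⊖ᶠ a) ⊗ g x ⊕ a ⊗ g x ≡⟨ cong (λ z → c ⊕ (x ⊖ᶠ a) ⊗ g x ⊕ a ⊗ z) (eh x) ⟩
      c ⊕ (x ⊖ᶠ a) ⊗ g x ⊕ a ⊗ (g a ⊕ (x ⊖ᶠ a) ⊗ h x)
        ≡⟨ solve 6 (λ c x a g ga h → c :+ (x :- a) :* g :+ a :* (ga :+ (x :- a) :* h) := (c :+ a :* ga) :+ (x :- a) :* (g :+ a :* h)) refl c x a (g x) (g a) (h x) ⟩
      (c ⊕ a ⊗ g a) ⊕ (x ⊖ᶠ a) ⊗ (g x ⊕ a ⊗ h x) ≡⟨ cong (_⊕ (x ⊖ᶠ a) ⊗ (g x ⊕ a ⊗ h x)) (sym (e a)) ⟩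
      f a ⊕ (x ⊖ᶠ a) ⊗ (g x ⊕ a ⊗ h x) ∎
      where open ≡-Reasoning

    roots≤degree : ∀ {ℓ n f} → ¬ ℓ ≡ 𝟘 → Lead ℓ n f → ∀ xs → Unique xs → All.All (λ x → f x ≡ 𝟘) xs → length xs ℕ.≤ n
    roots≤degree ℓ≢0 l [] _ _ = ℕ.z≤n
    roots≤degree ℓ≢0 (base e) (x ∷ xs) _ (p All.∷ _) = ⊥-elim (ℓ≢0 (trans (sym (e x)) p))
    roots≤degree {f = f} ℓ≢0 l@(step _ _ _ _) (a ∷ xs) (a∉ AP.∷ u) (p All.∷ ps) with factor l a
    ... | g , lg , eg = ℕ.s≤s (roots≤degree ℓ≢0 lg xs u (All.zipWith root (a∉ , ps)))
      where
      root : ∀ {x} → (¬ a ≡ x) × (f x ≡ 𝟘) → g x ≡ 𝟘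
      root {x} (a≢x , fx) = ⊗≡𝟘ʳ (λ z → a≢x (sym (⊖≡𝟘 z)))
        (trans (sym (trans (eg x) (trans (cong (_⊕ (x ⊖ᶠ a) ⊗ g x) p) (R.+-identityˡ _)))) fx)

    -- Polynomial functions with n coefficients. No leading coefficient is recorded, so they form a
    -- space of dimension at most n.
    Below : ℕ → (Carrier → Carrier) → Set
    Below zero    f = ∀ x → f x ≡ 𝟘
    Below (suc n) f = ∃ λ c → ∃ λ g → Below n g × (∀ x → f x ≡ c ⊕ x ⊗ g x)

    Lead⇒Below : ∀ {ℓ n f} → Lead ℓ n f → Below (suc n) f
    Lead⇒Below {ℓ} (base e) = ℓ , (λ _ → 𝟘) , (λ _ → refl) , λ x → trans (e x) (solve 2 (λ a x → a := a :+ x :* con (+ 0)) refl ℓ x)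
    Lead⇒Below (step c g l e) = c , g , Lead⇒Below l , e

    Below-lin : ∀ n {f g} → Below n f → ∀ r → Below n g → Below n (λ x → f x ⊖ᶠ r ⊗ g x)
    Below-lin zero    p r p′ x = trans (cong₂ (λ a b → a ⊖ᶠ r ⊗ b) (p x) (p′ x)) (solve 1 (λ r → con (+ 0) :- r :* con (+ 0) := con (+ 0)) refl r)
    Below-lin (suc n) (c , g , p , e) r (c′ , g′ , p′ , e′) = c ⊖ᶠ r ⊗ c′ , _ , Below-lin n p r p′ , λ x →
      trans (cong₂ (λ a b → a ⊖ᶠ r ⊗ b) (e x) (e′ x))
        (solve 6 (λ c x g r d h → (c :+ x :* g) :- r :* (d :+ x :* h) := (c :- r :* d) :+ x :* (g :- r :* h)) refl c x (g x) r c′ (g′ x))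

    Sum-≡𝟘 : ∀ {n} (t : Fin n → Carrier) → (∀ k → t k ≡ 𝟘) → Sum t ≡ 𝟘
    Sum-≡𝟘 {zero}  t h = refl
    Sum-≡𝟘 {suc n} t h = trans (cong₂ _⊕_ (h zero) (Sum-≡𝟘 (λ k → t (suc k)) (λ k → h (suc k)))) (R.+-identityˡ 𝟘)

    -- Gaussian elimination on constant coefficients. If they all vanish, a factor x splits off;
    -- otherwise a function i with nonzero constant coefficient is the pivot, and subtracting
    -- multiples of it lowers both counts by one.
    relation : ∀ n N → n ℕ.< N → (f : Fin N → Carrier → Carrier) → (∀ k → Below n (f k)) →
               ∃ λ (a : Fin N → Carrier) → (∃ λ k → ¬ a k ≡ 𝟘) × (∀ x → Sum (λ k → a k ⊗ f k x) ≡ 𝟘)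
    relation zero (suc N) _ f p = (λ _ → 𝟙) , (zero , λ e → 𝟘≢𝟙 (sym e)) ,
      λ x → Sum-≡𝟘 _ (λ k → trans (R.*-identityˡ _) (p k x))
    relation (suc n) (suc N) (ℕ.s≤s n<N) f p with any? (λ k → ¬? (proj₁ (p k) ≟ 𝟘))
    ... | no all0 with relation n (suc N) (ℕₚ.m<n⇒m<1+n n<N) (λ k → proj₁ (proj₂ (p k))) (λ k → proj₁ (proj₂ (proj₂ (p k))))
    ...   | a , nt , rel = a , nt , λ x → trans (Sum-cong (λ k → term x k)) (trans (sym (Sum-⊗ˡ x (λ k → a k ⊗ proj₁ (proj₂ (p k)) x))) (trans (cong (x ⊗_) (rel x)) (R.zeroʳ x)))
      where
      c0 : ∀ k → proj₁ (p k) ≡ 𝟘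
      c0 k with proj₁ (p k) ≟ 𝟘
      ... | yes e = e
      ... | no ne = ⊥-elim (all0 (k , ne))
      term : ∀ x k → a k ⊗ f k x ≡ x ⊗ (a k ⊗ proj₁ (proj₂ (p k)) x)
      term x k = trans (cong (a k ⊗_) (trans (proj₂ (proj₂ (proj₂ (p k))) x) (cong (_⊕ x ⊗ proj₁ (proj₂ (p k)) x) (c0 k))))
        (solve 3 (λ a x g → a :* (con (+ 0) :+ x :* g) := x :* (a :* g)) refl (a k) x (proj₁ (proj₂ (p k)) x))
    relation (suc n) (suc N) (ℕ.s≤s n<N) f p | yes (i , ci≢0) with relation n N n<N h (λ j → Below-lin n (proj₁ (proj₂ (proj₂ (p (punchIn i j))))) (ρ j) (proj₁ (proj₂ (proj₂ (p i)))))
      where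
      c : ∀ k → Carrier
      c k = proj₁ (p k)
      g : ∀ k → Carrier → Carrier
      g k = proj₁ (proj₂ (p k))
      ρ : Fin N → Carrier
      ρ j = inv (c i) ⊗ c (punchIn i j)
      h : Fin N → Carrier → Carrier
      h j x = g (punchIn i j) x ⊖ᶠ ρ j ⊗ g i x
    ... | a′ , (k₀ , nz₀) , rel = a , (punchIn i k₀ , λ e → nz₀ (trans (sym (insertAt-punchIn a′ i α k₀)) e)) , vanish
      where
      c : ∀ k → Carrier
      c k = proj₁ (p k)
      g : ∀ k → Carrier → Carrier
      g k = proj₁ (proj₂ (p k))
      ρ : Fin N → Carrier
      ρ j = inv (c i) ⊗ c (punchIn i j)
      h : Fin N → Carrier → Carrier
      h j x = g (punchIn i j) x ⊖ᶠ ρ j ⊗ g i x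
      α : Carrier
      α = ⊝ Sum (λ j → a′ j ⊗ ρ j)
      a : Fin (suc N) → Carrier
      a = insertAt a′ i α
      split : ∀ j x → f (punchIn i j) x ≡ ρ j ⊗ f i x ⊕ x ⊗ h j x
      split j x = begin
        f (punchIn i j) x ≡⟨ proj₂ (proj₂ (proj₂ (p (punchIn i j)))) x ⟩
        c (punchIn i j) ⊕ x ⊗ g (punchIn i j) x ≡⟨ cong (_⊕ x ⊗ g (punchIn i j) x) (sym (trans (R.*-comm _ _) (a⊗[inv-a⊗b] (c (punchIn i j)) ci≢0))) ⟩
        ρ j ⊗ c i ⊕ x ⊗ g (punchIn i j) x ≡⟨ solve 5 (λ r ci x gj gi → r :* ci :+ x :* gj := r :* (ci :+ x :* gi) :+ x :* (gj :- r :* gi)) refl (ρ j) (c i) x (g (punchIn i j) x) (g i x) ⟩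
        ρ j ⊗ (c i ⊕ x ⊗ g i x) ⊕ x ⊗ h j x ≡⟨ cong (λ z → ρ j ⊗ z ⊕ x ⊗ h j x) (sym (proj₂ (proj₂ (proj₂ (p i))) x)) ⟩
        ρ j ⊗ f i x ⊕ x ⊗ h j x ∎
        where open ≡-Reasoning
      vanish : ∀ x → Sum (λ k → a k ⊗ f k x) ≡ 𝟘
      vanish x = begin
        Sum (λ k → a k ⊗ f k x) ≡⟨ Sum-remove {i = i} (λ k → a k ⊗ f k x) ⟩
        a i ⊗ f i x ⊕ Sum (λ j → a (punchIn i j) ⊗ f (punchIn i j) x)
          ≡⟨ cong₂ _⊕_ (cong (_⊗ f i x) (insertAt-lookup a′ i α)) (Sum-cong (λ j → trans (cong₂ _⊗_ (insertAt-punchIn a′ i α j) (split j x))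
               (solve 5 (λ a r fi x h → a :* (r :* fi :+ x :* h) := a :* r :* fi :+ x :* (a :* h)) refl (a′ j) (ρ j) (f i x) x (h j x)))) ⟩
        α ⊗ f i x ⊕ Sum (λ j → a′ j ⊗ ρ j ⊗ f i x ⊕ x ⊗ (a′ j ⊗ h j x))
          ≡⟨ cong (α ⊗ f i x ⊕_) (trans (Sum-⊕ (λ j → a′ j ⊗ ρ j ⊗ f i x) (λ j → x ⊗ (a′ j ⊗ h j x)))
               (cong₂ _⊕_ (sym (Sum-⊗ʳ (f i x) (λ j → a′ j ⊗ ρ j))) (trans (sym (Sum-⊗ˡ x (λ j → a′ j ⊗ h j x))) (cong (x ⊗_) (rel x))))) ⟩
        α ⊗ f i x ⊕ (Sum (λ j → a′ j ⊗ ρ j) ⊗ f i x ⊕ x ⊗ 𝟘)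
          ≡⟨ solve 3 (λ s fi x → (:- s) :* fi :+ (s :* fi :+ x :* con (+ 0)) := con (+ 0)) refl (Sum (λ j → a′ j ⊗ ρ j)) (f i x) x ⟩
        𝟘 ∎
        where open ≡-Reasoning

    -- Numbering in descending order: `zero` receives the highest degree, so the first nonzero
    -- coefficient of a combination decides its degree.
    rev : ∀ {N} → Fin N → ℕ
    rev {suc N} zero    = N
    rev {suc N} (suc k) = rev k

    rev< : ∀ {N} (k : Fin N) → rev k ℕ.< N
    rev< {suc N} zero    = ℕₚ.≤-refl
    rev< {suc N} (suc k) = ℕₚ.m<n⇒m<1+n (rev< k)

    module _ (D : ℕ) (B : ℕ → Carrier → Carrier) where
      combination-Lead : ∀ {N} → (∀ n → n ℕ.< N → Monic (D ℕ.+ n) (B n)) → (a : Fin N → Carrier) →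
                         Lead 𝟘 (D ℕ.+ N) (λ x → Sum (λ k → a k ⊗ B (rev k) x))
      combination-Lead {zero}  monic a = zeroLead (D ℕ.+ 0)
        where
        zeroLead : ∀ n → Lead 𝟘 n (λ _ → 𝟘)
        zeroLead zero    = base (λ _ → refl)
        zeroLead (suc n) = Lead-raise (zeroLead n)
      combination-Lead {suc N} monic a = Lead-deg (sym (ℕₚ.+-suc D N))
        (Lead-raise (Lead-⊕ (Lead-scale (a zero) (monic N ℕₚ.≤-refl)) (combination-Lead (λ n n<N → monic n (ℕₚ.m<n⇒m<1+n n<N)) (λ k → a (suc k)))))

      combination-degree : ∀ {N} → (∀ n → n ℕ.< N → Monic (D ℕ.+ n) (B n)) → (a : Fin N → Carrier) → (∃ λ k → ¬ a k ≡ 𝟘) →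
        ∃ λ ℓ → ∃ λ n → (¬ ℓ ≡ 𝟘) × (n ℕ.< N) × Lead ℓ (D ℕ.+ n) (λ x → Sum (λ k → a k ⊗ B (rev k) x))
      combination-degree {suc N} monic a nt with a zero ≟ 𝟘
      ... | no a0≢0 = a zero , N , a0≢0 , ℕₚ.≤-refl , Lead-coef (trans (R.+-identityʳ _) (R.*-identityʳ _))
            (Lead-⊕ (Lead-scale (a zero) (monic N ℕₚ.≤-refl)) (combination-Lead (λ n n<N → monic n (ℕₚ.m<n⇒m<1+n n<N)) (λ k → a (suc k))))
      ... | yes a0≡0 with combination-degree (λ n n<N → monic n (ℕₚ.m<n⇒m<1+n n<N)) (λ k → a (suc k)) (nt′ nt)
        where
        nt′ : (∃ λ k → ¬ a k ≡ 𝟘) → ∃ λ k → ¬ a (suc k) ≡ 𝟘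
        nt′ (zero , n)  = ⊥-elim (n a0≡0)
        nt′ (suc k , n) = k , n
      ...   | ℓ , n , ℓ≢0 , n<N , l = ℓ , n , ℓ≢0 , ℕₚ.m<n⇒m<1+n n<N ,
              Lead-≗ (λ x → trans (cong (_⊕ Sum (λ k → a (suc k) ⊗ B (rev k) x)) (trans (cong (_⊗ B N x) a0≡0) (R.zeroˡ _))) (R.+-identityˡ _)) l

  -- Stepanov's method

  module Stepanov (K : EnumField) (m′ q′′ : ℕ) where
    open Polynomials K

    -- The field will satisfy x^(M²) = x. Indices n < N are read as n = k + m (j + q i) with digits
    -- k < m, j < q, i < I, and D bounds the degree of every `C n`. With I = m + 2 there are more
    -- indices than the D + 2 coefficients, for all m ≥ 1 and q ≥ 3.
    m q′ q M I N D : ℕ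
    m  = suc m′
    q′ = suc (suc q′′)
    q  = suc q′
    M  = m ℕ.* q
    I  = suc (suc m)
    N  = M ℕ.* I
    D  = m′ ℕ.* M ℕ.+ suc m ℕ.+ (m ℕ.* q′ ℕ.+ m ℕ.* q′)

    private
      dk dj di dj′ : ℕ → ℕ
      dk n  = n DM.% m
      dj n  = n DM./ m DM.% q
      di n  = n DM./ m DM./ q
      dj′ n = q′ ℕ.∸ dj n

      dj+dj′ : ∀ n → dj n ℕ.+ dj′ n ≡ q′
      dj+dj′ n = ℕₚ.m+[n∸m]≡n (ℕₚ.≤-pred (DM.m%n<n (n DM./ m) q))

      digits : ∀ n → n ≡ dk n ℕ.+ m ℕ.* (dj n ℕ.+ q ℕ.* di n)
      digits n = trans (DM.m≡m%n+[m/n]*n n m) (cong (dk n ℕ.+_) (trans (ℕₚ.*-comm _ m) (cong (m ℕ.*_)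
        (trans (DM.m≡m%n+[m/n]*n (n DM./ m) q) (cong (dj n ℕ.+_) (ℕₚ.*-comm (di n) q))))))

      di<I : ∀ {n} → n ℕ.< N → di n ℕ.< I
      di<I {n} n<N = DM.m<n*o⇒m/o<n (subst (n DM./ m ℕ.<_) (ℕₚ.*-comm q I) (DM.m<n*o⇒m/o<n
        (subst (n ℕ.<_) (trans (ℕₚ.*-assoc m q I) (ℕₚ.*-comm m (q ℕ.* I))) n<N)))

      N-large : suc (suc (suc D)) ℕ.≤ N
      -- The slack q″ + 4m′ + m′q″ is 0 exactly when m = 1 and q = 3.
      N-large = subst (suc (suc (suc D)) ℕ.≤_) (lem m′ q′′) (ℕₚ.m≤m+n _ (q′′ ℕ.+ 4 ℕ.* m′ ℕ.+ m′ ℕ.* q′′))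
        where
        lem : ∀ m′ q′′ → suc (suc (suc (m′ ℕ.* (suc m′ ℕ.* suc (suc (suc q′′))) ℕ.+ suc (suc m′) ℕ.+ (suc m′ ℕ.* suc (suc q′′) ℕ.+ suc m′ ℕ.* suc (suc q′′))))) ℕ.+ (q′′ ℕ.+ 4 ℕ.* m′ ℕ.+ m′ ℕ.* q′′)
          ≡ suc m′ ℕ.* suc (suc (suc q′′)) ℕ.* suc (suc (suc m′))
        lem = ℕ-Solver.solve-∀

    module _ (frob : ∀ x y → (x ⊕ y) ↑ M ≡ x ↑ M ⊕ y ↑ M) (fix : ∀ x → x ↑ (M ℕ.* M) ≡ x)
             {P : Carrier → Carrier} (monicP : Monic (m ℕ.+ m) P) (b : Carrier) where

      -- The defining relation of the counted points, with denominators cleared: P is x^m times a Laurent polynomial.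
      Good : Carrier → Set
      Good x = (¬ x ≡ 𝟘) × (x ↑ m ⊗ P x ↑ M ≡ x ↑ (m ℕ.* M) ⊗ (b ⊗ x ↑ m ⊖ᶠ P x))

      private
        s : Carrier → Carrier
        s x = b ⊗ x ↑ m ⊖ᶠ P x

        -- Put h = P / x^m. Then `B n` = x^(m q′) · x^(k + i M) h^j and `C n` = x^(m q′) · x^(k M +
        -- i) (b - h)^j, where x^(m q′) clears the denominators since j ≤ q′. As P has degree 2m,
        -- `B n` has degree m q′ + n, so these degrees are distinct, while the degrees of the `C n`
        -- stay small.
        B C : ℕ → Carrier → Carrier
        B n x = x ↑ (dk n ℕ.+ di n ℕ.* M ℕ.+ m ℕ.* dj′ n) ⊗ P x ↑ dj n
        C n x = x ↑ (dk n ℕ.* M ℕ.+ di n ℕ.+ m ℕ.* dj′ n) ⊗ s x ↑ dj n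

        B-monic : ∀ n → Monic (m ℕ.* q′ ℕ.+ n) (B n)
        B-monic n = Lead-deg eq (Monic-⊗ (Monic-x↑ _) (Monic-↑ monicP (dj n)))
          where
          lem : ∀ k i j j′ m q → k ℕ.+ i ℕ.* (m ℕ.* q) ℕ.+ m ℕ.* j′ ℕ.+ j ℕ.* (m ℕ.+ m) ≡ m ℕ.* (j ℕ.+ j′) ℕ.+ (k ℕ.+ m ℕ.* (j ℕ.+ q ℕ.* i))
          lem = ℕ-Solver.solve-∀
          eq : dk n ℕ.+ di n ℕ.* M ℕ.+ m ℕ.* dj′ n ℕ.+ dj n ℕ.* (m ℕ.+ m) ≡ m ℕ.* q′ ℕ.+ n
          eq = trans (lem (dk n) (di n) (dj n) (dj′ n) m q) (cong₂ (λ a b → m ℕ.* a ℕ.+ b) (dj+dj′ n) (sym (digits n)))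

        s-Lead : ∃ λ ℓ → Lead ℓ (m ℕ.+ m) s
        s-Lead = _ , Lead-≗ (λ x → cong (b ⊗ x ↑ m ⊕_) (solve 1 (λ p → :- p := :- con (+ 1) :* p) refl (P x)))
          (Lead-⊕ (Lead-< (ℕₚ.m<m+n m (ℕ.s≤s ℕ.z≤n)) (Lead-scale b (Monic-x↑ m))) (Lead-scale (⊝ 𝟙) monicP))

        C-Below : ∀ {n} → n ℕ.< N → Below (suc (suc D)) (C n)
        C-Below {n} n<N = Lead⇒Below (Lead-< (ℕ.s≤s le) (Lead-⊗ (Monic-x↑ _) (Lead-↑ (proj₂ s-Lead) (dj n))))
          where
          lem : ∀ j j′ m → m ℕ.* j′ ℕ.+ j ℕ.* (m ℕ.+ m) ≡ m ℕ.* (j ℕ.+ j′) ℕ.+ m ℕ.* j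
          lem = ℕ-Solver.solve-∀
          le : dk n ℕ.* M ℕ.+ di n ℕ.+ m ℕ.* dj′ n ℕ.+ dj n ℕ.* (m ℕ.+ m) ℕ.≤ D
          le = subst (ℕ._≤ D) (sym (trans (ℕₚ.+-assoc (dk n ℕ.* M ℕ.+ di n) _ _) (cong (dk n ℕ.* M ℕ.+ di n ℕ.+_) (trans (lem (dj n) (dj′ n) m) (cong (λ z → m ℕ.* z ℕ.+ m ℕ.* dj n) (dj+dj′ n))))))
            (ℕₚ.+-mono-≤ (ℕₚ.+-mono-≤ (ℕₚ.*-monoˡ-≤ M (ℕₚ.≤-pred (DM.m%n<n n m))) (ℕₚ.≤-pred (di<I n<N)))
              (ℕₚ.+-monoʳ-≤ (m ℕ.* q′) (ℕₚ.*-monoʳ-≤ m (ℕₚ.≤-pred (DM.m%n<n (n DM./ m) q)))))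

        -- At a good point the M-th power, an involution of the field, turns B n into C n.
        B↑M : ∀ n {x} → Good x → x ↑ (m ℕ.* q′) ⊗ B n x ↑ M ≡ x ↑ (m ℕ.* q′ ℕ.* M) ⊗ C n x
        B↑M n {x} (_ , star) = begin
          x ↑ (m ℕ.* q′) ⊗ (x ↑ e ⊗ P x ↑ j) ↑ M
            ≡⟨ cong₂ _⊗_ (cong (x ↑_) (trans (cong (m ℕ.*_) (sym (dj+dj′ n))) (ℕₚ.*-distribˡ-+ m j j′))) (trans (↑-⊗ (x ↑ e) (P x ↑ j) M)
                 (cong₂ _⊗_ (↑-* x e M) (trans (↑-* (P x) j M) (trans (cong (P x ↑_) (ℕₚ.*-comm j M)) (sym (↑-* (P x) M j)))))) ⟩
          x ↑ (m ℕ.* j ℕ.+ m ℕ.* j′) ⊗ (x ↑ (e ℕ.* M) ⊗ (P x ↑ M) ↑ j)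
            ≡⟨ cong (_⊗ (x ↑ (e ℕ.* M) ⊗ (P x ↑ M) ↑ j)) (trans (↑-+ x (m ℕ.* j) (m ℕ.* j′)) (cong (_⊗ x ↑ (m ℕ.* j′)) (sym (↑-* x m j)))) ⟩
          (x ↑ m) ↑ j ⊗ x ↑ (m ℕ.* j′) ⊗ (x ↑ (e ℕ.* M) ⊗ (P x ↑ M) ↑ j)
            ≡⟨ solve 4 (λ a b c d → a :* b :* (c :* d) := (b :* c) :* (a :* d)) refl ((x ↑ m) ↑ j) (x ↑ (m ℕ.* j′)) (x ↑ (e ℕ.* M)) ((P x ↑ M) ↑ j) ⟩
          x ↑ (m ℕ.* j′) ⊗ x ↑ (e ℕ.* M) ⊗ ((x ↑ m) ↑ j ⊗ (P x ↑ M) ↑ j)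
            ≡⟨ cong₂ _⊗_ (sym (↑-+ x (m ℕ.* j′) (e ℕ.* M))) (trans (sym (↑-⊗ (x ↑ m) (P x ↑ M) j)) (trans (cong (_↑ j) star) (trans (↑-⊗ (x ↑ (m ℕ.* M)) (s x) j) (cong (_⊗ s x ↑ j) (↑-* x (m ℕ.* M) j))))) ⟩
          x ↑ (m ℕ.* j′ ℕ.+ e ℕ.* M) ⊗ (x ↑ (m ℕ.* M ℕ.* j) ⊗ s x ↑ j)
            ≡⟨ trans (sym (R.*-assoc _ _ _)) (cong (_⊗ s x ↑ j) (sym (↑-+ x (m ℕ.* j′ ℕ.+ e ℕ.* M) (m ℕ.* M ℕ.* j)))) ⟩
          x ↑ (m ℕ.* j′ ℕ.+ e ℕ.* M ℕ.+ m ℕ.* M ℕ.* j) ⊗ s x ↑ j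
            ≡⟨ cong (λ z → x ↑ z ⊗ s x ↑ j) (lem₁ k i j j′ m M) ⟩
          x ↑ (M ℕ.* M ℕ.* i ℕ.+ (m ℕ.* (j ℕ.+ j′) ℕ.* M ℕ.+ (k ℕ.* M ℕ.+ m ℕ.* j′))) ⊗ s x ↑ j
            ≡⟨ cong (_⊗ s x ↑ j) (trans (↑-+ x (M ℕ.* M ℕ.* i) _) (trans (cong (_⊗ x ↑ (m ℕ.* (j ℕ.+ j′) ℕ.* M ℕ.+ (k ℕ.* M ℕ.+ m ℕ.* j′))) (trans (sym (↑-* x (M ℕ.* M) i)) (cong (_↑ i) (fix x)))) (sym (↑-+ x i _)))) ⟩
          x ↑ (i ℕ.+ (m ℕ.* (j ℕ.+ j′) ℕ.* M ℕ.+ (k ℕ.* M ℕ.+ m ℕ.* j′))) ⊗ s x ↑ j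
            ≡⟨ cong (λ z → x ↑ z ⊗ s x ↑ j) (trans (lem₂ k i (m ℕ.* (j ℕ.+ j′) ℕ.* M) (m ℕ.* j′) M) (cong (λ z → m ℕ.* z ℕ.* M ℕ.+ (k ℕ.* M ℕ.+ i ℕ.+ m ℕ.* j′)) (dj+dj′ n))) ⟩
          x ↑ (m ℕ.* q′ ℕ.* M ℕ.+ (k ℕ.* M ℕ.+ i ℕ.+ m ℕ.* j′)) ⊗ s x ↑ j
            ≡⟨ trans (cong (_⊗ s x ↑ j) (↑-+ x (m ℕ.* q′ ℕ.* M) _)) (R.*-assoc _ _ _) ⟩
          x ↑ (m ℕ.* q′ ℕ.* M) ⊗ C n x ∎
          where
          open ≡-Reasoning
          k = dk n
          i = di n
          j = dj n
          j′ = dj′ n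
          e = k ℕ.+ i ℕ.* M ℕ.+ m ℕ.* j′
          lem₁ : ∀ k i j j′ m M → m ℕ.* j′ ℕ.+ (k ℕ.+ i ℕ.* M ℕ.+ m ℕ.* j′) ℕ.* M ℕ.+ m ℕ.* M ℕ.* j ≡ M ℕ.* M ℕ.* i ℕ.+ (m ℕ.* (j ℕ.+ j′) ℕ.* M ℕ.+ (k ℕ.* M ℕ.+ m ℕ.* j′))
          lem₁ = ℕ-Solver.solve-∀
          lem₂ : ∀ k i z w M → i ℕ.+ (z ℕ.+ (k ℕ.* M ℕ.+ w)) ≡ z ℕ.+ (k ℕ.* M ℕ.+ i ℕ.+ w)
          lem₂ = ℕ-Solver.solve-∀

        frob-Sum : ∀ {n} (t : Fin n → Carrier) → Sum t ↑ M ≡ Sum (λ k → t k ↑ M)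
        frob-Sum {zero}  t = R.zeroˡ _
        frob-Sum {suc n} t = trans (frob (t zero) _) (cong (t zero ↑ M ⊕_) (frob-Sum (λ k → t (suc k))))

      private
        -- The M-th power is additive and returns α^M to α, so it carries Σ α^M B to Σ α C up to
        -- powers of x ≠ 0. The latter is 0, and only 0 has M-th power 0.
        combination-vanishes : (α : Fin N → Carrier) → (∀ x → Sum (λ k → α k ⊗ C (rev k) x) ≡ 𝟘) →
                               ∀ {x} → Good x → Sum (λ k → α k ↑ M ⊗ B (rev k) x) ≡ 𝟘
        combination-vanishes α rel {x} gx = go (y ≟ 𝟘)
          where
          open ≡-Reasoning
          y = Sum (λ k → α k ↑ M ⊗ B (rev k) x)
          term : ∀ k → x ↑ (m ℕ.* q′) ⊗ (α k ↑ M ⊗ B (rev k) x) ↑ M ≡ x ↑ (m ℕ.* q′ ℕ.* M) ⊗ (α k ⊗ C (rev k) x)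
          term k = begin
            x ↑ (m ℕ.* q′) ⊗ (α k ↑ M ⊗ B (rev k) x) ↑ M ≡⟨ cong (x ↑ (m ℕ.* q′) ⊗_) (trans (↑-⊗ (α k ↑ M) (B (rev k) x) M) (cong (_⊗ B (rev k) x ↑ M) (trans (↑-* (α k) M M) (fix (α k))))) ⟩
            x ↑ (m ℕ.* q′) ⊗ (α k ⊗ B (rev k) x ↑ M) ≡⟨ solve 3 (λ a b c → a :* (b :* c) := b :* (a :* c)) refl (x ↑ (m ℕ.* q′)) (α k) (B (rev k) x ↑ M) ⟩
            α k ⊗ (x ↑ (m ℕ.* q′) ⊗ B (rev k) x ↑ M) ≡⟨ cong (α k ⊗_) (B↑M (rev k) gx) ⟩
            α k ⊗ (x ↑ (m ℕ.* q′ ℕ.* M) ⊗ C (rev k) x) ≡⟨ solve 3 (λ a b c → a :* (b :* c) := b :* (a :* c)) refl (α k) (x ↑ (m ℕ.* q′ ℕ.* M)) (C (rev k) x) ⟩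
            x ↑ (m ℕ.* q′ ℕ.* M) ⊗ (α k ⊗ C (rev k) x) ∎
          go : Dec (y ≡ 𝟘) → y ≡ 𝟘
          go (yes e) = e
          go (no y≢0) = ⊥-elim (⊗≢𝟘 (↑≢𝟘 (proj₁ gx) (m ℕ.* q′)) (↑≢𝟘 y≢0 M) (begin
            x ↑ (m ℕ.* q′) ⊗ Sum (λ k → α k ↑ M ⊗ B (rev k) x) ↑ M ≡⟨ cong (x ↑ (m ℕ.* q′) ⊗_) (frob-Sum (λ k → α k ↑ M ⊗ B (rev k) x)) ⟩
            x ↑ (m ℕ.* q′) ⊗ Sum (λ k → (α k ↑ M ⊗ B (rev k) x) ↑ M) ≡⟨ Sum-⊗ˡ (x ↑ (m ℕ.* q′)) (λ k → (α k ↑ M ⊗ B (rev k) x) ↑ M) ⟩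
            Sum (λ k → x ↑ (m ℕ.* q′) ⊗ (α k ↑ M ⊗ B (rev k) x) ↑ M) ≡⟨ Sum-cong term ⟩
            Sum (λ k → x ↑ (m ℕ.* q′ ℕ.* M) ⊗ (α k ⊗ C (rev k) x)) ≡⟨ sym (Sum-⊗ˡ (x ↑ (m ℕ.* q′ ℕ.* M)) (λ k → α k ⊗ C (rev k) x)) ⟩
            x ↑ (m ℕ.* q′ ℕ.* M) ⊗ Sum (λ k → α k ⊗ C (rev k) x) ≡⟨ trans (cong (x ↑ (m ℕ.* q′ ℕ.* M) ⊗_) (rel x)) (R.zeroʳ _) ⟩
            𝟘 ∎))

        relation-C : ∃ λ (α : Fin N → Carrier) → (∃ λ k → ¬ α k ≡ 𝟘) × (∀ x → Sum (λ k → α k ⊗ C (rev k) x) ≡ 𝟘)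
        relation-C = relation (suc (suc D)) N N-large (λ k → C (rev k)) (λ k → C-Below (rev< k))

        count-from : ∀ xs → Unique xs → All.All Good xs →
                     (∃ λ (α : Fin N → Carrier) → (∃ λ k → ¬ α k ≡ 𝟘) × (∀ x → Sum (λ k → α k ⊗ C (rev k) x) ≡ 𝟘)) →
                     length xs ℕ.≤ M ℕ.* m ℕ.+ 3 ℕ.* M
        count-from xs u good (α , (k₀ , αk₀≢0) , rel) = go (combination-degree (m ℕ.* q′) B (λ n _ → B-monic n) (λ k → α k ↑ M) (k₀ , ↑≢𝟘 αk₀≢0 M))
          where
          lem : ∀ M m → M ℕ.+ M ℕ.* suc (suc m) ≡ M ℕ.* m ℕ.+ 3 ℕ.* M
          lem = ℕ-Solver.solve-∀
          le : ∀ {n} → n ℕ.< N → m ℕ.* q′ ℕ.+ n ℕ.≤ M ℕ.* m ℕ.+ 3 ℕ.* M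
          le {n} n<N = subst (m ℕ.* q′ ℕ.+ n ℕ.≤_) (lem M m) (ℕₚ.+-mono-≤ (ℕₚ.*-monoʳ-≤ m (ℕₚ.n≤1+n q′)) (ℕₚ.<⇒≤ n<N))
          go : (∃ λ ℓ → ∃ λ n → (¬ ℓ ≡ 𝟘) × (n ℕ.< N) × Lead ℓ (m ℕ.* q′ ℕ.+ n) (λ x → Sum (λ k → α k ↑ M ⊗ B (rev k) x))) →
               length xs ℕ.≤ M ℕ.* m ℕ.+ 3 ℕ.* M
          go (ℓ , n , ℓ≢0 , n<N , l) = ℕₚ.≤-trans (roots≤degree ℓ≢0 l xs u (All.map (combination-vanishes α rel) good)) (le n<N)

      -- There are too many `C n` to be independent. A relation among them yields a combination of
      -- the `B n`, nonzero because their degrees differ, of degree below m q′ + N, with every good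
      -- point as a root.
      good-count : ∀ xs → Unique xs → All.All Good xs → length xs ℕ.≤ M ℕ.* m ℕ.+ 3 ℕ.* M
      good-count xs u good = count-from xs u good relation-C

  -- Quadratic extensions and Frobenius

  elems-unique : {A : Set} (E : Enum A) → Unique (Enum.elems E)
  elems-unique E = go elems (λ a → ≤-reflexive (once a))
    where
    open Enum E
    none : ∀ a xs → ∑[ x ∈ xs ] χ (x ≟ a) ≤ 0ℤ → All.All (λ y → ¬ a ≡ y) xs
    none a []       _ = All.[]
    none a (x ∷ xs) h with x ≟ a
    ... | no n  = (λ e → n (sym e)) All.∷ none a xs (subst (_≤ 0ℤ) (+-identityˡ _) h)
    ... | yes _ = ⊥-elim (1≰0 (≤-trans (subst (_≤ 1ℤ + ∑ xs (λ x → χ (x ≟ a))) (+-identityʳ 1ℤ) (+-monoʳ-≤ 1ℤ (∑-≥0 xs (λ x → 0≤χ (x ≟ a))))) h))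
      where
      1≰0 : ¬ 1ℤ ≤ 0ℤ
      1≰0 (+≤+ ())
    go : ∀ xs → (∀ a → ∑[ x ∈ xs ] χ (x ≟ a) ≤ 1ℤ) → Unique xs
    go []       _ = AP.[]
    go (x ∷ xs) h = none x xs (0≤-⇒≤ (subst (0ℤ ≤_) (lem S) (≤⇒0≤- (subst (λ z → z + S ≤ 1ℤ) (χ-yes (x ≟ x) refl) (h x)))))
        AP.∷ go xs (λ a → ≤-trans (subst (_≤ χ (x ≟ a) + ∑ xs (λ y → χ (y ≟ a))) (+-identityˡ _) (+-monoˡ-≤ _ (0≤χ (x ≟ a)))) (h a))
      where
      S = ∑[ y ∈ xs ] χ (y ≟ x)
      lem : ∀ s → 1ℤ - (1ℤ + s) ≡ 0ℤ - s
      lem = solve-∀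

  module QuadraticExtension (K : EnumField) (ν : EnumField.Carrier K)
                            (nonsquare : ∀ x → ¬ EnumField._⊗_ K x x ≡ ν) where
    open FieldKit K

    L : Set
    L = Carrier × Carrier

    _⊕ˡ_ _⊗ˡ_ : L → L → L
    (a , b) ⊕ˡ (c , d) = a ⊕ c , b ⊕ d
    (a , b) ⊗ˡ (c , d) = a ⊗ c ⊕ ν ⊗ (b ⊗ d) , a ⊗ d ⊕ b ⊗ c

    ⊝ˡ_ : L → L
    ⊝ˡ (a , b) = ⊝ a , ⊝ b

    conj-norm : L → Carrier
    conj-norm (a , b) = a ⊗ a ⊖ᶠ ν ⊗ (b ⊗ b)

    conj-norm≡𝟘 : ∀ a b → conj-norm (a , b) ≡ 𝟘 → (a , b) ≡ (𝟘 , 𝟘)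
    conj-norm≡𝟘 a b h with b ≟ 𝟘
    ... | no b≢0 = ⊥-elim (nonsquare (a ⊗ inv b) (begin
      a ⊗ inv b ⊗ (a ⊗ inv b) ≡⟨ solve 2 (λ a v → a :* v :* (a :* v) := a :* a :* (v :* v)) refl a (inv b) ⟩
      a ⊗ a ⊗ (inv b ⊗ inv b) ≡⟨ cong (_⊗ (inv b ⊗ inv b)) (⊖≡𝟘 h) ⟩
      ν ⊗ (b ⊗ b) ⊗ (inv b ⊗ inv b) ≡⟨ solve 3 (λ n b v → n :* (b :* b) :* (v :* v) := n :* (b :* v) :* (b :* v)) refl ν b (inv b) ⟩
      ν ⊗ (b ⊗ inv b) ⊗ (b ⊗ inv b) ≡⟨ cong (λ z → ν ⊗ z ⊗ z) (inv-right b b≢0) ⟩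
      ν ⊗ 𝟙 ⊗ 𝟙 ≡⟨ trans (R.*-identityʳ _) (R.*-identityʳ _) ⟩
      ν ∎))
      where open ≡-Reasoning
    ... | yes refl with a ≟ 𝟘
    ...   | yes refl = refl
    ...   | no a≢0   = ⊥-elim (⊗≢𝟘 a≢0 a≢0 (trans (solve 2 (λ a n → a :* a := a :* a :- n :* (con (+ 0) :* con (+ 0))) refl a ν) h))

    invˡ : L → L
    invˡ (a , b) = a ⊗ inv (conj-norm (a , b)) , ⊝ b ⊗ inv (conj-norm (a , b))

    isCommutativeRingˡ : IsCommutativeRing _≡_ _⊕ˡ_ _⊗ˡ_ ⊝ˡ_ (𝟘 , 𝟘) (𝟙 , 𝟘)
    isCommutativeRingˡ = record
      { isRing = record
        { +-isAbelianGroup = record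
          { isGroup = record
            { isMonoid = record
              { isSemigroup = record
                { isMagma = isMagma _⊕ˡ_
                ; assoc   = λ { (a , b) (c , d) (e , f) → cong₂ _,_ (R.+-assoc a c e) (R.+-assoc b d f) } }
              ; identity = (λ { (a , b) → cong₂ _,_ (R.+-identityˡ a) (R.+-identityˡ b) })
                         , (λ { (a , b) → cong₂ _,_ (R.+-identityʳ a) (R.+-identityʳ b) }) }
            ; inverse = (λ { (a , b) → cong₂ _,_ (R.-‿inverseˡ a) (R.-‿inverseˡ b) })
                      , (λ { (a , b) → cong₂ _,_ (R.-‿inverseʳ a) (R.-‿inverseʳ b) })
            ; ⁻¹-cong = cong ⊝ˡ_ }
          ; comm = λ { (a , b) (c , d) → cong₂ _,_ (R.+-comm a c) (R.+-comm b d) } }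
        ; *-cong = cong₂ _⊗ˡ_
        ; *-assoc = λ { (a , b) (c , d) (e , f) → cong₂ _,_
            (solve 7 (λ n a b c d e f → (a :* c :+ n :* (b :* d)) :* e :+ n :* ((a :* d :+ b :* c) :* f)
              := a :* (c :* e :+ n :* (d :* f)) :+ n :* (b :* (c :* f :+ d :* e))) refl ν a b c d e f)
            (solve 7 (λ n a b c d e f → (a :* c :+ n :* (b :* d)) :* f :+ (a :* d :+ b :* c) :* e
              := a :* (c :* f :+ d :* e) :+ b :* (c :* e :+ n :* (d :* f))) refl ν a b c d e f) }
        ; *-identity = (λ { (a , b) → cong₂ _,_
              (solve 3 (λ n a b → con (+ 1) :* a :+ n :* (con (+ 0) :* b) := a) refl ν a b)
              (solve 2 (λ a b → con (+ 1) :* b :+ con (+ 0) :* a := b) refl a b) })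
          , (λ { (a , b) → cong₂ _,_
              (solve 3 (λ n a b → a :* con (+ 1) :+ n :* (b :* con (+ 0)) := a) refl ν a b)
              (solve 2 (λ a b → a :* con (+ 0) :+ b :* con (+ 1) := b) refl a b) })
        ; distrib = (λ { (a , b) (c , d) (e , f) → cong₂ _,_
              (solve 7 (λ n a b c d e f → a :* (c :+ e) :+ n :* (b :* (d :+ f)) := (a :* c :+ n :* (b :* d)) :+ (a :* e :+ n :* (b :* f))) refl ν a b c d e f)
              (solve 6 (λ a b c d e f → a :* (d :+ f) :+ b :* (c :+ e) := (a :* d :+ b :* c) :+ (a :* f :+ b :* e)) refl a b c d e f) })
          , (λ { (a , b) (c , d) (e , f) → cong₂ _,_
              (solve 7 (λ n a b c d e f → (c :+ e) :* a :+ n :* ((d :+ f) :* b) := (c :* a :+ n :* (d :* b)) :+ (e :* a :+ n :* (f :* b))) refl ν a b c d e f)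
              (solve 6 (λ a b c d e f → (c :+ e) :* b :+ (d :+ f) :* a := (c :* b :+ d :* a) :+ (e :* b :+ f :* a)) refl a b c d e f) })
        }
      ; *-comm = λ { (a , b) (c , d) → cong₂ _,_
          (solve 5 (λ n a b c d → a :* c :+ n :* (b :* d) := c :* a :+ n :* (d :* b)) refl ν a b c d)
          (solve 4 (λ a b c d → a :* d :+ b :* c := c :* b :+ d :* a) refl a b c d) }
      }

    extension : EnumField
    extension = record
      { Carrier = L ; _⊕_ = _⊕ˡ_ ; _⊗_ = _⊗ˡ_ ; ⊝_ = ⊝ˡ_ ; 𝟘 = 𝟘 , 𝟘 ; 𝟙 = 𝟙 , 𝟘
      ; isCommutativeRing = isCommutativeRingˡ
      ; 𝟘≢𝟙 = λ e → 𝟘≢𝟙 (cong proj₁ e)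
      ; inv = invˡ
      ; inv-right = λ { (a , b) z≢0 → cong₂ _,_
          (trans (solve 4 (λ n a b v → a :* (a :* v) :+ n :* (b :* (:- b :* v)) := (a :* a :- n :* (b :* b)) :* v) refl ν a b (inv (conj-norm (a , b))))
            (inv-right _ (λ h → z≢0 (conj-norm≡𝟘 a b h))))
          (solve 3 (λ a b v → a :* (:- b :* v) :+ b :* (a :* v) := con (+ 0)) refl a b (inv (conj-norm (a , b)))) }
      ; enum = pairEnum enum enum
      }

    extension-sum : ∀ f → ∑ (EnumField.elems extension) f ≡ Σᶠ (λ a → Σᶠ (λ b → f (a , b)))
    extension-sum f = ∑-pairs elems elems f

  record Hom (F K : EnumField) : Set where
    private
      module F = EnumField F
      module K = EnumField K
    field
      ι   : F.Carrier → K.Carrier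
      ι-⊕ : ∀ a b → ι (a F.⊕ b) ≡ ι a K.⊕ ι b
      ι-⊗ : ∀ a b → ι (a F.⊗ b) ≡ ι a K.⊗ ι b
      ι-𝟘 : ι F.𝟘 ≡ K.𝟘
      ι-𝟙 : ι F.𝟙 ≡ K.𝟙

  idHom : ∀ F → Hom F F
  idHom F = record { ι = λ a → a ; ι-⊕ = λ _ _ → refl ; ι-⊗ = λ _ _ → refl ; ι-𝟘 = refl ; ι-𝟙 = refl }

  -- The coefficients of (1 + X)^q - X^q - 1 vanish, being those of a polynomial of degree less than q with q roots.
  module Frobenius (F : EnumField) (q′ : ℕ) (fermat : ∀ x → Polynomials._↑_ F x (suc q′) ≡ x)
                   (size≡ : EnumField.size F ≡ + suc q′) where
    private
      module F = Polynomials F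
      q = suc q′

      -- The coefficients of (1 + X)^n - X^n by Pascal's rule. Leaving out the leading one keeps the
      -- degree below n, so that for n = q the q elements of F are too many roots.
      binomials : ∀ n → Vec F.Carrier n
      binomials zero    = []
      binomials (suc n) = zipWith F._⊕_ (binomials n ∷ʳ F.𝟙) (F.𝟘 ∷ binomials n)

    module _ (K : EnumField) (H : Hom F K) where
      open Polynomials K
      open Hom H

      horner : ∀ {n} → Vec F.Carrier n → Carrier → Carrier
      horner []      z = 𝟘
      horner (c ∷ v) z = ι c ⊕ z ⊗ horner v z

      private
        horner-∷ʳ : ∀ {n} (v : Vec F.Carrier n) c z → horner (v ∷ʳ c) z ≡ horner v z ⊕ ι c ⊗ z ↑ n
        horner-∷ʳ []      c z = solve 2 (λ c z → c :+ z :* con (+ 0) := con (+ 0) :+ c :* con (+ 1)) refl (ι c) z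
        horner-∷ʳ {suc n} (d ∷ v) c z = trans (cong (λ w → ι d ⊕ z ⊗ w) (horner-∷ʳ v c z))
          (solve 5 (λ d z h c p → d :+ z :* (h :+ c :* p) := (d :+ z :* h) :+ c :* (z :* p)) refl (ι d) z (horner v z) (ι c) (z ↑ n))

        horner-zip : ∀ {n} (v w : Vec F.Carrier n) z → horner (zipWith F._⊕_ v w) z ≡ horner v z ⊕ horner w z
        horner-zip []      []      z = sym (R.+-identityˡ 𝟘)
        horner-zip (c ∷ v) (d ∷ w) z = trans (cong₂ (λ a b → a ⊕ z ⊗ b) (ι-⊕ c d) (horner-zip v w z))
          (solve 5 (λ c d z a b → c :+ d :+ z :* (a :+ b) := (c :+ z :* a) :+ (d :+ z :* b)) refl (ι c) (ι d) z (horner v z) (horner w z))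

      horner-binomials : ∀ n z → (𝟙 ⊕ z) ↑ n ≡ z ↑ n ⊕ horner (binomials n) z
      horner-binomials zero    z = sym (R.+-identityʳ 𝟙)
      horner-binomials (suc n) z = begin
        (𝟙 ⊕ z) ⊗ (𝟙 ⊕ z) ↑ n ≡⟨ cong ((𝟙 ⊕ z) ⊗_) (horner-binomials n z) ⟩
        (𝟙 ⊕ z) ⊗ (z ↑ n ⊕ h) ≡⟨ solve 3 (λ z p h → (con (+ 1) :+ z) :* (p :+ h) := z :* p :+ ((h :+ con (+ 1) :* p) :+ (con (+ 0) :+ z :* h))) refl z (z ↑ n) h ⟩
        z ⊗ z ↑ n ⊕ ((h ⊕ 𝟙 ⊗ z ↑ n) ⊕ (𝟘 ⊕ z ⊗ h))
          ≡⟨ cong₂ (λ a b → z ⊗ z ↑ n ⊕ ((h ⊕ a ⊗ z ↑ n) ⊕ (b ⊕ z ⊗ h))) (sym ι-𝟙) (sym ι-𝟘) ⟩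
        z ⊗ z ↑ n ⊕ ((h ⊕ ι F.𝟙 ⊗ z ↑ n) ⊕ (ι F.𝟘 ⊕ z ⊗ h))
          ≡⟨ cong (z ⊗ z ↑ n ⊕_) (sym (trans (horner-zip (binomials n ∷ʳ F.𝟙) (F.𝟘 ∷ binomials n) z) (cong (_⊕ horner (F.𝟘 ∷ binomials n) z) (horner-∷ʳ (binomials n) F.𝟙 z)))) ⟩
        z ↑ suc n ⊕ horner (binomials (suc n)) z ∎
        where
        open ≡-Reasoning
        h = horner (binomials n) z

      horner-zero : ∀ n z → horner (replicate n F.𝟘) z ≡ 𝟘
      horner-zero zero    z = refl
      horner-zero (suc n) z = trans (cong₂ (λ a b → a ⊕ z ⊗ b) ι-𝟘 (horner-zero n z)) (solve 1 (λ z → con (+ 0) :+ z :* con (+ 0) := con (+ 0)) refl z)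

    private
      hF : ∀ {n} → Vec F.Carrier n → F.Carrier → F.Carrier
      hF = horner F (idHom F)

      horner-Lead : ∀ {n} (v : Vec F.Carrier n) →
        (v ≡ replicate n F.𝟘) ⊎ (∃ λ ℓ → ∃ λ m → (¬ ℓ ≡ F.𝟘) × (m ℕ.< n) × F.Lead ℓ m (hF v))
      horner-Lead []      = inj₁ refl
      horner-Lead {suc n} (c ∷ v) with horner-Lead v
      ... | inj₂ (ℓ , m , ℓ≢0 , m<n , l) = inj₂ (ℓ , suc m , ℓ≢0 , ℕ.s≤s m<n , F.step c (hF v) l (λ _ → refl))
      ... | inj₁ refl with c F.≟ F.𝟘
      ...   | yes refl = inj₁ refl
      ...   | no c≢0   = inj₂ (c , 0 , c≢0 , ℕ.s≤s ℕ.z≤n , F.base (λ x → trans (cong (λ w → c F.⊕ x F.⊗ w) (horner-zero F (idHom F) n x))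
                           (F.solve 2 (λ c x → c F.:+ x F.:* F.con (+ 0) F.:= c) refl c x)))

      vanishing : ∀ (v : Vec F.Carrier q) → (∀ z → hF v z ≡ F.𝟘) → v ≡ replicate q F.𝟘
      vanishing v h with horner-Lead v
      ... | inj₁ e = e
      ... | inj₂ (ℓ , m , ℓ≢0 , m<q , l) = ⊥-elim (ℕₚ.<⇒≱ m<q (subst (ℕ._≤ m) len
              (F.roots≤degree ℓ≢0 l F.elems (elems-unique F.enum) (All.universal h F.elems))))
        where
        len : length F.elems ≡ q
        len = +-injective (trans (sym (∑-length F.elems)) size≡)

      -- On F, `fermat` reduces q-th powers to the identity, so the polynomial vanishes as a
      -- function. The conclusion concerns coefficients in F and therefore holds in every extension
      -- K, where `fermat` for the exponent q fails in general.
      binomials≡ : binomials q ≡ F.𝟙 ∷ replicate q′ F.𝟘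
      binomials≡ with binomials q in eq
      ... | c ∷ v = cong₂ _∷_ (F.⊖≡𝟘 (cong Vec.head zeros)) (cong Vec.tail zeros)
        where
        zeros : (c F.⊖ᶠ F.𝟙) ∷ v ≡ replicate q F.𝟘
        zeros = vanishing ((c F.⊖ᶠ F.𝟙) ∷ v) (λ z → begin
          (c F.⊖ᶠ F.𝟙) F.⊕ z F.⊗ hF v z ≡⟨ F.solve 4 (λ c z h p → (c F.:- F.con (+ 1)) F.:+ z F.:* h F.:= (p F.:+ (c F.:+ z F.:* h)) F.:- (F.con (+ 1) F.:+ p)) refl c z (hF v z) z ⟩
          (z F.⊕ hF (c ∷ v) z) F.⊖ᶠ (F.𝟙 F.⊕ z) ≡⟨ cong₂ (λ a b → (a F.⊕ b) F.⊖ᶠ (F.𝟙 F.⊕ z)) (sym (fermat z)) (cong (λ w → hF w z) (sym eq)) ⟩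
          (z F.↑ q F.⊕ hF (binomials q) z) F.⊖ᶠ (F.𝟙 F.⊕ z) ≡⟨ cong (F._⊖ᶠ (F.𝟙 F.⊕ z)) (sym (horner-binomials F (idHom F) q z)) ⟩
          (F.𝟙 F.⊕ z) F.↑ q F.⊖ᶠ (F.𝟙 F.⊕ z) ≡⟨ cong (F._⊖ᶠ (F.𝟙 F.⊕ z)) (fermat (F.𝟙 F.⊕ z)) ⟩
          (F.𝟙 F.⊕ z) F.⊖ᶠ (F.𝟙 F.⊕ z) ≡⟨ F.R.-‿inverseʳ _ ⟩
          F.𝟘 ∎)
          where open ≡-Reasoning

    module _ (K : EnumField) (H : Hom F K) where
      open Polynomials K
      open Hom H

      private
        frob-𝟙 : ∀ z → (𝟙 ⊕ z) ↑ q ≡ 𝟙 ⊕ z ↑ q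
        frob-𝟙 z = begin
          (𝟙 ⊕ z) ↑ q ≡⟨ horner-binomials K H q z ⟩
          z ↑ q ⊕ horner K H (binomials q) z ≡⟨ cong (λ w → z ↑ q ⊕ horner K H w z) binomials≡ ⟩
          z ↑ q ⊕ (ι F.𝟙 ⊕ z ⊗ horner K H (replicate q′ F.𝟘) z) ≡⟨ cong₂ (λ a b → z ↑ q ⊕ (a ⊕ z ⊗ b)) ι-𝟙 (horner-zero K H q′ z) ⟩
          z ↑ q ⊕ (𝟙 ⊕ z ⊗ 𝟘) ≡⟨ solve 2 (λ p z → p :+ (con (+ 1) :+ z :* con (+ 0)) := con (+ 1) :+ p) refl (z ↑ q) z ⟩
          𝟙 ⊕ z ↑ q ∎
          where open ≡-Reasoning

      -- By homogeneity the case x ≠ 0 reduces to 1 + y/x.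
      frobenius : ∀ x y → (x ⊕ y) ↑ q ≡ x ↑ q ⊕ y ↑ q
      frobenius x y with x ≟ 𝟘
      ... | yes refl = trans (cong (_↑ q) (R.+-identityˡ y)) (sym (trans (cong (_⊕ y ↑ q) (R.zeroˡ _)) (R.+-identityˡ _)))
      ... | no x≢0 = begin
        (x ⊕ y) ↑ q ≡⟨ cong (_↑ q) (sym (trans (R.distribˡ x 𝟙 _) (cong₂ _⊕_ (R.*-identityʳ x) (a⊗[inv-a⊗b] y x≢0)))) ⟩
        (x ⊗ (𝟙 ⊕ inv x ⊗ y)) ↑ q ≡⟨ ↑-⊗ x _ q ⟩
        x ↑ q ⊗ (𝟙 ⊕ inv x ⊗ y) ↑ q ≡⟨ cong (x ↑ q ⊗_) (frob-𝟙 (inv x ⊗ y)) ⟩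
        x ↑ q ⊗ (𝟙 ⊕ (inv x ⊗ y) ↑ q) ≡⟨ trans (R.distribˡ _ _ _) (cong₂ _⊕_ (R.*-identityʳ _) (sym (↑-⊗ x _ q))) ⟩
        x ↑ q ⊕ (x ⊗ (inv x ⊗ y)) ↑ q ≡⟨ cong (λ z → x ↑ q ⊕ z ↑ q) (a⊗[inv-a⊗b] y x≢0) ⟩
        x ↑ q ⊕ y ↑ q ∎
        where open ≡-Reasoning

      frobenius^ : ∀ i x y → (x ⊕ y) ↑ (q ℕ.^ i) ≡ x ↑ (q ℕ.^ i) ⊕ y ↑ (q ℕ.^ i)
      frobenius^ zero    x y = trans (R.*-identityʳ _) (sym (cong₂ _⊕_ (R.*-identityʳ x) (R.*-identityʳ y)))
      frobenius^ (suc i) x y = begin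
        (x ⊕ y) ↑ (q ℕ.* q ℕ.^ i) ≡⟨ sym (↑-* (x ⊕ y) q (q ℕ.^ i)) ⟩
        ((x ⊕ y) ↑ q) ↑ (q ℕ.^ i) ≡⟨ cong (_↑ (q ℕ.^ i)) (frobenius x y) ⟩
        (x ↑ q ⊕ y ↑ q) ↑ (q ℕ.^ i) ≡⟨ frobenius^ i _ _ ⟩
        (x ↑ q) ↑ (q ℕ.^ i) ⊕ (y ↑ q) ↑ (q ℕ.^ i) ≡⟨ cong₂ _⊕_ (↑-* x q (q ℕ.^ i)) (↑-* y q (q ℕ.^ i)) ⟩
        x ↑ (q ℕ.* q ℕ.^ i) ⊕ y ↑ (q ℕ.* q ℕ.^ i) ∎
        where open ≡-Reasoning

      -- The partial trace z + z^q + ... + z^(q^(n-1)).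
      trPow : ℕ → Carrier → Carrier
      trPow zero    z = 𝟘
      trPow (suc n) z = trPow n z ⊕ z ↑ (q ℕ.^ n)

      trPow-⊕ : ∀ n x y → trPow n (x ⊕ y) ≡ trPow n x ⊕ trPow n y
      trPow-⊕ zero    x y = sym (R.+-identityˡ 𝟘)
      trPow-⊕ (suc n) x y = trans (cong₂ _⊕_ (trPow-⊕ n x y) (frobenius^ n x y))
        (solve 4 (λ a b c d → (a :+ b) :+ (c :+ d) := (a :+ c) :+ (b :+ d)) refl (trPow n x) (trPow n y) (x ↑ (q ℕ.^ n)) (y ↑ (q ℕ.^ n)))

      trPow-+ : ∀ m n z → trPow (m ℕ.+ n) z ≡ trPow n z ⊕ trPow m (z ↑ (q ℕ.^ n))
      trPow-+ zero    n z = sym (R.+-identityʳ _)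
      trPow-+ (suc m) n z = trans (cong₂ _⊕_ (trPow-+ m n z) (trans (cong (z ↑_) (trans (cong (q ℕ.^_) (ℕₚ.+-comm m n)) (ℕₚ.^-distribˡ-+-* q n m))) (sym (↑-* z (q ℕ.^ n) (q ℕ.^ m)))))
        (R.+-assoc _ _ _)

      trPow-↑ : ∀ n l z → trPow n z ↑ (q ℕ.^ l) ≡ trPow n (z ↑ (q ℕ.^ l))
      trPow-↑ zero    l z with q ℕ.^ l in eq
      ... | zero  = ⊥-elim (ℕ.≢-nonZero⁻¹ (q ℕ.^ l) ⦃ ℕₚ.m^n≢0 q l ⦄ eq)
      ... | suc _ = R.zeroˡ _
      trPow-↑ (suc n) l z = trans (frobenius^ l _ _) (cong₂ _⊕_ (trPow-↑ n l z)
        (trans (↑-* z (q ℕ.^ n) (q ℕ.^ l)) (trans (cong (z ↑_) (ℕₚ.*-comm (q ℕ.^ n) (q ℕ.^ l))) (sym (↑-* z (q ℕ.^ l) (q ℕ.^ n))))))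

  -- Kloosterman sums in a quadratic extension

  module KloostermanSum (K : EnumField) where
    open FieldKit K

    klSum : (Carrier → ℤ) → Carrier → ℤ
    klSum f c = Σᶠ (λ x → nz x * f (x ⊕ c ⊗ inv x))

    -- For an additive character f this would be the square of `klSum f c`.
    klSum₂ : (Carrier → ℤ) → Carrier → ℤ
    klSum₂ f c = Σᶠ (λ x → Σᶠ (λ y → nz x * nz y * f ((x ⊕ c ⊗ inv x) ⊕ (y ⊕ c ⊗ inv y))))

    nz-⊗ : ∀ x y → nz (x ⊗ y) ≡ nz x * nz y
    nz-⊗ x y = go (x ≟ 𝟘) (y ≟ 𝟘)
      where
      go : Dec (x ≡ 𝟘) → Dec (y ≡ 𝟘) → nz (x ⊗ y) ≡ nz x * nz y
      go (yes refl) _ = trans (cong nz (R.zeroˡ y)) (trans nz-𝟘 (sym (cong (_* nz y) nz-𝟘)))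
      go (no _) (yes refl) = trans (cong nz (R.zeroʳ x)) (trans nz-𝟘 (sym (trans (cong (nz x *_) nz-𝟘) (*-zeroʳ (nz x)))))
      go (no x≢0) (no y≢0) = trans (nz-≢ (⊗≢𝟘 x≢0 y≢0)) (sym (cong₂ _*_ (nz-≢ x≢0) (nz-≢ y≢0)))

    inv-⊗ : ∀ {x y} → ¬ x ≡ 𝟘 → ¬ y ≡ 𝟘 → inv (x ⊗ y) ≡ inv x ⊗ inv y
    inv-⊗ {x} {y} x≢0 y≢0 = inv-unique (trans (solve 4 (λ x y a b → x :* y :* (a :* b) := x :* a :* (y :* b)) refl x y (inv x) (inv y))
      (trans (cong₂ _⊗_ (inv-right x x≢0) (inv-right y y≢0)) (R.*-identityˡ 𝟙)))

  -- Over K and its quadratic extension, the pairs (x , y) and the elements z with given trace and norm together number 2.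
  module Doubling (K : EnumField) (𝟚≢𝟘 : ¬ FieldKit.𝟚 K ≡ FieldKit.𝟘 K)
                  (ν : EnumField.Carrier K) (nonsquare : ∀ x → ¬ EnumField._⊗_ K x x ≡ ν) where
    open QuadraticCharacter K 𝟚≢𝟘
    open KloostermanSum K
    open QuadraticExtension K ν nonsquare
    private
      module L = FieldKit extension
      KK = pairEnum enum enum

    module _ (f : Carrier → ℤ) (Σf≡0 : Σᶠ f ≡ 0ℤ) {c : Carrier} (c≢0 : ¬ c ≡ 𝟘) where
      private
        -- Here 2a is the trace x + y and m the norm x y: x + c/x + y + c/y = (1 + c/m)(x + y). In
        -- `φ` the norm is a² - u, with u = h² for pairs in K and u = ν b² for elements of the
        -- extension.
        G : Carrier → Carrier → ℤ
        G a m = f (𝟚 ⊗ (𝟙 ⊕ c ⊗ inv m) ⊗ a)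

        φ : Carrier → Carrier → ℤ
        φ a u = nz (a ⊗ a ⊖ᶠ u) * G a (a ⊗ a ⊖ᶠ u)

        to from : Carrier × Carrier → Carrier × Carrier
        to   (a , h) = a ⊕ h , a ⊖ᶠ h
        from (x , y) = inv 𝟚 ⊗ (x ⊕ y) , inv 𝟚 ⊗ (x ⊖ᶠ y)

        half : ∀ x → inv 𝟚 ⊗ (𝟚 ⊗ x) ≡ x
        half x = inv-a⊗[a⊗b] x 𝟚≢𝟘

        from-to : ∀ p → from (to p) ≡ p
        from-to (a , h) = cong₂ _,_
          (trans (cong (inv 𝟚 ⊗_) (solve 2 (λ a h → (a :+ h) :+ (a :- h) := con (+ 2) :* a) refl a h)) (half a))
          (trans (cong (inv 𝟚 ⊗_) (solve 2 (λ a h → (a :+ h) :- (a :- h) := con (+ 2) :* h) refl a h)) (half h))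

        to-from : ∀ p → to (from p) ≡ p
        to-from (x , y) = cong₂ _,_
          (trans (solve 3 (λ v x y → v :* (x :+ y) :+ v :* (x :- y) := v :* (con (+ 2) :* x)) refl (inv 𝟚) x y) (half x))
          (trans (solve 3 (λ v x y → v :* (x :+ y) :- v :* (x :- y) := v :* (con (+ 2) :* y)) refl (inv 𝟚) x y) (half y))

        sum₂ : klSum₂ f c ≡ Σᶠ (λ a → Σᶠ (λ h → φ a (h ⊗ h)))
        sum₂ = begin
          klSum₂ f c ≡⟨ sym (∑-pairs elems elems (λ { (x , y) → nz x * nz y * f ((x ⊕ c ⊗ inv x) ⊕ (y ⊕ c ⊗ inv y)) })) ⟩
          ∑ (pairs elems elems) (λ { (x , y) → nz x * nz y * f ((x ⊕ c ⊗ inv x) ⊕ (y ⊕ c ⊗ inv y)) })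
            ≡⟨ sym (∑-reindex KK KK to from from-to to-from _) ⟩
          ∑ (pairs elems elems) (λ { (a , h) → nz (a ⊕ h) * nz (a ⊖ᶠ h) * f ((a ⊕ h ⊕ c ⊗ inv (a ⊕ h)) ⊕ (a ⊖ᶠ h ⊕ c ⊗ inv (a ⊖ᶠ h))) })
            ≡⟨ ∑-pairs elems elems _ ⟩
          Σᶠ (λ a → Σᶠ (λ h → nz (a ⊕ h) * nz (a ⊖ᶠ h) * f ((a ⊕ h ⊕ c ⊗ inv (a ⊕ h)) ⊕ (a ⊖ᶠ h ⊕ c ⊗ inv (a ⊖ᶠ h)))))
            ≡⟨ ∑-cong elems (λ a → ∑-cong elems (λ h → term a h)) ⟩
          Σᶠ (λ a → Σᶠ (λ h → φ a (h ⊗ h))) ∎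
          where
          open ≡-Reasoning
          val : ∀ x y → ¬ x ≡ 𝟘 → ¬ y ≡ 𝟘 → (x ⊕ c ⊗ inv x) ⊕ (y ⊕ c ⊗ inv y) ≡ (𝟙 ⊕ c ⊗ inv (x ⊗ y)) ⊗ (x ⊕ y)
          val x y x≢0 y≢0 = sym (begin
            (𝟙 ⊕ c ⊗ inv (x ⊗ y)) ⊗ (x ⊕ y) ≡⟨ cong (λ z → (𝟙 ⊕ c ⊗ z) ⊗ (x ⊕ y)) (inv-⊗ x≢0 y≢0) ⟩
            (𝟙 ⊕ c ⊗ (inv x ⊗ inv y)) ⊗ (x ⊕ y)
              ≡⟨ solve 5 (λ c x y a b → (con (+ 1) :+ c :* (a :* b)) :* (x :+ y) := x :+ y :+ c :* b :* (x :* a) :+ c :* a :* (y :* b)) refl c x y (inv x) (inv y) ⟩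
            x ⊕ y ⊕ c ⊗ inv y ⊗ (x ⊗ inv x) ⊕ c ⊗ inv x ⊗ (y ⊗ inv y)
              ≡⟨ cong₂ (λ p q → x ⊕ y ⊕ c ⊗ inv y ⊗ p ⊕ c ⊗ inv x ⊗ q) (inv-right x x≢0) (inv-right y y≢0) ⟩
            x ⊕ y ⊕ c ⊗ inv y ⊗ 𝟙 ⊕ c ⊗ inv x ⊗ 𝟙
              ≡⟨ solve 5 (λ c x y a b → x :+ y :+ c :* b :* con (+ 1) :+ c :* a :* con (+ 1) := (x :+ c :* a) :+ (y :+ c :* b)) refl c x y (inv x) (inv y) ⟩
            (x ⊕ c ⊗ inv x) ⊕ (y ⊕ c ⊗ inv y) ∎)
          term : ∀ a h → nz (a ⊕ h) * nz (a ⊖ᶠ h) * f ((a ⊕ h ⊕ c ⊗ inv (a ⊕ h)) ⊕ (a ⊖ᶠ h ⊕ c ⊗ inv (a ⊖ᶠ h))) ≡ φ a (h ⊗ h)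
          term a h = trans (cong (_* f ((a ⊕ h ⊕ c ⊗ inv (a ⊕ h)) ⊕ (a ⊖ᶠ h ⊕ c ⊗ inv (a ⊖ᶠ h)))) (trans (sym (nz-⊗ (a ⊕ h) (a ⊖ᶠ h))) (cong nz prod)))
            (nz-guard (a ⊗ a ⊖ᶠ h ⊗ h) (λ m≢0 → cong f (trans
              (val (a ⊕ h) (a ⊖ᶠ h) (λ e → m≢0 (trans (sym prod) (trans (cong (_⊗ (a ⊖ᶠ h)) e) (R.zeroˡ _)))) (λ e → m≢0 (trans (sym prod) (trans (cong ((a ⊕ h) ⊗_) e) (R.zeroʳ _)))))
              (trans (cong (λ z → (𝟙 ⊕ c ⊗ inv z) ⊗ ((a ⊕ h) ⊕ (a ⊖ᶠ h))) prod)
                (solve 3 (λ k a h → k :* ((a :+ h) :+ (a :- h)) := con (+ 2) :* k :* a) refl (𝟙 ⊕ c ⊗ inv (a ⊗ a ⊖ᶠ h ⊗ h)) a h)))))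
            where
            prod : (a ⊕ h) ⊗ (a ⊖ᶠ h) ≡ a ⊗ a ⊖ᶠ h ⊗ h
            prod = solve 2 (λ a h → (a :+ h) :* (a :- h) := a :* a :- h :* h) refl a h

        sumˡ : KloostermanSum.klSum extension (λ z → f (𝟚 ⊗ proj₁ z)) (c , 𝟘) ≡ Σᶠ (λ a → Σᶠ (λ b → φ a (ν ⊗ (b ⊗ b))))
        sumˡ = trans (extension-sum _) (∑-cong elems (λ a → ∑-cong elems (λ b → cong₂ _*_ (nzL a b) (cong f (val a b)))))
          where
          nzL : ∀ a b → L.nz (a , b) ≡ nz (conj-norm (a , b))
          nzL a b = cong (λ z → 1ℤ - z) (χ-⇔ ((a , b) L.≟ (𝟘 , 𝟘)) (conj-norm (a , b) ≟ 𝟘)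
            (λ { refl → solve 1 (λ n → con (+ 0) :* con (+ 0) :- n :* (con (+ 0) :* con (+ 0)) := con (+ 0)) refl ν }) (conj-norm≡𝟘 a b))
          val : ∀ a b → 𝟚 ⊗ proj₁ ((a , b) ⊕ˡ ((c , 𝟘) ⊗ˡ invˡ (a , b))) ≡ 𝟚 ⊗ (𝟙 ⊕ c ⊗ inv (conj-norm (a , b))) ⊗ a
          val a b = solve 5 (λ n c a v w → con (+ 2) :* (a :+ (c :* (a :* v) :+ n :* (con (+ 0) :* w))) := con (+ 2) :* (con (+ 1) :+ c :* v) :* a)
            refl ν c a (inv (conj-norm (a , b))) (⊝ b ⊗ inv (conj-norm (a , b)))

        -- For a fixed norm m the sum over traces is a complete sum of f, hence 0, unless the factor
        -- 1 + c/m vanishes, that is m = -c.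
        inner : ∀ m → nz m * Σᶠ (λ a → G a m) ≡ χ (m ≟ ⊝ c) * (nz m * (size * f 𝟘))
        inner m with m ≟ ⊝ c
        ... | yes refl = sym (trans (*-identityˡ _) (nz-guard (⊝ c) (λ m≢0 → sym (trans (∑-cong elems (λ a → cong f (trans (cong (λ z → 𝟚 ⊗ z ⊗ a) (k≡0 m≢0)) (solve 1 (λ a → con (+ 2) :* con (+ 0) :* a := con (+ 0)) refl a)))) (∑-const (f 𝟘))))))
          where
          k≡0 : ¬ ⊝ c ≡ 𝟘 → 𝟙 ⊕ c ⊗ inv (⊝ c) ≡ 𝟘
          k≡0 m≢0 = trans (cong (_⊕ c ⊗ inv (⊝ c)) (sym (inv-right (⊝ c) m≢0))) (solve 2 (λ c v → :- c :* v :+ c :* v := con (+ 0)) refl c (inv (⊝ c)))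
        ... | no m≢-c = trans (nz-guard m (λ m≢0 → trans (Σᶠ-scale (⊗≢𝟘 𝟚≢𝟘 (k≢0 m≢0)) f) Σf≡0)) (*-zeroʳ (nz m))
          where
          k≢0 : ¬ m ≡ 𝟘 → ¬ 𝟙 ⊕ c ⊗ inv m ≡ 𝟘
          k≢0 m≢0 e = m≢-c (⊖≡𝟘 (trans (solve 2 (λ m c → m :- (:- c) := m :+ c) refl m c) (trans (sym (trans (R.distribˡ m 𝟙 _)
            (cong₂ _⊕_ (R.*-identityʳ m) (trans (solve 3 (λ m c v → m :* (c :* v) := c :* (m :* v)) refl m c (inv m)) (trans (cong (c ⊗_) (inv-right m m≢0)) (R.*-identityʳ c))))))
            (trans (cong (m ⊗_) e) (R.zeroʳ m)))))

      -- `Σᶠ-nonsquares` joins the split and nonsplit cases into twice a free sum over trace and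
      -- norm, of which `inner` leaves only m = -c.
      doubling : klSum₂ f c + KloostermanSum.klSum extension (λ z → f (𝟚 ⊗ proj₁ z)) (c , 𝟘) ≡ + 2 * (size * f 𝟘)
      doubling = begin
        klSum₂ f c + KloostermanSum.klSum extension (λ z → f (𝟚 ⊗ proj₁ z)) (c , 𝟘) ≡⟨ cong₂ _+_ sum₂ sumˡ ⟩
        Σᶠ (λ a → Σᶠ (λ h → φ a (h ⊗ h))) + Σᶠ (λ a → Σᶠ (λ b → φ a (ν ⊗ (b ⊗ b)))) ≡⟨ sym (∑-+ elems _ _) ⟩
        Σᶠ (λ a → Σᶠ (λ h → φ a (h ⊗ h)) + Σᶠ (λ b → φ a (ν ⊗ (b ⊗ b)))) ≡⟨ ∑-cong elems (λ a → trans (Σᶠ-nonsquares nonsquare (φ a)) (cong (+ 2 *_) (flip-sum a))) ⟩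
        Σᶠ (λ a → + 2 * Σᶠ (λ m → nz m * G a m)) ≡⟨ ∑-*ˡ elems (+ 2) _ ⟩
        + 2 * Σᶠ (λ a → Σᶠ (λ m → nz m * G a m)) ≡⟨ cong (+ 2 *_) (trans (∑-swap elems elems _) (∑-cong elems (λ m → trans (∑-*ˡ elems (nz m) _) (inner m)))) ⟩
        + 2 * Σᶠ (λ m → χ (m ≟ ⊝ c) * (nz m * (size * f 𝟘))) ≡⟨ cong (+ 2 *_) (trans (∑-δ (⊝ c) _) (trans (cong (_* (size * f 𝟘)) (nz-≢ (λ e → c≢0 (⊝≡𝟘 e)))) (*-identityˡ _))) ⟩
        + 2 * (size * f 𝟘) ∎
        where
        open ≡-Reasoning
        flip-sum : ∀ a → Σᶠ (φ a) ≡ Σᶠ (λ m → nz m * G a m)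
        flip-sum a = trans (∑-cong elems (λ u → cong (λ z → nz z * G a z) (R.+-comm (a ⊗ a) (⊝ u))))
          (trans (Σᶠ-neg (λ u → nz (u ⊕ a ⊗ a) * G a (u ⊕ a ⊗ a))) (Σᶠ-shift (a ⊗ a) (λ m → nz m * G a m)))

  ∑-cauchy : {A : Set} (xs : List A) (g u : A → ℤ) → 0ℤ < ∑[ x ∈ xs ] g x * g x →
             (∑[ x ∈ xs ] g x * u x) * (∑[ x ∈ xs ] g x * u x) ≤ (∑[ x ∈ xs ] g x * g x) * (∑[ x ∈ xs ] u x * u x)
  ∑-cauchy xs g u 0<n = *-cancelˡ-≤-pos _ _ n ⦃ positive 0<n ⦄ (0≤-⇒≤ (subst (0ℤ ≤_) eq (∑-≥0 xs (λ x → 0≤² (n * u x - X * g x)))))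
    where
    open ≡-Reasoning
    n = ∑[ x ∈ xs ] g x * g x
    X = ∑[ x ∈ xs ] g x * u x
    V = ∑[ x ∈ xs ] u x * u x
    lem₁ : ∀ n X a b → (n * b - X * a) * (n * b - X * a) ≡ n * n * (b * b) - + 2 * n * X * (a * b) + X * X * (a * a)
    lem₁ = solve-∀
    lem₂ : ∀ n X V → n * n * V - + 2 * n * X * X + X * X * n ≡ n * (n * V) - n * (X * X)
    lem₂ = solve-∀
    eq : ∑[ x ∈ xs ] (n * u x - X * g x) * (n * u x - X * g x) ≡ n * (n * V) - n * (X * X)
    eq = begin
      ∑[ x ∈ xs ] (n * u x - X * g x) * (n * u x - X * g x) ≡⟨ ∑-cong xs (λ x → lem₁ n X (g x) (u x)) ⟩
      ∑[ x ∈ xs ] (n * n * (u x * u x) - + 2 * n * X * (g x * u x) + X * X * (g x * g x))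
        ≡⟨ trans (∑-+ xs _ _) (cong₂ _+_ (trans (∑-- xs _ _) (cong₂ _-_ (∑-*ˡ xs (n * n) _) (∑-*ˡ xs (+ 2 * n * X) _))) (∑-*ˡ xs (X * X) _)) ⟩
      n * n * V - + 2 * n * X * X + X * X * n ≡⟨ lem₂ n X V ⟩
      n * (n * V) - n * (X * X) ∎

  module Pushforward (F K : EnumField) (tr : EnumField.Carrier K → EnumField.Carrier F)
                     (tr-⊕ : ∀ x y → tr (EnumField._⊕_ K x y) ≡ EnumField._⊕_ F (tr x) (tr y))
                     (g : EnumField.Carrier F → ℤ) where
    private
      module F = FieldKit F
      open FieldKit K
      open KloostermanSum K
      open Correlation F g

    tr-𝟘 : tr 𝟘 ≡ F.𝟘
    tr-𝟘 = trans (F.solve 1 (λ a → a F.:= (a F.:+ a) F.:- a) refl (tr 𝟘)) (trans (cong (F._⊖ᶠ tr 𝟘) (trans (sym (tr-⊕ 𝟘 𝟘)) (cong tr (R.+-identityˡ 𝟘)))) (F.R.-‿inverseʳ (tr 𝟘)))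

    tr-⊝ : ∀ x → tr (⊝ x) ≡ F.⊝ tr x
    tr-⊝ x = F.⊖≡𝟘 (trans (F.solve 2 (λ a b → a F.:- (F.:- b) F.:= a F.:+ b) refl (tr (⊝ x)) (tr x))
      (trans (sym (tr-⊕ (⊝ x) x)) (trans (cong tr (R.-‿inverseˡ x)) tr-𝟘)))

    -- The sum pairs g with the average U of its translates by tr(x + c/x), and Cauchy-Schwarz
    -- trades this for the square norm of U. Expanding that norm gives differences w y - w x; the
    -- oddness of w and the substitution x ↦ -x turn them into the sums of `klSum₂`.
    klSum-cauchy : 0ℤ < norm → ∀ c → klSum (λ x → corr (tr x)) c * klSum (λ x → corr (tr x)) c ≤ norm * klSum₂ (λ x → corr (tr x)) c
    klSum-cauchy 0<n c = subst₂ _≤_ (cong₂ _*_ X≡ X≡) (cong (norm *_) V≡) (∑-cauchy F.elems g U 0<n)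
      where
      open ≡-Reasoning
      w : Carrier → Carrier
      w x = x ⊕ c ⊗ inv x
      U : F.Carrier → ℤ
      U b = Σᶠ (λ x → nz x * g (b F.⊕ tr (w x)))
      X≡ : F.Σᶠ (λ b → g b * U b) ≡ klSum (λ x → corr (tr x)) c
      X≡ = begin
        F.Σᶠ (λ b → g b * U b) ≡⟨ ∑-cong F.elems (λ b → trans (sym (∑-*ˡ elems (g b) _)) (∑-cong elems (λ x → comm (g b) (nz x) (g (b F.⊕ tr (w x)))))) ⟩
        F.Σᶠ (λ b → Σᶠ (λ x → nz x * (g b * g (b F.⊕ tr (w x))))) ≡⟨ ∑-swap F.elems elems _ ⟩
        Σᶠ (λ x → F.Σᶠ (λ b → nz x * (g b * g (b F.⊕ tr (w x))))) ≡⟨ ∑-cong elems (λ x → ∑-*ˡ F.elems (nz x) _) ⟩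
        klSum (λ x → corr (tr x)) c ∎
        where
        comm : ∀ a b c → a * (b * c) ≡ b * (a * c)
        comm = solve-∀
      nz-⊝ : ∀ x → nz (⊝ x) ≡ nz x
      nz-⊝ x = cong (λ z → 1ℤ - z) (χ-⇔ (⊝ x ≟ 𝟘) (x ≟ 𝟘) ⊝≡𝟘 (λ e → trans (cong ⊝_ e) (solve 0 (:- con (+ 0) := con (+ 0)) refl)))
      w-⊝ : ∀ x → ¬ x ≡ 𝟘 → w (⊝ x) ≡ ⊝ w x
      w-⊝ x x≢0 = trans (cong (λ z → ⊝ x ⊕ c ⊗ z) (inv-unique (trans (solve 2 (λ x v → :- x :* :- v := x :* v) refl x (inv x)) (inv-right x x≢0))))
        (solve 3 (λ x c v → :- x :+ c :* :- v := :- (x :+ c :* v)) refl x c (inv x))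
      shifted : ∀ x y → F.Σᶠ (λ b → g (b F.⊕ tr (w x)) * g (b F.⊕ tr (w y))) ≡ corr (tr (w y) F.⊖ᶠ tr (w x))
      shifted x y = trans (sym (F.Σᶠ-shift (F.⊝ tr (w x)) _)) (∑-cong F.elems (λ b → cong₂ (λ p q → g p * g q)
        (F.solve 2 (λ b x → b F.:- x F.:+ x F.:= b) refl b (tr (w x))) (F.solve 3 (λ b x y → b F.:- x F.:+ y F.:= b F.:+ (y F.:- x)) refl b (tr (w x)) (tr (w y)))))
      V≡ : F.Σᶠ (λ b → U b * U b) ≡ klSum₂ (λ x → corr (tr x)) c
      V≡ = begin
        F.Σᶠ (λ b → U b * U b)
          ≡⟨ ∑-cong F.elems (λ b → trans (sym (∑-product elems elems _ _)) (∑-cong elems (λ x → ∑-cong elems (λ y → four (nz x) (g (b F.⊕ tr (w x))) (nz y) (g (b F.⊕ tr (w y))))))) ⟩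
        F.Σᶠ (λ b → Σᶠ (λ x → Σᶠ (λ y → nz x * nz y * (g (b F.⊕ tr (w x)) * g (b F.⊕ tr (w y))))))
          ≡⟨ trans (∑-swap F.elems elems _) (∑-cong elems (λ x → ∑-swap F.elems elems _)) ⟩
        Σᶠ (λ x → Σᶠ (λ y → F.Σᶠ (λ b → nz x * nz y * (g (b F.⊕ tr (w x)) * g (b F.⊕ tr (w y))))))
          ≡⟨ ∑-cong elems (λ x → ∑-cong elems (λ y → trans (∑-*ˡ F.elems (nz x * nz y) _) (cong (nz x * nz y *_) (shifted x y)))) ⟩
        Σᶠ (λ x → Σᶠ (λ y → nz x * nz y * corr (tr (w y) F.⊖ᶠ tr (w x)))) ≡⟨ sym (Σᶠ-neg _) ⟩
        Σᶠ (λ x → Σᶠ (λ y → nz (⊝ x) * nz y * corr (tr (w y) F.⊖ᶠ tr (w (⊝ x))))) ≡⟨ ∑-cong elems (λ x → ∑-cong elems (λ y → term x y)) ⟩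
        klSum₂ (λ x → corr (tr x)) c ∎
        where
        four : ∀ a b c d → a * b * (c * d) ≡ a * c * (b * d)
        four = solve-∀
        term : ∀ x y → nz (⊝ x) * nz y * corr (tr (w y) F.⊖ᶠ tr (w (⊝ x))) ≡ nz x * nz y * corr (tr (w x ⊕ w y))
        term x y = trans (cong (λ z → z * nz y * corr (tr (w y) F.⊖ᶠ tr (w (⊝ x)))) (nz-⊝ x))
          (trans (*-assoc (nz x) (nz y) _) (trans (nz-guard x (λ x≢0 → cong (λ z → nz y * corr z) (begin
            tr (w y) F.⊖ᶠ tr (w (⊝ x)) ≡⟨ cong (tr (w y) F.⊖ᶠ_) (trans (cong tr (w-⊝ x x≢0)) (tr-⊝ (w x))) ⟩
            tr (w y) F.⊖ᶠ F.⊝ tr (w x) ≡⟨ F.solve 2 (λ a b → a F.:- (F.:- b) F.:= b F.:+ a) refl (tr (w y)) (tr (w x)) ⟩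
            tr (w x) F.⊕ tr (w y) ≡⟨ sym (tr-⊕ (w x) (w y)) ⟩
            tr (w x ⊕ w y) ∎))) (sym (*-assoc (nz x) (nz y) _))))

  -- The tower of quadratic extensions

  Hom-injective : ∀ {F K} (H : Hom F K) {a b} → Hom.ι H a ≡ Hom.ι H b → a ≡ b
  Hom-injective {F} {K} H {a} {b} e = go (d F.≟ F.𝟘)
    where
    module F = FieldKit F
    module K = FieldKit K
    open Hom H
    d = a F.⊖ᶠ b
    ιd : ι d ≡ K.𝟘
    ιd = trans (ι-⊕ a (F.⊝ b)) (trans (cong (K._⊕ ι (F.⊝ b)) e) (trans (sym (ι-⊕ b (F.⊝ b))) (trans (cong ι (F.R.-‿inverseʳ b)) ι-𝟘)))
    go : Dec (d ≡ F.𝟘) → a ≡ b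
    go (yes z) = F.⊖≡𝟘 z
    go (no d≢0) = ⊥-elim (K.𝟘≢𝟙 (sym (trans (sym ι-𝟙) (trans (cong ι (sym (F.inv-right d d≢0)))
      (trans (ι-⊗ d (F.inv d)) (trans (cong (K._⊗ ι (F.inv d)) ιd) (K.R.zeroˡ _)))))))

  module Tower (F : EnumField) (q′′ : ℕ) (F𝟚≢𝟘 : ¬ FieldKit.𝟚 F ≡ FieldKit.𝟘 F)
               (fermat : ∀ x → Polynomials._↑_ F x (suc (suc (suc q′′))) ≡ x)
               (size≡ : EnumField.size F ≡ + suc (suc (suc q′′))) where
    private module F = FieldKit F

    q′ q : ℕ
    q′ = suc (suc q′′)
    q  = suc q′

    open Frobenius F q′ fermat size≡

    Qₖ : ℕ → ℕ
    Qₖ k = q ℕ.^ (2 ℕ.^ k)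

    Qₖ-suc : ∀ k → Qₖ (suc k) ≡ Qₖ k ℕ.* Qₖ k
    Qₖ-suc k = trans (ℕₚ.^-distribˡ-+-* q (2 ℕ.^ k) _) (cong (λ z → Qₖ k ℕ.* q ℕ.^ z) (ℕₚ.+-identityʳ (2 ℕ.^ k)))

    1<Qₖ : ∀ k → 1 ℕ.< Qₖ k
    1<Qₖ k = ℕₚ.<-≤-trans (ℕ.s≤s (ℕ.s≤s ℕ.z≤n)) (subst (ℕ._≤ Qₖ k) (ℕₚ.*-identityʳ q)
      (ℕₚ.^-monoʳ-≤ q (ℕₚ.m^n>0 2 k)))

    -- The trace to F appears twice: as an additive map `tr`, for pulling functions on F back to K,
    -- and through `tr-pow` as a polynomial, for Stepanov's method.
    record Stage (k : ℕ) : Set₁ where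
      field
        K      : EnumField
        𝟚≢𝟘    : ¬ FieldKit.𝟚 K ≡ FieldKit.𝟘 K
        H      : Hom F K
        tr     : EnumField.Carrier K → F.Carrier
        tr-⊕   : ∀ x y → tr (EnumField._⊕_ K x y) ≡ tr x F.⊕ tr y
        tr-sum : ∀ f → F.Σᶠ f ≡ 0ℤ → FieldKit.Σᶠ K (λ x → f (tr x)) ≡ 0ℤ
        sizeₖ  : EnumField.size K ≡ + Qₖ k
        fix    : ∀ x → Polynomials._↑_ K x (Qₖ k) ≡ x
        tr-pow : ∀ x → Hom.ι H (tr x) ≡ trPow K H (2 ℕ.^ k) x

    level₀ : Stage 0
    level₀ = record
      { K = F ; 𝟚≢𝟘 = F𝟚≢𝟘 ; H = idHom F ; tr = λ x → x ; tr-⊕ = λ _ _ → refl ; tr-sum = λ _ h → h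
      ; sizeₖ = trans size≡ (cong +_ (sym (ℕₚ.*-identityʳ q)))
      ; fix = λ x → trans (cong (Polynomials._↑_ F x) (ℕₚ.*-identityʳ q)) (fermat x)
      ; tr-pow = λ x → sym (trans (F.R.+-identityˡ _) (F.R.*-identityʳ x))
      }

    module Step {k : ℕ} (ℓ : Stage k) (ν : EnumField.Carrier (Stage.K ℓ))
                (nonsquare : ∀ x → ¬ EnumField._⊗_ (Stage.K ℓ) x x ≡ ν) where
      open Stage ℓ
      open FieldKit K
      open QuadraticExtension K ν nonsquare
      private
        module PK = Polynomials K
        module PL = Polynomials extension

        j : Carrier → L
        j x = x , 𝟘

        j-⊗ : ∀ x y → j (x ⊗ y) ≡ j x ⊗ˡ j y
        j-⊗ x y = cong₂ _,_ (solve 3 (λ n x y → x :* y := x :* y :+ n :* (con (+ 0) :* con (+ 0))) refl ν x y)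
          (solve 2 (λ x y → con (+ 0) := x :* con (+ 0) :+ con (+ 0) :* y) refl x y)

        j-⊕ : ∀ x y → j (x ⊕ y) ≡ j x ⊕ˡ j y
        j-⊕ x y = cong (x ⊕ y ,_) (sym (R.+-identityˡ 𝟘))

        j-↑ : ∀ x n → j x PL.↑ n ≡ j (x PK.↑ n)
        j-↑ x zero    = refl
        j-↑ x (suc n) = trans (cong (j x ⊗ˡ_) (j-↑ x n)) (sym (j-⊗ x _))

        H′ : Hom F extension
        H′ = record
          { ι = λ a → j (Hom.ι H a)
          ; ι-⊕ = λ a b → trans (cong j (Hom.ι-⊕ H a b)) (j-⊕ _ _)
          ; ι-⊗ = λ a b → trans (cong j (Hom.ι-⊗ H a b)) (j-⊗ _ _)
          ; ι-𝟘 = cong j (Hom.ι-𝟘 H)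
          ; ι-𝟙 = cong j (Hom.ι-𝟙 H) }

        j-trPow : ∀ n x → trPow extension H′ n (j x) ≡ j (trPow K H n x)
        j-trPow zero    x = refl
        j-trPow (suc n) x = trans (cong₂ _⊕ˡ_ (j-trPow n x) (j-↑ x (q ℕ.^ n))) (sym (j-⊕ _ _))

        𝟚≢𝟘′ : ¬ PL.𝟚 ≡ PL.𝟘
        𝟚≢𝟘′ e = 𝟚≢𝟘 (cong proj₁ e)

        Q : ℕ
        Q = Qₖ k

        conj : L → L
        conj (a , b) = a , ⊝ b

        s : L
        s = 𝟘 , 𝟙

        decompose : ∀ a b → (a , b) ≡ j a ⊕ˡ (j b ⊗ˡ s)
        decompose a b = cong₂ _,_ (solve 3 (λ n a b → a := a :+ (b :* con (+ 0) :+ n :* (con (+ 0) :* con (+ 1)))) refl ν a b)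
          (solve 1 (λ b → b := con (+ 0) :+ (b :* con (+ 1) :+ con (+ 0) :* con (+ 0))) refl b)

        -- The Q-th power is additive and fixes K, so it is determined by its value at s, the square
        -- root of ν.
        ↑Q : ∀ a b → (a , b) PL.↑ Q ≡ j a ⊕ˡ (j b ⊗ˡ (s PL.↑ Q))
        ↑Q a b = begin
          (a , b) PL.↑ Q ≡⟨ cong (PL._↑ Q) (decompose a b) ⟩
          (j a ⊕ˡ (j b ⊗ˡ s)) PL.↑ Q ≡⟨ frobenius^ extension H′ (2 ℕ.^ k) (j a) (j b ⊗ˡ s) ⟩
          (j a PL.↑ Q) ⊕ˡ ((j b ⊗ˡ s) PL.↑ Q) ≡⟨ cong₂ _⊕ˡ_ (fixj a) (trans (PL.↑-⊗ (j b) s Q) (cong (_⊗ˡ (s PL.↑ Q)) (fixj b))) ⟩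
          j a ⊕ˡ (j b ⊗ˡ (s PL.↑ Q)) ∎
          where
          open ≡-Reasoning
          fixj : ∀ x → j x PL.↑ Q ≡ j x
          fixj x = trans (j-↑ x Q) (cong j (fix x))

        s²↑ : (s PL.↑ Q) ⊗ˡ (s PL.↑ Q) ≡ s ⊗ˡ s
        s²↑ = trans (sym (PL.↑-⊗ s s Q)) (trans (cong (PL._↑ Q) s²) (trans (j-↑ ν Q) (trans (cong j (fix ν)) (sym s²))))
          where
          s² : s ⊗ˡ s ≡ j ν
          s² = cong₂ _,_ (solve 1 (λ n → con (+ 0) :* con (+ 0) :+ n :* (con (+ 1) :* con (+ 1)) := n) refl ν)
            (solve 0 (con (+ 0) :* con (+ 1) :+ con (+ 1) :* con (+ 0) := con (+ 0)) refl)

        sizeL : EnumField.size extension ≡ + (Q ℕ.* Q)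
        sizeL = trans (extension-sum _) (trans (∑-const size) (trans (cong₂ _*_ sizeₖ sizeₖ) (sym (pos-* Q Q))))

        -- Otherwise all Q² elements of the extension would be roots of X^Q - X.
        s↑Q≢s : ¬ s PL.↑ Q ≡ s
        s↑Q≢s e = ℕₚ.<⇒≱ (ℕₚ.m<m*n Q Q ⦃ ℕ.>-nonZero (ℕₚ.<-trans (ℕ.s≤s ℕ.z≤n) (1<Qₖ k)) ⦄ (1<Qₖ k))
          (subst (ℕ._≤ Q) (+-injective (trans (sym (∑-length PL.elems)) sizeL))
            (PL.roots≤degree (λ z → PL.𝟘≢𝟙 (sym z)) monic PL.elems (elems-unique PL.enum) (All.universal root PL.elems)))
          where
          monic : PL.Monic Q (λ z → (z PL.↑ Q) PL.⊖ᶠ z)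
          monic = PL.Monic-⊕< (PL.Monic-x↑ Q) (1<Qₖ k) (PL.Lead-≗
            (λ x → PL.solve 1 (λ x → PL.:- x PL.:= (PL.:- PL.con (+ 1)) PL.:* (x PL.:* PL.con (+ 1))) refl x) (PL.Lead-scale (PL.⊝ PL.𝟙) (PL.Monic-x↑ 1)))
          root : ∀ z → (z PL.↑ Q) PL.⊖ᶠ z ≡ PL.𝟘
          root (a , b) = trans (cong (PL._⊖ᶠ (a , b)) (trans (↑Q a b) (trans (cong (λ w → j a ⊕ˡ (j b ⊗ˡ w)) e) (sym (decompose a b))))) (PL.R.-‿inverseʳ (a , b))

        -- `s PL.↑ Q` has the same square as s, because ν lies in K and is fixed. It is thus s or
        -- its negative, and `s↑Q≢s` leaves the negative.
        ↑Q≡conj : ∀ z → z PL.↑ Q ≡ conj z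
        ↑Q≡conj (a , b) with QuadraticCharacter.²≡² extension 𝟚≢𝟘′ {s PL.↑ Q} {s} s²↑
        ... | inj₁ e = ⊥-elim (s↑Q≢s e)
        ... | inj₂ e = trans (↑Q a b) (trans (cong (λ w → j a ⊕ˡ (j b ⊗ˡ w)) e) (cong₂ _,_
            (solve 3 (λ n a b → a :+ (b :* (:- con (+ 0)) :+ n :* (con (+ 0) :* (:- con (+ 1)))) := a) refl ν a b)
            (solve 1 (λ b → con (+ 0) :+ (b :* (:- con (+ 1)) :+ con (+ 0) :* (:- con (+ 0))) := :- b) refl b)))

      next : Stage (suc k)
      next = record
        { K = extension ; 𝟚≢𝟘 = 𝟚≢𝟘′ ; H = H′
        ; tr = λ z → tr (𝟚 ⊗ proj₁ z)
        ; tr-⊕ = λ x y → trans (cong tr (R.distribˡ 𝟚 (proj₁ x) (proj₁ y))) (tr-⊕ _ _)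
        ; tr-sum = λ f h → trans (extension-sum _) (trans (∑-cong elems (λ a → ∑-const _)) (trans (∑-*ˡ elems size _)
            (trans (cong (size *_) (trans (Σᶠ-scale 𝟚≢𝟘 (λ x → f (tr x))) (tr-sum f h))) (*-zeroʳ size))))
        ; sizeₖ = trans sizeL (cong +_ (sym (Qₖ-suc k)))
        ; fix = λ z → trans (cong (z PL.↑_) (Qₖ-suc k)) (trans (sym (PL.↑-* z Q Q)) (trans (↑Q≡conj (z PL.↑ Q)) (trans (cong conj (↑Q≡conj z)) (conj² z))))
        -- The second half of the powers is the first half applied to z^Q, so the full trace of z is
        -- the partial trace of z + conj z, an element of K.
        ; tr-pow = λ z → sym (begin
            trPow extension H′ (2 ℕ.^ suc k) z ≡⟨ cong (λ w → trPow extension H′ (2 ℕ.^ k ℕ.+ w) z) (ℕₚ.+-identityʳ (2 ℕ.^ k)) ⟩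
            trPow extension H′ (n ℕ.+ n) z ≡⟨ trPow-+ extension H′ n n z ⟩
            trPow extension H′ n z ⊕ˡ trPow extension H′ n (z PL.↑ Q) ≡⟨ sym (trPow-⊕ extension H′ n z (z PL.↑ Q)) ⟩
            trPow extension H′ n (z ⊕ˡ (z PL.↑ Q)) ≡⟨ cong (λ w → trPow extension H′ n (z ⊕ˡ w)) (↑Q≡conj z) ⟩
            trPow extension H′ n (z ⊕ˡ conj z) ≡⟨ cong (trPow extension H′ n) (z+conj z) ⟩
            trPow extension H′ n (j (𝟚 ⊗ proj₁ z)) ≡⟨ j-trPow n (𝟚 ⊗ proj₁ z) ⟩
            j (trPow K H n (𝟚 ⊗ proj₁ z)) ≡⟨ cong j (sym (tr-pow (𝟚 ⊗ proj₁ z))) ⟩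
            j (Hom.ι H (tr (𝟚 ⊗ proj₁ z))) ∎)
        }
        where
        open ≡-Reasoning
        n = 2 ℕ.^ k
        conj² : ∀ z → conj (conj z) ≡ z
        conj² (a , b) = cong (a ,_) (solve 1 (λ b → :- (:- b) := b) refl b)
        z+conj : ∀ z → z ⊕ˡ conj z ≡ j (𝟚 ⊗ proj₁ z)
        z+conj (a , b) = cong₂ _,_ (solve 1 (λ a → a :+ a := con (+ 2) :* a) refl a) (R.-‿inverseʳ b)

    module _ {k : ℕ} (ℓ : Stage k) where
      open QuadraticCharacter (Stage.K ℓ) (Stage.𝟚≢𝟘 ℓ) using (∃-nonsquare)

      next : Stage (suc k)
      next = Step.next ℓ (proj₁ ∃-nonsquare) (proj₂ ∃-nonsquare)

    level : ∀ k → Stage k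
    level zero    = level₀
    level (suc k) = next (level k)

    module TraceCount {k : ℕ} (ℓ : Stage (suc k)) {c : EnumField.Carrier (Stage.K ℓ)} where
      open Stage ℓ
      open Polynomials K

      w : Carrier → Carrier
      w x = x ⊕ c ⊗ inv x

      -- x^(q^l) times the partial trace of x + c/x, as a polynomial.
      cleared : ℕ → Carrier → Carrier
      cleared zero    x = x ⊗ x ⊕ c
      cleared (suc l) x = (x ⊗ x ⊕ c) ↑ (q ℕ.^ suc l) ⊕ x ↑ (q ℕ.^ suc l ℕ.∸ q ℕ.^ l) ⊗ cleared l x

      private
        q^l<q^sl : ∀ l → q ℕ.^ l ℕ.< q ℕ.^ suc l
        q^l<q^sl l = ℕₚ.m<m+n (q ℕ.^ l) (ℕₚ.<-≤-trans (ℕₚ.m^n>0 q l) (ℕₚ.m≤m+n (q ℕ.^ l) _))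

        quadratic-monic : Monic 2 (λ x → x ⊗ x ⊕ c)
        quadratic-monic = Monic-⊕< (Lead-≗ (λ x → cong (x ⊗_) (sym (R.*-identityʳ x))) (Monic-x↑ 2)) (ℕ.s≤s ℕ.z≤n) (base (λ _ → refl))

      cleared-monic : ∀ l → Monic (q ℕ.^ l ℕ.+ q ℕ.^ l) (cleared l)
      cleared-monic zero    = quadratic-monic
      cleared-monic (suc l) = Monic-⊕< (Lead-deg (lem Q′) (Monic-↑ quadratic-monic Q′)) lt (Lead-⊗ (Monic-x↑ (Q′ ℕ.∸ q ℕ.^ l)) (cleared-monic l))
        where
        Q′ = q ℕ.^ suc l
        lem : ∀ a → a ℕ.* 2 ≡ a ℕ.+ a
        lem = ℕ-Solver.solve-∀
        lt : Q′ ℕ.∸ q ℕ.^ l ℕ.+ (q ℕ.^ l ℕ.+ q ℕ.^ l) ℕ.< Q′ ℕ.+ Q′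
        lt = subst (ℕ._< Q′ ℕ.+ Q′) (trans (cong (ℕ._+ q ℕ.^ l) (sym (ℕₚ.m∸n+n≡m (ℕₚ.<⇒≤ (q^l<q^sl l))))) (ℕₚ.+-assoc (Q′ ℕ.∸ q ℕ.^ l) _ _))
          (ℕₚ.+-monoʳ-< Q′ (q^l<q^sl l))

      cleared-spec : ∀ l {x} → ¬ x ≡ 𝟘 → cleared l x ≡ x ↑ (q ℕ.^ l) ⊗ trPow K H (suc l) (w x)
      xw : ∀ {x} → ¬ x ≡ 𝟘 → x ⊗ w x ≡ x ⊗ x ⊕ c
      xw {x} x≢0 = trans (solve 3 (λ x c v → x :* (x :+ c :* v) := x :* x :+ c :* (x :* v)) refl x c (inv x))
        (cong (x ⊗ x ⊕_) (trans (cong (c ⊗_) (inv-right x x≢0)) (R.*-identityʳ c)))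
      cleared-spec zero {x} x≢0 = trans (sym (xw x≢0)) (solve 2 (λ x w → x :* w := (x :* con (+ 1)) :* (con (+ 0) :+ w :* con (+ 1))) refl x (w x))
      cleared-spec (suc l) {x} x≢0 = begin
        (x ⊗ x ⊕ c) ↑ Q′ ⊕ x ↑ (Q′ ℕ.∸ q ℕ.^ l) ⊗ cleared l x
          ≡⟨ cong₂ (λ a b → a ↑ Q′ ⊕ x ↑ (Q′ ℕ.∸ q ℕ.^ l) ⊗ b) (sym (xw x≢0)) (cleared-spec l x≢0) ⟩
        (x ⊗ w x) ↑ Q′ ⊕ x ↑ (Q′ ℕ.∸ q ℕ.^ l) ⊗ (x ↑ (q ℕ.^ l) ⊗ t)
          ≡⟨ cong₂ _⊕_ (↑-⊗ x (w x) Q′) (trans (sym (R.*-assoc _ _ _)) (cong (_⊗ t) (trans (sym (↑-+ x (Q′ ℕ.∸ q ℕ.^ l) (q ℕ.^ l))) (cong (x ↑_) (ℕₚ.m∸n+n≡m (ℕₚ.<⇒≤ (q^l<q^sl l))))))) ⟩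
        x ↑ Q′ ⊗ w x ↑ Q′ ⊕ x ↑ Q′ ⊗ t ≡⟨ solve 3 (λ a b t → a :* b :+ a :* t := a :* (t :+ b)) refl (x ↑ Q′) (w x ↑ Q′) t ⟩
        x ↑ Q′ ⊗ (t ⊕ w x ↑ Q′) ∎
        where
        open ≡-Reasoning
        Q′ = q ℕ.^ suc l
        t = trPow K H (suc l) (w x)

      private
        solution? : ∀ b x → Dec ((¬ x ≡ 𝟘) × (tr (w x) ≡ b))
        solution? b x = ¬? (x ≟ 𝟘) ×-dec (tr (w x) F.≟ b)

      -- Let h be the partial trace of w x over half of the powers. The full trace is h + h^M, so
      -- trace b means h^M = b - h; multiplied by powers of x this is the relation in `Good`.
      traceCount-list : ∀ l m′ → 2 ℕ.^ k ≡ suc l → q ℕ.^ l ≡ suc m′ → ∀ b →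
        length (filter (solution? b) elems) ℕ.≤ suc m′ ℕ.* q ℕ.* suc m′ ℕ.+ 3 ℕ.* (suc m′ ℕ.* q)
      traceCount-list l m′ 2^k q^l b = good-count frob fixM (subst (λ z → Monic (z ℕ.+ z) (cleared l)) q^l (cleared-monic l)) (Hom.ι H b)
          xs (Unique-filter (solution? b) (elems-unique enum)) (All.map good (all-filter (solution? b) elems))
        where
        xs = filter (solution? b) elems
        open Stepanov K m′ q′′ using (M; m; Good; good-count)
        M≡ : M ≡ q ℕ.^ (2 ℕ.^ k)
        M≡ = trans (ℕₚ.*-comm (suc m′) q) (trans (cong (q ℕ.*_) (sym q^l)) (cong (q ℕ.^_) (sym 2^k)))
        frob : ∀ x y → (x ⊕ y) ↑ M ≡ x ↑ M ⊕ y ↑ M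
        frob = subst (λ z → ∀ x y → (x ⊕ y) ↑ z ≡ x ↑ z ⊕ y ↑ z) (sym M≡) (frobenius^ K H (2 ℕ.^ k))
        fixM : ∀ x → x ↑ (M ℕ.* M) ≡ x
        fixM x = trans (cong (x ↑_) (trans (cong₂ ℕ._*_ M≡ M≡) (sym (Qₖ-suc k)))) (fix x)
        good : ∀ {x} → (¬ x ≡ 𝟘) × (tr (w x) ≡ b) → Good frob fixM (subst (λ z → Monic (z ℕ.+ z) (cleared l)) q^l (cleared-monic l)) (Hom.ι H b) x
        good {x} (x≢0 , e) = x≢0 , (begin
          x ↑ m ⊗ cleared l x ↑ M ≡⟨ cong (λ z → x ↑ m ⊗ z ↑ M) P≡ ⟩
          x ↑ m ⊗ (x ↑ m ⊗ h) ↑ M ≡⟨ cong (x ↑ m ⊗_) (trans (↑-⊗ (x ↑ m) h M) (cong₂ _⊗_ (↑-* x m M) h↑M)) ⟩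
          x ↑ m ⊗ (x ↑ (m ℕ.* M) ⊗ (Hom.ι H b ⊖ᶠ h)) ≡⟨ solve 4 (λ a c b h → a :* (c :* (b :- h)) := c :* (b :* a :- a :* h)) refl (x ↑ m) (x ↑ (m ℕ.* M)) (Hom.ι H b) h ⟩
          x ↑ (m ℕ.* M) ⊗ (Hom.ι H b ⊗ x ↑ m ⊖ᶠ x ↑ m ⊗ h) ≡⟨ cong (λ z → x ↑ (m ℕ.* M) ⊗ (Hom.ι H b ⊗ x ↑ m ⊖ᶠ z)) (sym P≡) ⟩
          x ↑ (m ℕ.* M) ⊗ (Hom.ι H b ⊗ x ↑ m ⊖ᶠ cleared l x) ∎)
          where
          open ≡-Reasoning
          h = trPow K H (2 ℕ.^ k) (w x)
          P≡ : cleared l x ≡ x ↑ m ⊗ h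
          P≡ = trans (cleared-spec l x≢0) (cong₂ (λ y z → x ↑ y ⊗ trPow K H z (w x)) q^l (sym 2^k))
          h+h↑M : h ⊕ h ↑ M ≡ Hom.ι H b
          h+h↑M = begin
            h ⊕ h ↑ M ≡⟨ cong (h ⊕_) (trans (cong (h ↑_) M≡) (trPow-↑ K H (2 ℕ.^ k) (2 ℕ.^ k) (w x))) ⟩
            h ⊕ trPow K H (2 ℕ.^ k) (w x ↑ (q ℕ.^ (2 ℕ.^ k))) ≡⟨ sym (trPow-+ K H (2 ℕ.^ k) (2 ℕ.^ k) (w x)) ⟩
            trPow K H (2 ℕ.^ k ℕ.+ 2 ℕ.^ k) (w x) ≡⟨ cong (λ z → trPow K H (2 ℕ.^ k ℕ.+ z) (w x)) (sym (ℕₚ.+-identityʳ (2 ℕ.^ k))) ⟩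
            trPow K H (2 ℕ.^ suc k) (w x) ≡⟨ sym (tr-pow (w x)) ⟩
            Hom.ι H (tr (w x)) ≡⟨ cong (Hom.ι H) e ⟩
            Hom.ι H b ∎
          h↑M : h ↑ M ≡ Hom.ι H b ⊖ᶠ h
          h↑M = trans (solve 2 (λ h p → p := (h :+ p) :- h) refl h (h ↑ M)) (cong (_⊖ᶠ h) h+h↑M)

      traceCount : F.Carrier → ℤ
      traceCount b = Σᶠ (λ x → nz x * χ (tr (w x) F.≟ b))

      -- The bound M m + 3 M of `good-count` multiplied by q, where M = q m = `Qₖ k`. The term
      -- `Qₖ (suc k)` is the average over b up to 1, and the rest is of the order of the square root
      -- of the field size.
      traceCount≤ : ∀ b → + q * traceCount b ≤ + Qₖ (suc k) + + 3 * + q * + Qₖ k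
      traceCount≤ b with 2 ℕ.^ k in 2^k
      ... | zero = ⊥-elim (ℕ.≢-nonZero⁻¹ (2 ℕ.^ k) ⦃ ℕₚ.m^n≢0 2 k ⦄ 2^k)
      ... | suc l with q ℕ.^ l in q^l
      ...   | zero = ⊥-elim (ℕ.≢-nonZero⁻¹ (q ℕ.^ l) ⦃ ℕₚ.m^n≢0 q l ⦄ q^l)
      ...   | suc m′ = subst₂ _≤_ (trans (pos-* q (length (filter (solution? b) elems))) (cong (+ q *_) (sym count≡))) rhs (+≤+ (ℕₚ.*-monoʳ-≤ q (traceCount-list l m′ 2^k q^l b)))
        where
        count≡ : traceCount b ≡ + length (filter (solution? b) elems)
        count≡ = trans (∑-cong elems (λ x → sym (trans (χ-× (solution? b x) (¬? (x ≟ 𝟘)) (tr (w x) F.≟ b) (λ p → p) _,_) (cong (_* χ (tr (w x) F.≟ b)) (χ¬ (x ≟ 𝟘)))))) (∑-filter elems (solution? b))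
          where
          χ¬ : ∀ {P : Set} (p : Dec P) → χ (¬? p) ≡ 1ℤ - χ p
          χ¬ (yes _) = refl
          χ¬ (no _)  = refl
        lem : ∀ q m → q ℕ.* (m ℕ.* q ℕ.* m ℕ.+ 3 ℕ.* (m ℕ.* q)) ≡ (q ℕ.* m) ℕ.* (q ℕ.* m) ℕ.+ 3 ℕ.* q ℕ.* (q ℕ.* m)
        lem = ℕ-Solver.solve-∀
        Qk : Qₖ k ≡ q ℕ.* suc m′
        Qk = trans (cong (q ℕ.^_) 2^k) (cong (q ℕ.*_) q^l)
        rhs : + (q ℕ.* (suc m′ ℕ.* q ℕ.* suc m′ ℕ.+ 3 ℕ.* (suc m′ ℕ.* q))) ≡ + (q ℕ.^ (suc l ℕ.+ (suc l ℕ.+ 0))) + + 3 * + q * + (q ℕ.* suc m′)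
        rhs = trans (cong +_ (lem q (suc m′))) (cong₂ _+_ (cong +_ (sym (trans (cong (λ z → q ℕ.^ (z ℕ.+ (z ℕ.+ 0))) (sym 2^k)) (trans (Qₖ-suc k) (cong₂ ℕ._*_ Qk Qk)))))
          (trans (pos-* (3 ℕ.* q) (q ℕ.* suc m′)) (cong (_* + (q ℕ.* suc m′)) (pos-* 3 q))))

  -- The Kloosterman bound

  n<4^n : ∀ n → n ℕ.< 4 ℕ.^ n
  n<4^n zero    = ℕ.s≤s ℕ.z≤n
  n<4^n (suc n) = ℕₚ.<-≤-trans (ℕ.s≤s (n<4^n n)) (subst (ℕ._≤ 4 ℕ.^ suc n) (ℕₚ.+-comm (4 ℕ.^ n) 1)
    (ℕₚ.+-monoʳ-≤ (4 ℕ.^ n) (ℕₚ.≤-trans (ℕₚ.m^n>0 4 n) (ℕₚ.m≤m+n (4 ℕ.^ n) _))))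

  -- The iteration x ↦ x² - 2 escapes to infinity from every starting point greater than 2.
  module Growth (q : ℕ) (0<q : 0ℤ < + q) (Q : ℕ → ℕ) (Q₀ : Q 0 ≡ q) (Q-suc : ∀ k → Q (suc k) ≡ Q k ℕ.* Q k)
                (1≤Q : ∀ k → 1ℤ ≤ + Q k) (X : ℕ → ℤ) (norm : ℤ) (0<n : 0ℤ < norm)
                (next : ∀ k → X k * X k + norm * X (suc k) ≤ norm * (+ 2 * (+ Q k * norm)))
                (upper : ∀ k → - X (suc k) ≤ + 4 * + q * (+ Q k * norm))
                (large : + 4 * + q * (norm * norm) < X 0 * X 0) where
    private
      instance
        pos-n : Positive norm
        pos-n = positive 0<n

      0≤norm : 0ℤ ≤ norm
      0≤norm = <⇒≤ 0<n

      0≤Q : ∀ k → 0ℤ ≤ + Q k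
      0≤Q k = +≤+ ℕ.z≤n

    -- The excess of -X (suc j) over the conjectured bound 2 √(Q (suc j)) norm, since Q (suc j) is
    -- the square of Q j.
    D : ℕ → ℤ
    D j = - X (suc j) - + 2 * (+ Q j * norm)

    D-lower : ∀ j → X j * X j - + 4 * (+ Q j * (norm * norm)) ≤ norm * D j
    D-lower j = 0≤-⇒≤ (subst (0ℤ ≤_) (l (X j) norm (X (suc j)) (+ Q j)) (≤⇒0≤- (next j)))
      where
      l : ∀ x n y Q → n * (+ 2 * (Q * n)) - (x * x + n * y) ≡ n * (- y - + 2 * (Q * n)) - (x * x - + 4 * (Q * (n * n)))
      l = solve-∀

    D₀≥1 : 1ℤ ≤ D 0
    D₀≥1 = i<j⇒suc[i]≤j (*-cancelˡ-<-nonNeg norm ⦃ nonNegative 0≤norm ⦄ (<-≤-trans (subst (_< X 0 * X 0 - + 4 * (+ Q 0 * (norm * norm))) (sym (*-zeroʳ norm)) excess) (D-lower 0)))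
      where
      excess : 0ℤ < X 0 * X 0 - + 4 * (+ Q 0 * (norm * norm))
      excess = subst (_< X 0 * X 0 - + 4 * (+ Q 0 * (norm * norm))) (+-inverseʳ (+ 4 * (+ Q 0 * (norm * norm))))
        (+-monoˡ-< (- (+ 4 * (+ Q 0 * (norm * norm)))) (subst (_< X 0 * X 0) (trans (*-assoc (+ 4) (+ q) _) (cong (λ z → + 4 * (+ z * (norm * norm))) (sym Q₀))) large))

    -- As -X (suc j) = D + 2 Q norm, the difference X (suc j)² - 4 Q² norm² equals D² + 4 Q norm D.
    -- Dropping D² already makes D gain a factor 4 over Q at each level, which contradicts `upper`.
    D-step : ∀ j → 0ℤ ≤ D j → + 4 * + Q j * D j ≤ D (suc j)
    D-step j 0≤D = *-cancelˡ-≤-pos _ _ norm (≤-trans (0≤-⇒≤ (subst (0ℤ ≤_) (l (D j) (+ Q j) norm) (0≤² (D j)))) (subst (_≤ norm * D (suc j)) eq (D-lower (suc j))))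
      where
      l : ∀ D Q n → D * D ≡ D * D + + 4 * Q * (n * D) - n * (+ 4 * Q * D)
      l = solve-∀
      l′ : ∀ y Q n → y * y - + 4 * (Q * Q * (n * n)) ≡ (- y - + 2 * (Q * n)) * (- y - + 2 * (Q * n)) + + 4 * Q * (n * (- y - + 2 * (Q * n)))
      l′ = solve-∀
      eq : X (suc j) * X (suc j) - + 4 * (+ Q (suc j) * (norm * norm)) ≡ D j * D j + + 4 * + Q j * (norm * D j)
      eq = trans (cong (λ z → X (suc j) * X (suc j) - + 4 * (z * (norm * norm))) (trans (cong +_ (Q-suc j)) (pos-* (Q j) (Q j)))) (l′ (X (suc j)) (+ Q j) norm)

    D-growth : ∀ j → (0ℤ ≤ D j) × (+ (4 ℕ.^ j) * + Q j ≤ + q * D j)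
    D-growth zero = ≤-trans (+≤+ ℕ.z≤n) D₀≥1 , subst₂ _≤_ (trans (*-identityʳ (+ q)) (trans (cong +_ (sym Q₀)) (sym (*-identityˡ (+ Q 0))))) refl (*ˡ-≤ (<⇒≤ 0<q) D₀≥1)
    D-growth (suc j) with D-growth j
    ... | 0≤D , h = ≤-trans (0≤* (0≤* {+ 4} (+≤+ ℕ.z≤n) (0≤Q j)) 0≤D) (D-step j 0≤D)
        , ≤-trans (subst₂ _≤_ eq (l₂ (+ Q j) (+ q) (D j)) (*ˡ-≤ (0≤* {+ 4} (+≤+ ℕ.z≤n) (0≤Q j)) h)) (*ˡ-≤ (<⇒≤ 0<q) (D-step j 0≤D))
      where
      l₁ : ∀ Q a → + 4 * Q * (a * Q) ≡ + 4 * a * (Q * Q)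
      l₁ = solve-∀
      l₂ : ∀ Q q D → + 4 * Q * (q * D) ≡ q * (+ 4 * Q * D)
      l₂ = solve-∀
      eq : + 4 * + Q j * (+ (4 ℕ.^ j) * + Q j) ≡ + (4 ℕ.^ suc j) * + Q (suc j)
      eq = trans (l₁ (+ Q j) (+ (4 ℕ.^ j))) (cong₂ _*_ (sym (pos-* 4 (4 ℕ.^ j))) (sym (trans (cong +_ (Q-suc j)) (pos-* (Q j) (Q j)))))

    bounded : ∀ j → + (4 ℕ.^ j) ≤ + 4 * (+ q * + q) * norm
    bounded j = *-cancelʳ-≤-pos _ _ (+ Q j) ⦃ positive (<-≤-trans (+<+ (ℕ.s≤s ℕ.z≤n)) (1≤Q j)) ⦄ (≤-trans (proj₂ (D-growth j)) (≤-trans (*ˡ-≤ (<⇒≤ 0<q) D≤) (≤-reflexive (l (+ q) (+ Q j) norm))))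
      where
      l : ∀ q Q n → q * (+ 4 * q * (Q * n)) ≡ + 4 * (q * q) * n * Q
      l = solve-∀
      D≤ : D j ≤ + 4 * + q * (+ Q j * norm)
      D≤ = ≤-trans (subst (D j ≤_) (+-identityʳ _) (+-monoʳ-≤ (- X (suc j)) (neg-mono-≤ (0≤* {+ 2} (+≤+ ℕ.z≤n) (0≤* (0≤Q j) 0≤norm))))) (upper j)

    absurd : ⊥
    absurd = go (+ 4 * (+ q * + q) * norm) refl (0≤* {+ 4 * (+ q * + q)} (0≤* {+ 4} (+≤+ ℕ.z≤n) (0≤² (+ q))) 0≤norm)
      where
      go : ∀ B → B ≡ + 4 * (+ q * + q) * norm → 0ℤ ≤ B → ⊥
      -- The level j = b suffices, where b is the bound itself, since 4^b > b.
      go (+ b) e _ = ℕₚ.<⇒≱ (n<4^n b) (drop‿+≤+ (subst (+ (4 ℕ.^ b) ≤_) (sym e) (bounded b)))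


  module Weil (F : EnumField) (q′′ : ℕ) (F𝟚≢𝟘 : ¬ FieldKit.𝟚 F ≡ FieldKit.𝟘 F)
              (fermat : ∀ x → Polynomials._↑_ F x (suc (suc (suc q′′))) ≡ x)
              (size≡ : EnumField.size F ≡ + suc (suc (suc q′′)))
              (g : EnumField.Carrier F → ℤ) (Σg≡0 : FieldKit.Σᶠ F g ≡ 0ℤ)
              (c : EnumField.Carrier F) (c≢0 : ¬ c ≡ EnumField.𝟘 F) where
    open Tower F q′′ F𝟚≢𝟘 fermat size≡
    open Correlation F g
    private module F = FieldKit F

    Σcorr≡0 : F.Σᶠ corr ≡ 0ℤ
    Σcorr≡0 = trans corr-sum (cong₂ _*_ Σg≡0 Σg≡0)

    private
      0<q : 0ℤ < + q
      0<q = +<+ (ℕ.s≤s ℕ.z≤n)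

      0≤Q : ∀ k → 0ℤ ≤ + Qₖ k
      0≤Q k = +≤+ ℕ.z≤n

      1≤Q : ∀ k → 1ℤ ≤ + Qₖ k
      1≤Q k = +≤+ (ℕₚ.<⇒≤ (1<Qₖ k))

    klX : ∀ {k} → Stage k → ℤ
    klX ℓ = KloostermanSum.klSum (Stage.K ℓ) (λ x → corr (Stage.tr ℓ x)) (Hom.ι (Stage.H ℓ) c)

    -- `klSum-cauchy` followed by `doubling`: K′ = 2q - K² weakened to an inequality.
    klX-next : ∀ {k} (ℓ : Stage k) → 0ℤ < norm → klX ℓ * klX ℓ + norm * klX (next ℓ) ≤ norm * (+ 2 * (+ Qₖ k * norm))
    klX-next {k} ℓ 0<n = subst (klX ℓ * klX ℓ + norm * klX (next ℓ) ≤_) eq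
        (+-monoˡ-≤ (norm * klX (next ℓ)) (klSum-cauchy 0<n (Hom.ι H c)))
      where
      open Stage ℓ
      module K = FieldKit K
      open Pushforward F K tr tr-⊕ g
      open QuadraticCharacter K 𝟚≢𝟘 using (∃-nonsquare)
      f : K.Carrier → ℤ
      f x = corr (tr x)
      ιc≢0 : ¬ Hom.ι H c ≡ K.𝟘
      ιc≢0 e = c≢0 (Hom-injective H (trans e (sym (Hom.ι-𝟘 H))))
      eq : norm * KloostermanSum.klSum₂ K f (Hom.ι H c) + norm * klX (next ℓ) ≡ norm * (+ 2 * (+ Qₖ k * norm))
      eq = trans (sym (*-distribˡ-+ norm _ _)) (cong (norm *_) (trans
        (Doubling.doubling K 𝟚≢𝟘 (proj₁ ∃-nonsquare) (proj₂ ∃-nonsquare) f (tr-sum corr Σcorr≡0) ιc≢0)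
        (cong₂ (λ a b → + 2 * (a * b)) sizeₖ (trans (cong corr tr-𝟘) corr-𝟘))))

    -- Because `corr` sums to 0, -q N b may be replaced by the nonnegative deficit T - q N b. Then
    -- corr b ≤ `norm` applies termwise, and the total deficit is known from `ΣN`. An upper bound on
    -- each N b is thus all that Stepanov's method has to supply.
    -klX≤ : ∀ {k} (ℓ : Stage (suc k)) → - klX ℓ ≤ + 4 * + q * (+ Qₖ k * norm)
    -klX≤ {k} ℓ = *-cancelˡ-≤-pos _ _ (+ q) ⦃ positive 0<q ⦄ (≤-trans (≤-reflexive eq) (≤-trans (∑-mono F.elems term) (≤-trans (≤-reflexive total) final)))
      where
      open Stage ℓ
      module K = FieldKit K
      open TraceCount ℓ {Hom.ι H c}
      open ≡-Reasoning
      T = + Qₖ (suc k) + + 3 * + q * + Qₖ k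
      N = traceCount
      X≡ : klX ℓ ≡ F.Σᶠ (λ b → N b * corr b)
      X≡ = begin
        K.Σᶠ (λ x → K.nz x * corr (tr (w x))) ≡⟨ ∑-cong K.elems (λ x → trans (cong (K.nz x *_) (sym (F.∑-δ (tr (w x)) corr))) (sym (∑-*ˡ F.elems (K.nz x) _))) ⟩
        K.Σᶠ (λ x → F.Σᶠ (λ b → K.nz x * (χ (b F.≟ tr (w x)) * corr b))) ≡⟨ ∑-swap K.elems F.elems _ ⟩
        F.Σᶠ (λ b → K.Σᶠ (λ x → K.nz x * (χ (b F.≟ tr (w x)) * corr b)))
          ≡⟨ ∑-cong F.elems (λ b → trans (∑-cong K.elems (λ x → trans (sym (*-assoc (K.nz x) _ _)) (cong (λ z → K.nz x * z * corr b) (χ-⇔ (b F.≟ tr (w x)) (tr (w x) F.≟ b) sym sym)))) (∑-*ʳ K.elems _ (corr b))) ⟩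
        F.Σᶠ (λ b → N b * corr b) ∎
      ΣN : F.Σᶠ N ≡ + Qₖ (suc k) - 1ℤ
      ΣN = begin
        F.Σᶠ (λ b → K.Σᶠ (λ x → K.nz x * χ (tr (w x) F.≟ b))) ≡⟨ ∑-swap F.elems K.elems _ ⟩
        K.Σᶠ (λ x → F.Σᶠ (λ b → K.nz x * χ (tr (w x) F.≟ b))) ≡⟨ ∑-cong K.elems (λ x → trans (∑-*ˡ F.elems (K.nz x) _) (cong (K.nz x *_)
            (trans (∑-cong F.elems (λ b → χ-⇔ (tr (w x) F.≟ b) (b F.≟ tr (w x)) sym sym)) (F.once (tr (w x)))))) ⟩
        K.Σᶠ (λ x → K.nz x * 1ℤ) ≡⟨ K.Σᶠ-nz (λ _ → 1ℤ) ⟩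
        K.size - 1ℤ ≡⟨ cong (λ z → z - 1ℤ) sizeₖ ⟩
        + Qₖ (suc k) - 1ℤ ∎
      eq : + q * - klX ℓ ≡ F.Σᶠ (λ b → (T - + q * N b) * corr b)
      eq = sym (begin
        F.Σᶠ (λ b → (T - + q * N b) * corr b) ≡⟨ ∑-cong F.elems (λ b → l T (+ q) (N b) (corr b)) ⟩
        F.Σᶠ (λ b → T * corr b - + q * (N b * corr b)) ≡⟨ trans (∑-- F.elems _ _) (cong₂ _-_ (trans (∑-*ˡ F.elems T corr) (trans (cong (T *_) Σcorr≡0) (*-zeroʳ T))) (∑-*ˡ F.elems (+ q) _)) ⟩
        0ℤ - + q * F.Σᶠ (λ b → N b * corr b) ≡⟨ cong (λ z → 0ℤ - + q * z) (sym X≡) ⟩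
        0ℤ - + q * klX ℓ ≡⟨ l′ (+ q) (klX ℓ) ⟩
        + q * - klX ℓ ∎)
        where
        l : ∀ t q n c → (t - q * n) * c ≡ t * c - q * (n * c)
        l = solve-∀
        l′ : ∀ q x → 0ℤ - q * x ≡ q * - x
        l′ = solve-∀
      term : ∀ b → (T - + q * N b) * corr b ≤ (T - + q * N b) * norm
      term b = *ˡ-≤ (≤⇒0≤- (traceCount≤ b)) (corr≤norm b)
      total : F.Σᶠ (λ b → (T - + q * N b) * norm) ≡ + q * ((+ 3 * + q * + Qₖ k + 1ℤ) * norm)
      total = begin
        F.Σᶠ (λ b → (T - + q * N b) * norm) ≡⟨ ∑-*ʳ F.elems _ norm ⟩
        F.Σᶠ (λ b → T - + q * N b) * norm ≡⟨ cong (_* norm) (trans (∑-- F.elems _ _) (cong₂ _-_ (trans (F.∑-const T) (cong (_* T) size≡)) (trans (∑-*ˡ F.elems (+ q) N) (cong (+ q *_) ΣN)))) ⟩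
        (+ q * T - + q * (+ Qₖ (suc k) - 1ℤ)) * norm ≡⟨ l (+ q) (+ Qₖ (suc k)) (+ 3 * + q * + Qₖ k) norm ⟩
        + q * ((+ 3 * + q * + Qₖ k + 1ℤ) * norm) ∎
        where
        l : ∀ q a b n → (q * (a + b) - q * (a - 1ℤ)) * n ≡ q * ((b + 1ℤ) * n)
        l = solve-∀
      final : + q * ((+ 3 * + q * + Qₖ k + 1ℤ) * norm) ≤ + q * (+ 4 * + q * (+ Qₖ k * norm))
      final = *ˡ-≤ (<⇒≤ 0<q) (subst ((+ 3 * + q * + Qₖ k + 1ℤ) * norm ≤_) (l (+ q) (+ Qₖ k) norm)
          (*ʳ-≤ 0≤norm (+-monoʳ-≤ (+ 3 * + q * + Qₖ k) (subst (_≤ + q * + Qₖ k) refl (*-≤-* {1ℤ} {+ q} {1ℤ} {+ Qₖ k} (+≤+ ℕ.z≤n) (0≤Q k) (+≤+ (ℕ.s≤s ℕ.z≤n)) (1≤Q k))))))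
        where
        l : ∀ q a n → (+ 3 * q * a + q * a) * n ≡ + 4 * q * (a * n)
        l = solve-∀

    -- The case norm = 0 is separate because the recursion divides by `norm`; there every
    -- correlation is 0. Otherwise a violation is the starting value that `Growth` refutes.
    weil : kloosterman c * kloosterman c ≤ + 4 * + q * (norm * norm)
    weil with ℤₚ.<-cmp 0ℤ norm
    ... | tri> _ _ n<0 = ⊥-elim (<-irrefl refl (≤-<-trans 0≤norm n<0))
    ... | tri≈ _ 0≡n _ = ≤-trans (≤-reflexive (cong₂ _*_ zeroX zeroX)) (0≤* {+ 4 * + q} (+≤+ ℕ.z≤n) (0≤² norm))
      where
      zeroC : ∀ u → corr u ≡ 0ℤ
      zeroC u = ≤-antisym (subst (corr u ≤_) (sym 0≡n) (corr≤norm u)) (subst (λ z → - z ≤ corr u) (sym 0≡n) (-norm≤corr u))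
      zeroX : kloosterman c ≡ 0ℤ
      zeroX = trans (∑-cong F.elems (λ x → trans (cong (F.nz x *_) (zeroC _)) (*-zeroʳ (F.nz x)))) (∑-0 F.elems)
    ... | tri< 0<n _ _ with kloosterman c * kloosterman c ℤₚ.≤? + 4 * + q * (norm * norm)
    ...   | yes h = h
    ...   | no ¬h = ⊥-elim (Growth.absurd q 0<q Qₖ (ℕₚ.*-identityʳ q) Qₖ-suc 1≤Q (λ k → klX (level k)) norm 0<n
            (λ k → klX-next (level k) 0<n) (λ k → -klX≤ (level (suc k))) (≰⇒> ¬h))

  -- Numerical estimates

  0≤^ : ∀ {a} → 0ℤ ≤ a → ∀ n → 0ℤ ≤ a ^ n
  0≤^ h zero    = +≤+ ℕ.z≤n
  0≤^ h (suc n) = 0≤* h (0≤^ h n)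

  ^-mono : ∀ {a b} → 0ℤ ≤ a → a ≤ b → ∀ n → a ^ n ≤ b ^ n
  ^-mono 0≤a h zero    = ≤-refl
  ^-mono 0≤a h (suc n) = *-≤-* 0≤a (0≤^ (≤-trans 0≤a h) n) h (^-mono 0≤a h n)

  pos-^ : ∀ m n → + (m ℕ.^ n) ≡ (+ m) ^ n
  pos-^ m zero    = refl
  pos-^ m (suc n) = trans (pos-* m (m ℕ.^ n)) (cong (+ m *_) (pos-^ m n))

  ^-*-distrib : ∀ a b n → (a * b) ^ n ≡ a ^ n * b ^ n
  ^-*-distrib a b zero    = refl
  ^-*-distrib a b (suc n) = trans (cong (a * b *_) (^-*-distrib a b n)) (lem a b (a ^ n) (b ^ n))
    where
    lem : ∀ a b c d → a * b * (c * d) ≡ a * c * (b * d)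
    lem = solve-∀

  -- Equality holds at n = 0, and each further step multiplies the left side by at most 9/4 < 3.
  square≤exponential : ∀ {q} → + 3 ≤ q → ∀ n → + (2 ℕ.+ n) * + (2 ℕ.+ n) ≤ + 4 * q ^ n
  square≤exponential 3≤q zero    = ≤-refl
  square≤exponential {q} 3≤q (suc n) = ≤-trans step (subst (+ 3 * (+ 4 * q ^ n) ≤_) (lem q (q ^ n)) (*ʳ-≤ {+ 4 * q ^ n} (0≤* {+ 4} (+≤+ ℕ.z≤n) (0≤^ (≤-trans (+≤+ ℕ.z≤n) 3≤q) n)) 3≤q))
    where
    lem : ∀ q a → q * (+ 4 * a) ≡ + 4 * (q * a)
    lem = solve-∀
    m = + n
    gap : ∀ m → + 3 * ((+ 2 + m) * (+ 2 + m)) - (+ 3 + m) * (+ 3 + m) ≡ + 2 * (m * m) + + 6 * m + + 3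
    gap = solve-∀
    step : + (3 ℕ.+ n) * + (3 ℕ.+ n) ≤ + 3 * (+ 4 * q ^ n)
    step = ≤-trans (0≤-⇒≤ (subst (0ℤ ≤_) (sym (gap m)) (0≤+ (0≤+ (0≤* {+ 2} (+≤+ ℕ.z≤n) (0≤² m)) (0≤* {+ 6} {m} (+≤+ ℕ.z≤n) (+≤+ ℕ.z≤n))) (+≤+ ℕ.z≤n))))
      (*ˡ-≤ {+ 3} (+≤+ ℕ.z≤n) (square≤exponential 3≤q n))

  ≤-by-difference : ∀ {a b} c → 0ℤ ≤ c → b - a ≡ c → a ≤ b
  ≤-by-difference c 0≤c e = 0≤-⇒≤ (subst (0ℤ ≤_) (sym e) 0≤c)

  0<-from-square : ∀ {c e} → 0ℤ ≤ e → 0ℤ < c * (e * e) → 0ℤ < e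
  0<-from-square {c} {e} 0≤e h with ℤₚ.<-cmp 0ℤ e
  ... | tri< 0<e _ _  = 0<e
  ... | tri≈ _ refl _ = ⊥-elim (<-irrefl refl (subst (0ℤ <_) (*-zeroʳ c) h))
  ... | tri> _ _ e<0  = ⊥-elim (<-irrefl refl (≤-<-trans 0≤e e<0))

  -- With e ≤ q r, the inequality k q² r < c e² forces c r > k, which is at least c m.
  power-lower : ∀ {q r e} → 0ℤ ≤ q → 0ℤ ≤ r → 0ℤ ≤ e → e ≤ q * r →
                ∀ k c m → 0ℤ ≤ c → 0ℤ ≤ k - c * m → k * (q * (q * r)) < c * (e * e) → m < r
  power-lower {q} {r} {e} 0≤q 0≤r 0≤e e≤qr k c m 0≤c h thr = go (m ℤₚ.<? r)
    where
    l₁ : ∀ q a k c → k * (q * a) - c * (a * a) ≡ a * (k * q - c * a)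
    l₁ = solve-∀
    l₂ : ∀ q r k c m → k * q - c * (q * r) ≡ q * (c * (m - r) + (k - c * m))
    l₂ = solve-∀
    go : Dec (m < r) → m < r
    go (yes m<r) = m<r
    go (no m≮r) = ⊥-elim (<-irrefl refl (<-≤-trans thr (≤-trans (*ˡ-≤ 0≤c (*-≤-* {e} {q * r} {e} 0≤e (0≤* 0≤q 0≤r) e≤qr e≤qr))
        (≤-by-difference (q * r * (q * (c * (m - r) + (k - c * m))))
          (0≤* (0≤* 0≤q 0≤r) (0≤* 0≤q (0≤+ (0≤* 0≤c (≤⇒0≤- (≮⇒≥ m≮r))) h)))
          (trans (l₁ q (q * r) k c) (cong (q * r *_) (l₂ q r k c m)))))))

  -- Numerals are kept as explicit products and the ring identities have variable coefficients: otherwise the type checker unfolds large multiples.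
  module Numerics (q r e ν S : ℤ) (n : ℕ) (r≡q^d-1 : r ≡ q ^ (2 ℕ.+ n)) (3≤q : + 3 ≤ q) (0≤e : 0ℤ ≤ e) (0≤ν : 0ℤ ≤ ν)
    (count : (q * ν - e * e) * (q * ν - e * e) ≤ + 4 * (q * (q * r)) * (e * e))
    (threshold : + 20 * + 20 * + 4 * (q * (q * r)) < + 7 * + 7 * (e * e))
    (e≤qr : e ≤ q * r)
    (energy : ν * ν - e * ν ≤ e * S) where

    private
      0≤c : ∀ {m} → 0ℤ ≤ + m
      0≤c = +≤+ ℕ.z≤n

      0≤q : 0ℤ ≤ q
      0≤q = ≤-trans 0≤c 3≤q

      1≤q : 1ℤ ≤ q
      1≤q = ≤-trans (+≤+ (ℕ.s≤s ℕ.z≤n)) 3≤q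

      0<q : 0ℤ < q
      0<q = <-≤-trans (+<+ (ℕ.s≤s ℕ.z≤n)) 1≤q

      0<* : ∀ {a b} → 0ℤ < a → 0ℤ < b → 0ℤ < a * b
      0<* {a} {b} h h′ = subst (_< a * b) (*-zeroʳ a) (*-monoˡ-<-pos a ⦃ positive h ⦄ h′)

      *-cancelˡ-≤′ : ∀ {a b} c → 0ℤ < c → c * a ≤ c * b → a ≤ b
      *-cancelˡ-≤′ c 0<c = *-cancelˡ-≤-pos _ _ c ⦃ positive 0<c ⦄

      0<c : ∀ {m} → 0ℤ < + suc m
      0<c = +<+ (ℕ.s≤s ℕ.z≤n)

      d-1 : ℤ
      d-1 = + (2 ℕ.+ n)

      0≤r : 0ℤ ≤ r
      0≤r = subst (0ℤ ≤_) (sym r≡q^d-1) (0≤^ 0≤q (2 ℕ.+ n))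

      0<e : 0ℤ < e
      0<e = 0<-from-square {+ 7 * + 7} 0≤e (≤-<-trans (0≤* {+ 20 * + 20 * + 4} {q * (q * r)} 0≤c (0≤* 0≤q (0≤* 0≤q 0≤r))) threshold)

      -- `count` and the threshold give k (e² - q ν) ≤ c e². With k = 20 and c = 7 the distance
      -- count keeps 13/20 of its expected size.
      distance-lower : ∀ k c → 0ℤ ≤ c → (q * ν - e * e) * (q * ν - e * e) ≤ + 4 * (q * (q * r)) * (e * e) → k * k * + 4 * (q * (q * r)) < c * c * (e * e) → 0ℤ ≤ k →
                       (k - c) * (e * e) ≤ k * (q * ν)
      distance-lower k c 0≤c′ h thr 0≤k = ≤-by-difference (c * (e * e) - k * (e * e - q * ν))
          (≤⇒0≤- (²≤²⇒≤ {k * (e * e - q * ν)} {c * (e * e)} (0≤* 0≤c′ (0≤² e)) sq)) (l (q * ν) (e * e) k c)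
        where
        l : ∀ a b k c → k * a - (k - c) * b ≡ c * b - k * (b - a)
        l = solve-∀
        l₁ : ∀ a b k → k * k * ((a - b) * (a - b)) ≡ k * (b - a) * (k * (b - a))
        l₁ = solve-∀
        l₂ : ∀ Q b k f → k * k * (f * Q * b) ≡ k * k * f * Q * b
        l₂ = solve-∀
        l₃ : ∀ b c → c * c * b * b ≡ c * b * (c * b)
        l₃ = solve-∀
        sq : k * (e * e - q * ν) * (k * (e * e - q * ν)) ≤ c * (e * e) * (c * (e * e))
        sq = subst₂ _≤_ (l₁ (q * ν) (e * e) k) (l₃ (e * e) c) (≤-trans (*ˡ-≤ (0≤² k) h)
          (≤-trans (≤-reflexive (l₂ (q * (q * r)) (e * e) k (+ 4))) (*ʳ-≤ (0≤² e) (<⇒≤ thr))))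

      20qν≥13e² : + 13 * (e * e) ≤ + 20 * (q * ν)
      20qν≥13e² = distance-lower (+ 20) (+ 7) 0≤c count threshold 0≤c

      -- 1600/49 lies between 32 and 33.
      32<r : + 32 < r
      32<r = power-lower {q} {r} {e} 0≤q 0≤r 0≤e e≤qr (+ 20 * + 20 * + 4) (+ 7 * + 7) (+ 32) 0≤c 0≤c threshold

      linear : ∀ k j a c m → 0ℤ ≤ c → 0ℤ ≤ k * k * m - j * (a * a) → 0ℤ ≤ j → m ≤ r → k * k * j * (q * (q * r)) < c * c * (e * e) → j * (a * q) ≤ c * e
      linear k j a c m 0≤c′ h 0≤j m≤r thr = ²≤²⇒≤ (0≤* 0≤c′ 0≤e) (≤-trans
        (≤-by-difference (j * (q * q * (k * k * (r - m) + (k * k * m - j * (a * a)))))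
          (0≤* 0≤j (0≤* (0≤² q) (0≤+ (0≤* (0≤² k) (≤⇒0≤- m≤r)) h))) (l q a r k j m))
        (≤-trans (<⇒≤ thr) (≤-reflexive (l′ c e))))
        where
        l : ∀ q a r k j m → k * k * j * (q * (q * r)) - j * (a * q) * (j * (a * q)) ≡ j * (q * q * (k * k * (r - m) + (k * k * m - j * (a * a))))
        l = solve-∀
        l′ : ∀ c e → c * c * (e * e) ≡ c * e * (c * e)
        l′ = solve-∀

      rescale : ∀ a b c f → 0ℤ < a → 0ℤ ≤ b → 0ℤ ≤ b * f - a * c → f * q ≤ a * e → c * q ≤ b * e
      rescale a b c f 0<a 0≤b h fq≤ae = *-cancelˡ-≤′ a 0<a (≤-by-difference (b * (a * e - f * q) + (b * f - a * c) * q)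
          (0≤+ (0≤* 0≤b (≤⇒0≤- fq≤ae)) (0≤* h 0≤q)) (l a b c f q e))
        where
        l : ∀ a b c f q e → a * (b * e) - a * (c * q) ≡ b * (a * e - f * q) + (b * f - a * c) * q
        l = solve-∀

      -- From r ≥ 33 follows 49 e² > 1600 · 33 q². As 4 · 57² ≤ 400 · 33, with 57 the largest such
      -- integer, this gives 228 q ≤ 7 e, and 228/7 exceeds 420/13.
      13e≥420q : + 20 * (+ 20 + 1ℤ) * q ≤ + 13 * e
      13e≥420q = rescale (+ 7) (+ 13) (+ 20 * (+ 20 + 1ℤ)) (+ 4 * + 57) 0<c 0≤c 0≤c
        (≤-trans (≤-reflexive (*-assoc (+ 4) (+ 57) q)) (linear (+ 20) (+ 4) (+ 57) (+ 7) (+ 33) 0≤c 0≤c 0≤c (i<j⇒suc[i]≤j 32<r) threshold))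

      multiple≤ν : ∀ a b c → 0ℤ < b → b * c * q ≤ a * e → a * (e * e) ≤ b * (q * ν) → c * e ≤ ν
      multiple≤ν a b c 0<b h h′ = *-cancelˡ-≤′ (b * q) (0<* 0<b 0<q) (≤-trans (≤-reflexive (l b c q e)) (≤-trans (*ʳ-≤ 0≤e h)
        (≤-trans (≤-reflexive (*-assoc a e e)) (≤-trans h′ (≤-reflexive (sym (*-assoc b q ν)))))))
        where
        l : ∀ b c q e → b * q * (c * e) ≡ b * c * q * e
        l = solve-∀

      -- Makes the term e ν in `energy` at most ν²/21, so that e S ≥ (20/21) ν².
      21e≤ν : (+ 20 + 1ℤ) * e ≤ ν
      21e≤ν = multiple≤ν (+ 13) (+ 20) (+ 20 + 1ℤ) 0<c 13e≥420q 20qν≥13e²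

      -- The square of d - 1 is at most 4 q^(d-3), and q⁴ · q^(d-3) = q^(d+1) is the power in the
      -- threshold.
      dimension : ∀ k c → 0ℤ ≤ c → k * k * + 4 * (q * (q * r)) < c * c * (e * e) → k * (q * q) * d-1 ≤ c * e
      dimension k c 0≤c′ thr = ²≤²⇒≤ (0≤* 0≤c′ 0≤e) (≤-trans (≤-reflexive (l q k d-1)) (≤-trans
        (*ˡ-≤ {k * k * (q * q * (q * q))} (0≤* (0≤² k) (0≤² (q * q))) (square≤exponential 3≤q n))
        (≤-trans (≤-reflexive (trans (l′ q (q ^ n) k (+ 4)) (cong (λ z → k * k * + 4 * (q * (q * z))) (sym r≡q^d-1)))) (≤-trans (<⇒≤ thr) (≤-reflexive (l″ e c))))))
        where
        l : ∀ q k m → k * (q * q) * m * (k * (q * q) * m) ≡ k * k * (q * q * (q * q)) * (m * m)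
        l = solve-∀
        l′ : ∀ q p k f → k * k * (q * q * (q * q)) * (f * p) ≡ k * k * f * (q * (q * (q * (q * p))))
        l′ = solve-∀
        l″ : ∀ e c → c * c * (e * e) ≡ c * e * (c * e)
        l″ = solve-∀

      7e≥20q²d : + 20 * (q * q) * d-1 ≤ + 7 * e
      7e≥20q²d = dimension (+ 20) (+ 7) 0≤c threshold

      cubic′ : ∀ a b → 0ℤ < b → 0ℤ ≤ a → 0ℤ ≤ b + 1ℤ → a * (e * e) ≤ b * (q * ν) → (b + 1ℤ) * e ≤ ν →
               a * a * (e * e * e) ≤ b * (b + 1ℤ) * (q * q) * S
      cubic′ a b 0<b 0≤a 0≤b+1 h h′ = *-cancelˡ-≤′ (b * e) (0<* 0<b 0<e) (≤-trans (≤-reflexive (l₁ a b e)) (≤-trans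
        (*ˡ-≤ 0≤b (*-≤-* {a * (e * e)} (0≤* 0≤a (0≤² e)) (0≤* 0≤b (0≤* 0≤q 0≤ν)) h h))
        (≤-trans (≤-by-difference (b * b * (q * q) * (ν * (ν - (b + 1ℤ) * e)))
          (0≤* (0≤* (0≤² b) (0≤² q)) (0≤* 0≤ν (≤⇒0≤- h′))) (l₂ q ν e b))
        (≤-trans (*ˡ-≤ {b * b * (b + 1ℤ) * (q * q)} (0≤* (0≤* (0≤² b) 0≤b+1) (0≤² q)) energy) (≤-reflexive (l₃ q e S b))))))
        where
        0≤b = <⇒≤ 0<b
        l₁ : ∀ a b e → b * e * (a * a * (e * e * e)) ≡ b * (a * (e * e) * (a * (e * e)))
        l₁ = solve-∀
        l₂ : ∀ q v e b → b * b * (b + 1ℤ) * (q * q) * (v * v - e * v) - b * (b * (q * v) * (b * (q * v))) ≡ b * b * (q * q) * (v * (v - (b + 1ℤ) * e))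
        l₂ = solve-∀
        l₃ : ∀ q e S b → b * b * (b + 1ℤ) * (q * q) * (e * S) ≡ b * e * (b * (b + 1ℤ) * (q * q) * S)
        l₃ = solve-∀

    -- (20/21) ν² with ν ≥ 13 e²/(20 q) gives e S ≥ (169/420) e⁴/q².
    cubic : + 13 * + 13 * (e * e * e) ≤ + 20 * (+ 20 + 1ℤ) * (q * q) * S
    cubic = cubic′ (+ 13) (+ 20) 0<c 0≤c 0≤c 20qν≥13e² 21e≤ν

    private
      absorb : ∀ k a m l R → 0ℤ < k → 0ℤ ≤ m → a * (e * e * e) ≤ k * (q * q) * S → l * k * (q * q) * R ≤ m * a * e →
               l * (R * (e * e)) ≤ m * S
      absorb k a m l R 0<k 0≤m h h′ = *-cancelˡ-≤′ (k * (q * q)) (0<* 0<k (0<* 0<q 0<q))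
        (≤-trans (≤-reflexive (l₁ q R e k l)) (≤-trans (*ʳ-≤ (0≤² e) h′) (≤-trans (≤-reflexive (l₂ e m a)) (≤-trans (*ˡ-≤ 0≤m h) (≤-reflexive (sym (l₃ q S k m)))))))
        where
        l₁ : ∀ q R e k l → k * (q * q) * (l * (R * (e * e))) ≡ l * k * (q * q) * R * (e * e)
        l₁ = solve-∀
        l₂ : ∀ e m a → m * a * e * (e * e) ≡ m * (a * (e * e * e))
        l₂ = solve-∀
        l₃ : ∀ q S k m → k * (q * q) * (m * S) ≡ m * (k * (q * q) * S)
        l₃ = solve-∀

      scale-by : ∀ w u v x y R → 0ℤ ≤ w → w * v ≡ y → 0ℤ ≤ x - w * u → v * (q * q) * R ≤ u * e → y * (q * q) * R ≤ x * e
      scale-by w u v x y R 0≤w refl h h′ = ≤-by-difference (w * (u * e - v * (q * q) * R) + (x - w * u) * e)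
          (0≤+ (0≤* 0≤w (≤⇒0≤- h′)) (0≤* h 0≤e)) (l w u v x R e (q * q))
        where
        l : ∀ w u v x R e Q → x * e - w * v * Q * R ≡ w * (u * e - v * Q * R) + (x - w * u) * e
        l = solve-∀

      9S : ∀ R → + 9 * (+ 20 * (+ 20 + 1ℤ)) * (q * q) * R ≤ + 8 * (+ 13 * + 13) * e → + 9 * (R * (e * e)) ≤ + 8 * S
      9S R = absorb (+ 20 * (+ 20 + 1ℤ)) (+ 13 * + 13) (+ 8) (+ 9) R 0<c 0≤c cubic

    degenerate : + 9 * (+ (2 ℕ.+ n) * (e * e)) ≤ + 8 * S
    -- 189 · 20 = 9 · 420, and 189 · 7 = 1323 is just below 8 · 169 = 1352.
    degenerate = 9S d-1 (scale-by (+ 189) (+ 7) (+ 20) (+ 8 * (+ 13 * + 13)) (+ 9 * (+ 20 * (+ 20 + 1ℤ))) d-1 0≤c refl 0≤c 7e≥20q²d)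

    moderate : ∀ R → + 3 * (q * q) * R ≤ e → + 9 * (R * (e * e)) ≤ + 8 * S
    -- 1260 · 3 = 9 · 420 and 1260 ≤ 1352: the factor 3 in e/3q² is small enough for the constant of
    -- the theorem and large enough for the ratio 9/8.
    moderate R h = 9S R (scale-by (+ 1260) 1ℤ (+ 3) (+ 8 * (+ 13 * + 13)) (+ 9 * (+ 20 * (+ 20 + 1ℤ))) R 0≤c refl 0≤c (≤-trans h (≤-reflexive (sym (*-identityˡ e)))))

  -- Rational estimates for the partial sums of log 2.

  private
    ¼ : ℚ.ℚ
    ¼ = ℚ.½ ℚ.* ℚ.½

  0≤halfPow : ∀ n → ℚ.0ℚ ℚ.≤ halfPow n
  0≤halfPow zero    = from-yes (ℚ.0ℚ ℚₚ.≤? ℚ.1ℚ)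
  0≤halfPow (suc n) = subst (ℚ._≤ halfPow (suc n)) (ℚₚ.*-zeroʳ ℚ.½) (ℚₚ.*-monoˡ-≤-nonNeg ℚ.½ (0≤halfPow n))

  -- The tail of the series after N ≥ 3 terms is at most a quarter of 2^-N.
  log2-tail : ∀ n → log2Partial (3 ℕ.+ n) ℚ.+ ¼ ℚ.* halfPow (3 ℕ.+ n) ℚ.≤ + 7 ℚ./ 10
  -- 1/2 + 1/8 + 1/24 + 1/32 = 67/96.
  log2-tail zero    = from-yes (log2Partial 3 ℚ.+ ¼ ℚ.* halfPow 3 ℚₚ.≤? + 7 ℚ./ 10)
  log2-tail (suc n) = ℚₚ.≤-trans (ℚₚ.≤-trans (ℚₚ.≤-reflexive (ℚₚ.+-assoc L _ _)) (ℚₚ.+-monoʳ-≤ L (ℚₚ.≤-trans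
      (ℚₚ.+-monoˡ-≤ (¼ ℚ.* h) (ℚₚ.*-monoʳ-≤-nonNeg h ⦃ ℚ.nonNegative (0≤halfPow (4 ℕ.+ n)) ⦄ quarter)) (ℚₚ.≤-reflexive eq)))) (log2-tail n)
    where
    L = log2Partial (3 ℕ.+ n)
    h = halfPow (4 ℕ.+ n)
    quarter : + 1 ℚ./ (4 ℕ.+ n) ℚ.≤ ¼
    quarter = ℚₚ.toℚᵘ-cancel-≤ (ℚᵘₚ.≤-respˡ-≃ (ℚᵘₚ.≃-sym (ℚₚ.toℚᵘ-fromℚᵘ (ℚᵘ.mkℚᵘ (+ 1) (3 ℕ.+ n))))
      (ℚᵘ.*≤* (+≤+ (ℕ.s≤s (ℕ.s≤s (ℕ.s≤s (ℕ.s≤s ℕ.z≤n)))))))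
    eq : ¼ ℚ.* h ℚ.+ ¼ ℚ.* h ≡ ¼ ℚ.* halfPow (3 ℕ.+ n)
    eq = trans (sym (ℚₚ.*-distribʳ-+ h ¼ ¼)) (trans (sym (ℚₚ.*-assoc (¼ ℚ.+ ¼) ℚ.½ (halfPow (3 ℕ.+ n)))) refl)

  log2Partial≤ : ∀ n → log2Partial n ℚ.≤ + 7 ℚ./ 10
  log2Partial≤ 0 = from-yes (log2Partial 0 ℚₚ.≤? + 7 ℚ./ 10)
  log2Partial≤ 1 = from-yes (log2Partial 1 ℚₚ.≤? + 7 ℚ./ 10)
  log2Partial≤ 2 = from-yes (log2Partial 2 ℚₚ.≤? + 7 ℚ./ 10)
  log2Partial≤ (suc (suc (suc n))) = ℚₚ.≤-trans (ℚₚ.≤-trans (ℚₚ.≤-reflexive (sym (ℚₚ.+-identityʳ _)))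
    (ℚₚ.+-monoʳ-≤ (log2Partial (3 ℕ.+ n)) (subst (ℚ._≤ ¼ ℚ.* halfPow (3 ℕ.+ n)) (ℚₚ.*-zeroʳ ¼) (ℚₚ.*-monoˡ-≤-nonNeg ¼ (0≤halfPow (3 ℕ.+ n)))))) (log2-tail n)

  0≤log2Partial : ∀ n → ℚ.0ℚ ℚ.≤ log2Partial n
  0≤log2Partial zero    = ℚₚ.≤-refl
  0≤log2Partial (suc n) = ℚₚ.+-mono-≤ (0≤log2Partial n) (subst (ℚ._≤ + 1 ℚ./ suc n ℚ.* halfPow (suc n)) (ℚₚ.*-zeroʳ (+ 1 ℚ./ suc n))
    (ℚₚ.*-monoˡ-≤-nonNeg (+ 1 ℚ./ suc n) ⦃ ℚₚ.normalize-nonNeg 1 (suc n) ⦄ (0≤halfPow (suc n))))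

  private
    clear-denominators : ∀ a b → ℕ→ℚ (16 ℕ.* a) ℚ.< ℕ→ℚ b ℚ.* (+ 49 ℚ./ 100) → 1600 ℕ.* a ℕ.< 49 ℕ.* b
    clear-denominators a b lt = go (ℚᵘₚ.<-respʳ-≃ (ℚᵘₚ.≃-trans (ℚₚ.toℚᵘ-homo-* (ℕ→ℚ b) (+ 49 ℚ./ 100)) (ℚᵘₚ.*-cong (ℚₚ.toℚᵘ-fromℚᵘ (ℚᵘ.mkℚᵘ (+ b) 0)) (ℚᵘₚ.≃-refl {ℚᵘ.mkℚᵘ (+ 49) 99})))
                 (ℚᵘₚ.<-respˡ-≃ (ℚₚ.toℚᵘ-fromℚᵘ (ℚᵘ.mkℚᵘ (+ (16 ℕ.* a)) 0)) (ℚₚ.toℚᵘ-mono-< lt)))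
      where
      l : + (16 ℕ.* a) * + 100 ≡ + (1600 ℕ.* a)
      l = trans (sym (pos-* (16 ℕ.* a) 100)) (cong +_ (trans (ℕₚ.*-comm (16 ℕ.* a) 100) (trans (sym (ℕₚ.*-assoc 100 16 a)) (cong (λ z → z ℕ.* a) {100 ℕ.* 16} {1600} refl))))
      r : + b * + 49 * + 1 ≡ + (49 ℕ.* b)
      r = trans (*-identityʳ (+ b * + 49)) (trans (sym (pos-* b 49)) (cong +_ (ℕₚ.*-comm b 49)))
      go : ℚᵘ.mkℚᵘ (+ (16 ℕ.* a)) 0 ℚᵘ.< ℚᵘ.mkℚᵘ (+ b) 0 ℚᵘ.* ℚᵘ.mkℚᵘ (+ 49) 99 → 1600 ℕ.* a ℕ.< 49 ℕ.* b
      go (ℚᵘ.*<* p) = drop‿+<+ (subst₂ _<_ l r p)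

  above⇒1600< : ∀ q d e → AboveThreshold q d e → 1600 ℕ.* q ℕ.^ suc d ℕ.< 49 ℕ.* (e ℕ.* e)
  above⇒1600< q d e (n , h) = clear-denominators (q ℕ.^ suc d) (e ℕ.* e) (ℚₚ.<-≤-trans h (ℚₚ.≤-trans
      (ℚₚ.≤-trans (ℚₚ.*-monoʳ-≤-nonNeg L ⦃ nnL ⦄ (ℚₚ.*-monoˡ-≤-nonNeg E ⦃ nnE ⦄ (log2Partial≤ n)))
                  (ℚₚ.*-monoˡ-≤-nonNeg (E ℚ.* (+ 7 ℚ./ 10)) ⦃ nnE7 ⦄ (log2Partial≤ n)))
      (ℚₚ.≤-reflexive (ℚₚ.*-assoc E (+ 7 ℚ./ 10) (+ 7 ℚ./ 10)))))
    where
    L = log2Partial n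
    E = ℕ→ℚ (e ℕ.* e)
    nnL = ℚ.nonNegative (0≤log2Partial n)
    nnE : ℚ.NonNegative E
    nnE = ℚₚ.normalize-nonNeg (e ℕ.* e) 1
    nnE7 : ℚ.NonNegative (E ℚ.* (+ 7 ℚ./ 10))
    nnE7 = ℚ.nonNegative (subst (ℚ._≤ E ℚ.* (+ 7 ℚ./ 10)) (ℚₚ.*-zeroʳ E) (ℚₚ.*-monoˡ-≤-nonNeg E ⦃ nnE ⦄ (from-yes (ℚ.0ℚ ℚₚ.≤? + 7 ℚ./ 10))))

  0<1/ : ∀ k → ℚ.0ℚ ℚ.< + 1 ℚ./ suc k
  0<1/ k = ℚₚ.positive⁻¹ (+ 1 ℚ./ suc k) ⦃ ℚₚ.normalize-pos 1 (suc k) ⦄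

  1/-*-≤ : ∀ k m n → m ℕ.≤ suc k ℕ.* n → (+ 1 ℚ./ suc k) ℚ.* ℕ→ℚ m ℚ.≤ ℕ→ℚ n
  1/-*-≤ k m n h = ℚₚ.toℚᵘ-cancel-≤ (ℚᵘₚ.≤-respˡ-≃ (ℚᵘₚ.≃-sym (ℚᵘₚ.≃-trans (ℚₚ.toℚᵘ-homo-* (+ 1 ℚ./ suc k) (ℕ→ℚ m))
      (ℚᵘₚ.*-cong (ℚₚ.toℚᵘ-fromℚᵘ (ℚᵘ.mkℚᵘ (+ 1) k)) (ℚₚ.toℚᵘ-fromℚᵘ (ℚᵘ.mkℚᵘ (+ m) 0)))))
    (ℚᵘₚ.≤-respʳ-≃ (ℚᵘₚ.≃-sym (ℚₚ.toℚᵘ-fromℚᵘ (ℚᵘ.mkℚᵘ (+ n) 0)))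
      (ℚᵘ.*≤* (subst₂ _≤_ l r (+≤+ h)))))
    where
    l : + m ≡ + 1 * + m * + 1
    l = lem (+ m)
      where
      lem : ∀ a → a ≡ + 1 * a * + 1
      lem = solve-∀
    r : + (suc k ℕ.* n) ≡ + n * + (suc k ℕ.* 1)
    r = trans (pos-* (suc k) n) (trans (*-comm (+ suc k) (+ n)) (cong (λ z → + n * + z) (sym (ℕₚ.*-identityʳ (suc k)))))

  -- Finite fields as enumerated fields

  ∑-tabulate : ∀ {A : Set} {n} (h : Fin n → A) (f : A → ℤ) → ∑ (tabulate h) f ≡ ∑ (allFin n) (λ i → f (h i))
  ∑-tabulate {n = zero}  h f = refl
  ∑-tabulate {n = suc n} h f = cong (λ z → f (h zero) + z) (trans (∑-tabulate (λ i → h (suc i)) f) (sym (∑-tabulate suc (λ i → f (h i)))))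

  finEnum : ∀ n → Enum (Fin n)
  finEnum n = record { _≟_ = Finₚ._≟_ ; elems = allFin n ; once = go n }
    where
    go : ∀ n (a : Fin n) → ∑ (allFin n) (λ i → χ (i Finₚ.≟ a)) ≡ 1ℤ
    go (suc n) zero    = cong (λ z → 1ℤ + z) (trans (∑-tabulate {n = n} Fin.suc _) (trans (∑-cong (allFin n) (λ i → χ-no (suc i Finₚ.≟ zero) (λ ()))) (∑-0 (allFin n))))
    go (suc n) (suc a) = trans (+-identityˡ _) (trans (∑-tabulate {n = n} Fin.suc _) (trans (∑-cong (allFin n) (λ i → χ-⇔ (suc i Finₚ.≟ suc a) (i Finₚ.≟ a) Finₚ.suc-injective (cong suc))) (go n a)))

  module FromFiniteField {q : ℕ} (F : FiniteField q) where
    private module F = FiniteField F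

    open Inverse F.enumeration using (to; from; strictlyInverseˡ; strictlyInverseʳ)

    inv₀ : F.Carrier → F.Carrier
    inv₀ x with x F.≟ F.0#
    ... | yes _   = F.0#
    ... | no x≢0  = proj₁ (F.inverse x x≢0)

    inv₀-right : ∀ x → ¬ x ≡ F.0# → x F.* inv₀ x ≡ F.1#
    inv₀-right x x≢0 with x F.≟ F.0#
    ... | yes e = ⊥-elim (x≢0 e)
    ... | no n  = proj₂ (F.inverse x n)

    enumField : EnumField
    enumField = record
      { Carrier = F.Carrier ; _⊕_ = F._+_ ; _⊗_ = F._*_ ; ⊝_ = F.-_ ; 𝟘 = F.0# ; 𝟙 = F.1#
      ; isCommutativeRing = F.isCommutativeRing ; 𝟘≢𝟙 = F.0≢1 ; inv = inv₀ ; inv-right = inv₀-right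
      ; enum = record
        { _≟_ = F._≟_
        ; elems = mapᴸ from (allFin q)
        ; once = λ a → trans (∑-map from (allFin q) _) (trans (∑-cong (allFin q) (λ i →
            χ-⇔ (from i F.≟ a) (i Finₚ.≟ to a) (λ e → trans (sym (strictlyInverseˡ i)) (cong to e)) (λ e → trans (cong from e) (strictlyInverseʳ a))))
            (Enum.once (finEnum q) (to a))) } }

    open Polynomials enumField

    size≡q : size ≡ + q
    size≡q = trans (∑-length (mapᴸ from (allFin q))) (cong +_ (trans (length-map from (allFin q)) (length-tabulate (λ i → i))))

    module _ (M : CommutativeMonoid 0ℓ 0ℓ) where
      private
        module M = CommutativeMonoid M
        open Algebra.Properties.CommutativeMonoid.Sum M using (sum; sum-cong-≋; sum-permute)

      big-reindex : (φ ψ : Carrier → Carrier) → (∀ x → ψ (φ x) ≡ x) → (∀ x → φ (ψ x) ≡ x) → (f : Carrier → M.Carrier) →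
                    sum (λ i → f (from i)) M.≈ sum (λ i → f (φ (from i)))
      big-reindex φ ψ ψφ φψ f = M.trans (sum-permute (λ i → f (from i)) π)
          (sum-cong-≋ (λ i → M.reflexive (cong f (strictlyInverseʳ (φ (from i))))))
        where
        π = permutation (λ i → to (φ (from i))) (λ i → to (ψ (from i)))
          (λ i → trans (cong (λ z → to (φ z)) (strictlyInverseʳ _)) (trans (cong to (φψ (from i))) (strictlyInverseˡ i)))
          (λ i → trans (cong (λ z → to (ψ z)) (strictlyInverseʳ _)) (trans (cong to (ψφ (from i))) (strictlyInverseˡ i)))

    private
      module S = Algebra.Properties.CommutativeMonoid.Sum R.+-commutativeMonoid
      module P = Algebra.Properties.CommutativeMonoid.Sum R.*-commutativeMonoid
      module × = Algebra.Properties.Monoid.Mult R.+-monoid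

      sum-const : ∀ n c → S.sum {n} (λ _ → c) ≡ n ×.× c
      sum-const n c = S.sum-replicate n

      prod-const : ∀ n c → P.sum {n} (λ _ → c) ≡ c ↑ n
      prod-const n c = P.sum-replicate n

      prod-𝟙 : ∀ n (t : Fin n → Carrier) → (∀ i → t i ≡ 𝟙) → P.sum t ≡ 𝟙
      prod-𝟙 zero    t h = refl
      prod-𝟙 (suc n) t h = trans (cong₂ _⊗_ (h zero) (prod-𝟙 n (λ i → t (suc i)) (λ i → h (suc i)))) (R.*-identityˡ 𝟙)

      prod≢𝟘 : ∀ n (t : Fin n → Carrier) → (∀ i → ¬ t i ≡ 𝟘) → ¬ P.sum t ≡ 𝟘
      prod≢𝟘 zero    t h e = 𝟘≢𝟙 (sym e)
      prod≢𝟘 (suc n) t h   = ⊗≢𝟘 (h zero) (prod≢𝟘 n (λ i → t (suc i)) (λ i → h (suc i)))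

    -- Translation by 𝟙 permutes the elements, hence q·𝟙 = 𝟘.
    q×𝟙≡𝟘 : q ×.× 𝟙 ≡ 𝟘
    q×𝟙≡𝟘 = trans (solve 2 (λ s p → p := (s :+ p) :- s) refl s (q ×.× 𝟙)) (trans (cong (_⊖ᶠ s) (sym shifted)) (R.-‿inverseʳ s))
      where
      s = S.sum (λ i → from i)
      shifted : s ≡ s ⊕ q ×.× 𝟙
      shifted = trans (big-reindex R.+-commutativeMonoid (_⊕ 𝟙) (_⊖ᶠ 𝟙)
          (λ x → solve 1 (λ x → x :+ con (+ 1) :- con (+ 1) := x) refl x) (λ x → solve 1 (λ x → x :- con (+ 1) :+ con (+ 1) := x) refl x) (λ x → x))
        (trans (S.∑-distrib-+ (λ i → from i) (λ _ → 𝟙)) (cong (s ⊕_) (sum-const q 𝟙)))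

    𝟚≢𝟘 : q DM.% 2 ≡ 1 → ¬ 𝟚 ≡ 𝟘
    𝟚≢𝟘 odd e = 𝟘≢𝟙 (trans (sym q×𝟙≡𝟘) (trans (cong (×._× 𝟙) q≡) (trans (cong (𝟙 ⊕_) (even (q DM./ 2))) (R.+-identityʳ 𝟙))))
      where
      q≡ : q ≡ suc (q DM./ 2 ℕ.* 2)
      q≡ = trans (DM.m≡m%n+[m/n]*n q 2) (cong (ℕ._+ q DM./ 2 ℕ.* 2) odd)
      even : ∀ k → (k ℕ.* 2) ×.× 𝟙 ≡ 𝟘
      even zero    = refl
      even (suc k) = trans (solve 1 (λ z → con (+ 1) :+ (con (+ 1) :+ z) := con (+ 2) :+ z) refl ((k ℕ.* 2) ×.× 𝟙)) (trans (cong₂ _⊕_ e (even k)) (R.+-identityˡ 𝟘))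

    -- Multiplication by a ≠ 0 permutes the field. To keep the product over all q elements nonzero,
    -- u replaces `𝟘` by `𝟙`; w supplies the factor a missing at that one place, so the exponent
    -- becomes q and not q - 1.
    fermat : ∀ a → a ↑ q ≡ a
    fermat a with a ≟ 𝟘
    ... | yes refl = 𝟘↑ q (to 𝟘)
      where
      𝟘↑ : ∀ n → Fin n → 𝟘 ↑ n ≡ 𝟘
      𝟘↑ (suc n) _ = R.zeroˡ _
    ... | no a≢0 = sym (⊗-cancelˡ (prod≢𝟘 q (λ i → u (from i)) (λ i → u≢𝟘 (from i))) (begin
      Π ⊗ a ≡⟨ cong (_⊗ a) (big-reindex R.*-commutativeMonoid (a ⊗_) (inv a ⊗_) (λ x → inv-a⊗[a⊗b] x a≢0) (λ x → a⊗[inv-a⊗b] x a≢0) u) ⟩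
      P.sum (λ i → u (a ⊗ from i)) ⊗ a ≡⟨ cong (P.sum (λ i → u (a ⊗ from i)) ⊗_) (sym Πw) ⟩
      P.sum (λ i → u (a ⊗ from i)) ⊗ P.sum (λ i → w (from i)) ≡⟨ sym (P.∑-distrib-+ (λ i → u (a ⊗ from i)) (λ i → w (from i))) ⟩
      P.sum (λ i → u (a ⊗ from i) ⊗ w (from i)) ≡⟨ P.sum-cong-≗ (λ i → uw (from i)) ⟩
      P.sum (λ i → u (from i) ⊗ a) ≡⟨ P.∑-distrib-+ (λ i → u (from i)) (λ _ → a) ⟩
      Π ⊗ P.sum {q} (λ _ → a) ≡⟨ cong (Π ⊗_) (prod-const q a) ⟩
      Π ⊗ a ↑ q ∎))
      where
      open ≡-Reasoning
      u w : Carrier → Carrier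
      u x with x ≟ 𝟘
      ... | yes _ = 𝟙
      ... | no _  = x
      w x with x ≟ 𝟘
      ... | yes _ = a
      ... | no _  = 𝟙
      u≢𝟘 : ∀ x → ¬ u x ≡ 𝟘
      u≢𝟘 x with x ≟ 𝟘
      ... | yes _ = λ e → 𝟘≢𝟙 (sym e)
      ... | no n  = n
      uw : ∀ x → u (a ⊗ x) ⊗ w x ≡ u x ⊗ a
      uw x with x ≟ 𝟘
      ... | yes refl with (a ⊗ 𝟘) ≟ 𝟘
      ...   | yes _ = refl
      ...   | no n  = ⊥-elim (n (R.zeroʳ a))
      uw x | no x≢0 with (a ⊗ x) ≟ 𝟘
      ...   | yes e = ⊥-elim (⊗≢𝟘 a≢0 x≢0 e)
      ...   | no _  = trans (R.*-identityʳ _) (R.*-comm a x)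
      Π = P.sum (λ i → u (from i))
      Πw : P.sum (λ i → w (from i)) ≡ a
      Πw = go q from to strictlyInverseˡ strictlyInverseʳ
        where
        go : ∀ n (fr : Fin n → Carrier) (t : Carrier → Fin n) → (∀ i → t (fr i) ≡ i) → (∀ x → fr (t x) ≡ x) → P.sum (λ i → w (fr i)) ≡ a
        go zero fr t _ _ with t 𝟘
        ... | ()
        go (suc n) fr t tf ft = trans (P.sum-remove {i = t 𝟘} (λ i → w (fr i))) (trans (cong₂ _⊗_ w0 (prod-𝟙 n _ wj)) (R.*-identityʳ a))
          where
          w0 : w (fr (t 𝟘)) ≡ a
          w0 with fr (t 𝟘) ≟ 𝟘
          ... | yes _ = refl
          ... | no n  = ⊥-elim (n (ft 𝟘))
          wj : ∀ j → w (fr (punchIn (t 𝟘) j)) ≡ 𝟙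
          wj j with fr (punchIn (t 𝟘) j) ≟ 𝟘
          ... | yes e = ⊥-elim (Finₚ.punchInᵢ≢i (t 𝟘) j (trans (sym (tf _)) (cong t e)))
          ... | no _  = refl

  -- Counting prisms

  open Defs using (FiniteField; AboveThreshold; prismCount; isNonDegPrism?; IsNonDegPrism)
  open import Data.List.Relation.Unary.Unique.Propositional using (Unique)
  import Data.List.Relation.Unary.AllPairs as AP
  import Data.List.Relation.Unary.All as All
  open import Data.List.Base using (concatMap)
  import Data.Vec.Base as Vec
  import Data.Vec.Relation.Unary.All as VA
  open import Relation.Binary.Definitions using (DecidableEquality)
  open import Relation.Nullary using (¬?; _×-dec_; map′)
  import Data.Nat.DivMod as DM
  import Data.Nat.Tactic.RingSolver as ℕ-Solver
  import Data.Fin.Base as Fin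
  open import Function.Bundles using (Inverse)

  ∑-unique≤1 : {A : Set} (_≟_ : DecidableEquality A) → ∀ {xs} → Unique xs → ∀ a → ∑[ x ∈ xs ] χ (x ≟ a) ≤ 1ℤ
  ∑-unique≤1 _≟_ AP.[] a = +≤+ ℕ.z≤n
  ∑-unique≤1 _≟_ {x ∷ xs} (x∉ AP.∷ u) a with x ≟ a
  ... | no _     = subst (_≤ 1ℤ) (sym (+-identityˡ _)) (∑-unique≤1 _≟_ u a)
  ... | yes refl = ≤-reflexive (cong (λ z → 1ℤ + z) (absent x∉))
    where
    absent : ∀ {ys} → All.All (λ y → ¬ x ≡ y) ys → ∑[ y ∈ ys ] χ (y ≟ x) ≡ 0ℤ
    absent All.[] = refl
    absent (n All.∷ ns) = cong₂ _+_ (χ-no (_ ≟ x) (λ e → n (sym e))) (absent ns)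

  χ≤χ : {P Q : Set} (p : Dec P) (q : Dec Q) → (P → Q) → χ p ≤ χ q
  χ≤χ (yes p) q f = ≤-reflexive (sym (χ-yes q (f p)))
  χ≤χ (no _)  q f = 0≤χ q

  module DistinctTuples {A : Set} (_≟_ : DecidableEquality A) {xs : List A} (uniq : Unique xs)
                        {P : A → Set} (P? : ∀ x → Dec (P x)) where
    -- S collects the entries already chosen, so that distinctness becomes a condition on each new
    -- entry and choices can be counted one at a time.
    data Good (S : List A) : ∀ {n} → Vec A n → Set where
      []  : Good S []
      add : ∀ {n x} {v : Vec A n} → P x × All.All (λ s → ¬ x ≡ s) S → Good (x ∷ S) v → Good S (x ∷ v)

    fresh? : ∀ S x → Dec (All.All (λ s → ¬ x ≡ s) S)
    fresh? S x = All.all? (λ s → ¬? (x ≟ s)) S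

    good? : ∀ S {n} (v : Vec A n) → Dec (Good S v)
    good? S []      = yes []
    good? S (x ∷ v) = map′ (λ { (p , g) → add p g }) (λ { (add p g) → p , g }) ((P? x ×-dec fresh? S x) ×-dec good? (x ∷ S) v)

    good-fresh : ∀ {S n} {v : Vec A n} → Good S v → All.All (λ x → All.All (λ s → ¬ x ≡ s) S) (Vec.toList v)
    good-fresh []               = All.[]
    good-fresh (add (_ , fr) g) = fr All.∷ All.map All.tail (good-fresh g)

    good-unique : ∀ {S n} {v : Vec A n} → Good S v → Unique (Vec.toList v)
    good-unique []        = AP.[]
    good-unique (add _ g) = All.map (λ fr e → All.head fr (sym e)) (good-fresh g) AP.∷ good-unique g

    good-all : ∀ {S n} {v : Vec A n} → Good S v → VA.All P v
    good-all []              = VA.[]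
    good-all (add (p , _) g) = p VA.∷ good-all g

    w : ℤ
    w = ∑[ x ∈ xs ] χ (P? x)

    tupleCount : ℕ → List A → ℤ
    tupleCount n S = ∑[ v ∈ tuples n xs ] χ (good? S v)

    private
      available : List A → ℤ
      available S = ∑[ x ∈ xs ] χ (P? x ×-dec fresh? S x)

      available≥ : ∀ S → w - + length S ≤ available S
      available≥ []      = ≤-trans (≤-reflexive (+-identityʳ w)) (∑-mono xs (λ x → χ≤χ (P? x) (P? x ×-dec fresh? [] x) (λ p → p , All.[])))
      available≥ (s ∷ S) = ≤-trans (≤-reflexive (lem w (+ length S))) (≤-trans (+-mono-≤ (available≥ S) (neg-mono-≤ (∑-unique≤1 _≟_ uniq s)))
        (≤-trans (≤-reflexive (sym (∑-- xs _ _))) (∑-mono xs term)))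
        where
        lem : ∀ w l → w - (1ℤ + l) ≡ w - l - 1ℤ
        lem = solve-∀
        term : ∀ x → χ (P? x ×-dec fresh? S x) - χ (x ≟ s) ≤ χ (P? x ×-dec fresh? (s ∷ S) x)
        term x with x ≟ s
        ... | no n  = ≤-trans (≤-reflexive (+-identityʳ _)) (χ≤χ (P? x ×-dec fresh? S x) _ (λ { (p , fr) → p , n All.∷ fr }))
        ... | yes _ = ≤-trans (+-monoˡ-≤ -1ℤ (χ≤1 (P? x ×-dec fresh? S x))) (0≤χ _)
          where
          χ≤1 : {Q : Set} (q : Dec Q) → χ q ≤ 1ℤ
          χ≤1 (yes _) = ≤-refl
          χ≤1 (no _)  = +≤+ ℕ.z≤n

      tupleCount-suc : ∀ n S → tupleCount (suc n) S ≡ ∑[ x ∈ xs ] χ (P? x ×-dec fresh? S x) * tupleCount n (x ∷ S)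
      tupleCount-suc n S = trans (∑-tuples n xs _) (∑-cong xs (λ x → trans (∑-cong (tuples n xs) (λ v →
        χ-× (good? S (x ∷ v)) (P? x ×-dec fresh? S x) (good? (x ∷ S) v) (λ { (add p g) → p , g }) add)) (∑-*ˡ (tuples n xs) (χ (P? x ×-dec fresh? S x)) (λ v → χ (good? (x ∷ S) v)))))

    0≤tupleCount : ∀ n S → 0ℤ ≤ tupleCount n S
    0≤tupleCount n S = ∑-≥0 (tuples n xs) (λ v → 0≤χ (good? S v))

    -- With l < D entries used at least w - l remain, and w - l ≥ w/D because w ≥ D. Each choice
    -- therefore costs at most a factor D.
    tupleCount≥ : ∀ D n S → length S ℕ.+ n ≡ D → + D ≤ w → w ^ n ≤ (+ D) ^ n * tupleCount n S
    tupleCount≥ D zero    S _ _  = ≤-refl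
    tupleCount≥ D (suc n) S eq D≤w = ≤-trans (*ʳ-≤ {w ^ n} (0≤^ 0≤w n) room) (≤-trans (≤-reflexive (*-assoc (+ D) _ (w ^ n)))
      (≤-trans (*ˡ-≤ {+ D} (+≤+ ℕ.z≤n) (*ʳ-≤ (0≤^ 0≤w n) (available≥ S)))
      (≤-trans (*ˡ-≤ {+ D} (+≤+ ℕ.z≤n) (≤-trans (≤-reflexive (sym (∑-*ʳ xs _ (w ^ n)))) (∑-mono xs (λ x → *ˡ-≤ (0≤χ (P? x ×-dec fresh? S x))
        (tupleCount≥ D n (x ∷ S) (trans (sym (ℕₚ.+-suc (length S) n)) eq) D≤w)))))
      (≤-reflexive total))))
      where
      0≤w : 0ℤ ≤ w
      0≤w = ≤-trans (+≤+ ℕ.z≤n) D≤w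
      D≡ : + D ≡ 1ℤ + (+ length S + + n)
      D≡ = trans (cong +_ (trans (sym eq) (ℕₚ.+-suc (length S) n))) refl
      room : w ≤ + D * (w - + length S)
      room = ≤-by-difference ((+ length S + + n) * (w - + D) + (1ℤ + (+ length S + + n)) * + n)
        (0≤+ (0≤* {+ length S + + n} (+≤+ ℕ.z≤n) (≤⇒0≤- D≤w)) (0≤* {1ℤ + (+ length S + + n)} {+ n} (+≤+ ℕ.z≤n) (+≤+ ℕ.z≤n)))
        (trans (cong (λ z → z * (w - + length S) - w) D≡) (trans (lem w (+ length S) (+ n)) (cong (λ z → (+ length S + + n) * (w - z) + (1ℤ + (+ length S + + n)) * + n) (sym D≡))))
        where
        lem : ∀ w l n → (1ℤ + (l + n)) * (w - l) - w ≡ (l + n) * (w - (1ℤ + (l + n))) + (1ℤ + (l + n)) * n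
        lem = solve-∀
      total : + D * (∑[ x ∈ xs ] χ (P? x ×-dec fresh? S x) * ((+ D) ^ n * tupleCount n (x ∷ S))) ≡ (+ D) ^ suc n * tupleCount (suc n) S
      total = trans (cong (+ D *_) (trans (∑-cong xs (λ x → comm (χ (P? x ×-dec fresh? S x)) ((+ D) ^ n) (tupleCount n (x ∷ S)))) (trans (∑-*ˡ xs ((+ D) ^ n) _)
        (cong ((+ D) ^ n *_) (sym (tupleCount-suc n S)))))) (sym (*-assoc (+ D) ((+ D) ^ n) _))
        where
        comm : ∀ a b c → a * (b * c) ≡ b * (a * c)
        comm = solve-∀

  module Prisms {q : ℕ} (F : FiniteField q) (d : ℕ) {t : FiniteField.Carrier F} (t≢0 : ¬ t ≡ FiniteField.0# F)
                (E : List (Defs.Point F d)) (uniq : Unique E) where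
    open FromFiniteField F using (enumField)
    open Geometry enumField
    _≟ᵖ_ = Enum._≟_ (ptEnum d)

    a : Pt d → Pt d → ℤ
    a x y = χ (nrm (x -ᵖ y) ≟ t)

    IsApex : Pt d → Pt d → Pt d → Set
    IsApex y z x = (nrm (x -ᵖ y) ≡ t) × (nrm (x -ᵖ z) ≡ t)

    isApex? : ∀ y z x → Dec (IsApex y z x)
    isApex? y z x = (nrm (x -ᵖ y) ≟ t) ×-dec (nrm (x -ᵖ z) ≟ t)

    private module DT y z = DistinctTuples _≟ᵖ_ uniq (isApex? y z)

    apexes : Pt d → Pt d → ℤ
    apexes y z = DT.w y z

    e edges S : ℤ
    e     = ∑[ x ∈ E ] 1ℤ
    edges = ∑[ x ∈ E ] ∑[ y ∈ E ] a x y
    S     = ∑[ y ∈ E ] ∑[ z ∈ E ] χ (¬? (y ≟ᵖ z)) * apexes y z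

    0≤e : 0ℤ ≤ e
    0≤e = ∑-≥0 E (λ _ → +≤+ ℕ.z≤n)

    0≤edges : 0ℤ ≤ edges
    0≤edges = ∑-≥0 E (λ x → ∑-≥0 E (λ y → 0≤χ (nrm (x -ᵖ y) ≟ t)))

    private
      apexes≡ : ∀ y z → apexes y z ≡ ∑[ x ∈ E ] a x y * a x z
      apexes≡ y z = ∑-cong E (λ x → χ-× (isApex? y z x) (nrm (x -ᵖ y) ≟ t) (nrm (x -ᵖ z) ≟ t) (λ p → p) _,_)

      deg : Pt d → ℤ
      deg x = ∑[ y ∈ E ] a x y

      deg²-sum : ∑[ x ∈ E ] deg x * deg x ≡ ∑[ y ∈ E ] ∑[ z ∈ E ] apexes y z
      deg²-sum = begin
        ∑[ x ∈ E ] deg x * deg x ≡⟨ ∑-cong E (λ x → sym (∑-product E E (a x) (a x))) ⟩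
        ∑[ x ∈ E ] ∑[ y ∈ E ] ∑[ z ∈ E ] a x y * a x z ≡⟨ trans (∑-swap E E _) (∑-cong E (λ y → ∑-swap E E _)) ⟩
        ∑[ y ∈ E ] ∑[ z ∈ E ] ∑[ x ∈ E ] a x y * a x z ≡⟨ ∑-cong E (λ y → ∑-cong E (λ z → sym (apexes≡ y z))) ⟩
        ∑[ y ∈ E ] ∑[ z ∈ E ] apexes y z ∎
        where open ≡-Reasoning

      0≤apexes : ∀ y z → 0ℤ ≤ apexes y z
      0≤apexes y z = ∑-≥0 E (λ x → 0≤χ (isApex? y z x))

      diagonal≤ : ∑[ y ∈ E ] ∑[ z ∈ E ] χ (y ≟ᵖ z) * apexes y z ≤ edges
      diagonal≤ = ≤-trans (∑-mono E row) (≤-reflexive (trans (∑-cong E (λ y → trans (apexes≡ y y) (∑-cong E (λ x → idem (nrm (x -ᵖ y) ≟ t))))) (∑-swap E E (λ y x → a x y))))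
        where
        idem : {Q : Set} (p : Dec Q) → χ p * χ p ≡ χ p
        idem (yes _) = refl
        idem (no _)  = refl
        row : ∀ y → ∑[ z ∈ E ] χ (y ≟ᵖ z) * apexes y z ≤ apexes y y
        row y = ≤-trans (≤-reflexive (trans (∑-cong E (λ z → trans (χ-guard (y ≟ᵖ z) (λ { refl → refl })) (cong (_* apexes y y) (χ-⇔ (y ≟ᵖ z) (z ≟ᵖ y) sym sym)))) (∑-*ʳ E _ (apexes y y))))
          (≤-trans (*ʳ-≤ (0≤apexes y y) (∑-unique≤1 _≟ᵖ_ uniq y)) (≤-reflexive (*-identityˡ _)))

      deg²≤ : ∑[ x ∈ E ] deg x * deg x ≤ S + edges
      deg²≤ = ≤-trans (≤-reflexive (trans deg²-sum (trans (∑-cong E (λ y → trans (∑-cong E (λ z → split (y ≟ᵖ z) (apexes y z))) (∑-+ E _ _))) (∑-+ E _ _)))) (+-monoʳ-≤ S diagonal≤)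
        where
        split : {Q : Set} (p : Dec Q) (b : ℤ) → b ≡ χ (¬? p) * b + χ p * b
        split (yes _) b = sym (trans (+-identityˡ _) (*-identityˡ b))
        split (no _)  b = sym (trans (+-identityʳ _) (*-identityˡ b))

    -- Cauchy-Schwarz on the degrees. The sum of squared degrees counts the apexes over all pairs (y
    -- , z), and the pairs with y = z account for at most `edges`.
    energy : edges * edges - e * edges ≤ e * S
    energy = ≤-by-difference (e * (S + edges) - edges * edges) (≤⇒0≤- (≤-trans cauchy (*ˡ-≤ 0≤e deg²≤))) (lem e S edges)
      where
      lem : ∀ e s v → e * s - (v * v - e * v) ≡ e * (s + v) - v * v
      lem = solve-∀
      cauchyᴱ : (xs : List (Pt d)) (f : Pt d → ℤ) → ∑ xs f * ∑ xs f ≤ (∑[ x ∈ xs ] 1ℤ) * (∑[ x ∈ xs ] f x * f x)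
      cauchyᴱ []       f = ≤-refl
      cauchyᴱ (x ∷ xs) f = subst (λ s → s * s ≤ (∑[ y ∈ x ∷ xs ] 1ℤ) * (∑[ y ∈ x ∷ xs ] f y * f y)) (∑-cong (x ∷ xs) (λ y → *-identityˡ (f y)))
        (∑-cauchy (x ∷ xs) (λ _ → 1ℤ) f (<-≤-trans (+<+ (ℕ.s≤s ℕ.z≤n)) (+-monoʳ-≤ 1ℤ (∑-≥0 xs (λ _ → +≤+ ℕ.z≤n)))))
      cauchy : edges * edges ≤ e * (∑[ x ∈ E ] deg x * deg x)
      cauchy = cauchyᴱ E deg

    private
      nrm≡ : ∀ {n} (x y : Pt n) → Defs.‖_‖ F (Defs._-ᵥ_ F x y) ≡ nrm (x -ᵖ y)
      nrm≡ []      []      = refl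
      nrm≡ (x ∷ v) (y ∷ w) = cong ((x ⊖ᶠ y) ⊗ (x ⊖ᶠ y) ⊕_) (nrm≡ v w)

      tuples≡ : ∀ {B : Set} n (xs : List B) → Defs.tuples F n xs ≡ tuples n xs
      tuples≡ zero    xs = refl
      tuples≡ (suc n) xs = cong (λ l → concatMap (λ x → mapᴸ (x ∷_) l) xs) (tuples≡ n xs)

      nrm-self : ∀ (x : Pt d) → nrm (x -ᵖ x) ≡ 𝟘
      nrm-self x = trans (cong nrm (-ᵖ-self x)) (nrm0 d)
        where
        nrm0 : ∀ n → nrm (0ᵖ {n}) ≡ 𝟘
        nrm0 zero    = refl
        nrm0 (suc n) = trans (cong (𝟘 ⊗ 𝟘 ⊕_) (nrm0 n)) (solve 0 (con (+ 0) :* con (+ 0) :+ con (+ 0) := con (+ 0)) refl)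

      -- An apex cannot equal y or z, since its distance to them is t ≠ 0 while a point has distance
      -- 0 from itself.
      good⇒prism : ∀ {y z n} {v : Vec (Pt d) n} → ¬ y ≡ z → DT.Good y z [] v → IsNonDegPrism F t n (y ∷ z ∷ v)
      good⇒prism {y} {z} y≢z g = VA.map (λ { {x} (p , p′) → trans (nrm≡ x y) p , trans (nrm≡ x z) p′ }) (DT.good-all y z g)
          , (y≢z All.∷ avoid (DT.good-all y z g) (λ { (p , _) refl → t≢0 (trans (sym p) (nrm-self y)) })) AP.∷
            (avoid (DT.good-all y z g) (λ { (_ , p) refl → t≢0 (trans (sym p) (nrm-self z)) }) AP.∷ DT.good-unique y z g)
        where
        avoid : ∀ {n c} {v : Vec (Pt d) n} → VA.All (IsApex y z) v → (∀ {x} → IsApex y z x → ¬ c ≡ x) → All.All (λ x → ¬ c ≡ x) (Vec.toList v)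
        avoid VA.[]       h = All.[]
        avoid (p VA.∷ ps) h = h p All.∷ avoid ps h

    prismCount≥ : ∑[ y ∈ E ] ∑[ z ∈ E ] χ (¬? (y ≟ᵖ z)) * DT.tupleCount y z d [] ≤ + prismCount F t d E
    prismCount≥ = ≤-trans (∑-mono E (λ y → ∑-mono E (λ z → ≤-trans (≤-reflexive (sym (∑-*ˡ (tuples d E) (χ (¬? (y ≟ᵖ z))) (λ v → χ (DT.good? y z [] v))))) (∑-mono (tuples d E) (term y z))))) (≤-reflexive (begin
        ∑[ y ∈ E ] ∑[ z ∈ E ] ∑[ v ∈ tuples d E ] χ (isNonDegPrism? F t d (y ∷ z ∷ v)) ≡⟨ ∑-cong E (λ y → sym (∑-tuples d E _)) ⟩
        ∑[ y ∈ E ] ∑[ v ∈ tuples (suc d) E ] χ (isNonDegPrism? F t d (y ∷ v)) ≡⟨ sym (∑-tuples (suc d) E _) ⟩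
        ∑[ v ∈ tuples (suc (suc d)) E ] χ (isNonDegPrism? F t d v) ≡⟨ cong (λ l → ∑[ v ∈ l ] χ (isNonDegPrism? F t d v)) (sym (tuples≡ (suc (suc d)) E)) ⟩
        ∑[ v ∈ Defs.tuples F (suc (suc d)) E ] χ (isNonDegPrism? F t d v) ≡⟨ ∑-filter (Defs.tuples F (suc (suc d)) E) (isNonDegPrism? F t d) ⟩
        + prismCount F t d E ∎))
      where
      open ≡-Reasoning
      term : ∀ y z (v : Vec (Pt d) d) → χ (¬? (y ≟ᵖ z)) * χ (DT.good? y z [] v) ≤ χ (isNonDegPrism? F t d (y ∷ z ∷ v))
      term y z v = go (y ≟ᵖ z)
        where
        go : (p : Dec (y ≡ z)) → χ (¬? p) * χ (DT.good? y z [] v) ≤ χ (isNonDegPrism? F t d (y ∷ z ∷ v))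
        go (yes _)  = 0≤χ (isNonDegPrism? F t d (y ∷ z ∷ v))
        go (no y≢z) = ≤-trans (≤-reflexive (*-identityˡ _)) (χ≤χ (DT.good? y z [] v) (isNonDegPrism? F t d (y ∷ z ∷ v)) (good⇒prism y≢z))

    -- Pairs with w ≤ R apexes contribute nothing positive to the sum of w - R. For the others w ≥ R
    -- + 1 ≥ d, so (R + 1)^(d-1) (w - R) ≤ w^d, which is at most d^d times the number of d-tuples of
    -- distinct apexes.
    popular : ∀ d′ R → d ≡ suc d′ → d′ ℕ.≤ R → (+ suc R) ^ d′ * (S - + R * (e * e)) ≤ (+ d) ^ d * + prismCount F t d E
    popular d′ R d≡ d′≤R = ≤-trans (*ˡ-≤ (0≤^ (+≤+ ℕ.z≤n) d′) drop) (≤-trans (≤-reflexive (sym push)) (≤-trans (∑-mono E (λ y → ∑-mono E (λ z → *ˡ-≤ (0≤χ (¬? (y ≟ᵖ z))) (pair y z))))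
        (≤-trans (≤-reflexive pull) (*ˡ-≤ (0≤^ (+≤+ ℕ.z≤n) d) prismCount≥))))
      where
      open ≡-Reasoning
      comm : ∀ a b c → a * (b * c) ≡ b * (a * c)
      comm = solve-∀
      T = + suc R
      U = ∑[ y ∈ E ] ∑[ z ∈ E ] χ (¬? (y ≟ᵖ z)) * (apexes y z - + R)
      pair : ∀ y z → T ^ d′ * (apexes y z - + R) ≤ (+ d) ^ d * DT.tupleCount y z d []
      pair y z with T ℤₚ.≤? apexes y z
      ... | yes T≤w = ≤-trans (*ˡ-≤ (0≤^ (+≤+ ℕ.z≤n) d′) (≤-by-difference (+ R) (+≤+ ℕ.z≤n) (l (apexes y z) (+ R)))) (≤-trans (≤-reflexive (*-comm (T ^ d′) (apexes y z)))
          (≤-trans (*ˡ-≤ (0≤apexes y z) (^-mono (+≤+ ℕ.z≤n) T≤w d′)) (subst (λ n → apexes y z ^ n ≤ (+ d) ^ d * DT.tupleCount y z d []) d≡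
            (DT.tupleCount≥ y z d d [] refl (≤-trans (+≤+ (subst (ℕ._≤ suc R) (sym d≡) (ℕ.s≤s d′≤R))) T≤w)))))
        where
        l : ∀ w r → w - (w - r) ≡ r
        l = solve-∀
      ... | no T≰w = ≤-trans (subst (T ^ d′ * (apexes y z - + R) ≤_) (*-zeroʳ (T ^ d′)) (*ˡ-≤ (0≤^ (+≤+ ℕ.z≤n) d′) (i≤j⇒i-j≤0 (i<j⇒i≤pred[j] (≰⇒> T≰w)))))
          (0≤* (0≤^ {+ d} (+≤+ ℕ.z≤n) d) (DT.0≤tupleCount y z d []))
      drop : S - + R * (e * e) ≤ U
      drop = ≤-trans (+-monoʳ-≤ S (neg-mono-≤ (*ˡ-≤ {+ R} (+≤+ ℕ.z≤n) few))) (≤-reflexive (sym (begin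
        U ≡⟨ ∑-cong E (λ y → trans (∑-cong E (λ z → dist (χ (¬? (y ≟ᵖ z))) (apexes y z) (+ R))) (trans (∑-- E _ _) (cong (λ s → (∑[ z ∈ E ] χ (¬? (y ≟ᵖ z)) * apexes y z) - s) (∑-*ˡ E (+ R) _)))) ⟩
        ∑[ y ∈ E ] ((∑[ z ∈ E ] χ (¬? (y ≟ᵖ z)) * apexes y z) - + R * (∑[ z ∈ E ] χ (¬? (y ≟ᵖ z)))) ≡⟨ trans (∑-- E _ _) (cong (λ s → S - s) (∑-*ˡ E (+ R) _)) ⟩
        S - + R * (∑[ y ∈ E ] ∑[ z ∈ E ] χ (¬? (y ≟ᵖ z))) ∎)))
        where
        dist : ∀ c w r → c * (w - r) ≡ c * w - r * c
        dist = solve-∀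
        few : ∑[ y ∈ E ] ∑[ z ∈ E ] χ (¬? (y ≟ᵖ z)) ≤ e * e
        few = ≤-trans (∑-mono E (λ y → ∑-mono E (λ z → χ≤χ (¬? (y ≟ᵖ z)) (yes refl) (λ _ → refl {x = y})))) (≤-reflexive (trans (∑-cong E (λ _ → sym (*-identityˡ e))) (∑-*ʳ E (λ _ → 1ℤ) e)))
      push : ∑[ y ∈ E ] ∑[ z ∈ E ] χ (¬? (y ≟ᵖ z)) * (T ^ d′ * (apexes y z - + R)) ≡ T ^ d′ * U
      push = trans (∑-cong E (λ y → trans (∑-cong E (λ z → comm (χ (¬? (y ≟ᵖ z))) (T ^ d′) (apexes y z - + R))) (∑-*ˡ E (T ^ d′) _))) (∑-*ˡ E (T ^ d′) _)
      pull : ∑[ y ∈ E ] ∑[ z ∈ E ] χ (¬? (y ≟ᵖ z)) * ((+ d) ^ d * DT.tupleCount y z d []) ≡ (+ d) ^ d * (∑[ y ∈ E ] ∑[ z ∈ E ] χ (¬? (y ≟ᵖ z)) * DT.tupleCount y z d [])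
      pull = trans (∑-cong E (λ y → trans (∑-cong E (λ z → comm (χ (¬? (y ≟ᵖ z))) ((+ d) ^ d) (DT.tupleCount y z d []))) (∑-*ˡ E ((+ d) ^ d) _))) (∑-*ˡ E ((+ d) ^ d) _)

  -- Choice of the popularity threshold and assembly of the bound.

  open Defs using (FiniteField; AboveThreshold; prismCount; isNonDegPrism?; IsNonDegPrism)
  open import Data.List.Relation.Unary.Unique.Propositional using (Unique)
  import Data.List.Relation.Unary.AllPairs as AP
  import Data.List.Relation.Unary.All as All
  open import Data.List.Base using (concatMap)
  import Data.Vec.Base as Vec
  import Data.Vec.Relation.Unary.All as VA
  open import Relation.Binary.Definitions using (DecidableEquality)
  open import Relation.Nullary using (¬?; _×-dec_; map′)
  import Data.Nat.DivMod as DM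
  import Data.Nat.Tactic.RingSolver as ℕ-Solver
  import Data.Fin.Base as Fin
  open import Function.Bundles using (Inverse)
  open import Data.Nat.Primality using (Prime)

  odd-power : ∀ p k → p DM.% 2 ≡ 1 → (p ℕ.^ k) DM.% 2 ≡ 1
  odd-power p zero    _ = refl
  odd-power p (suc k) h = trans (DM.%-distribˡ-* p (p ℕ.^ k) 2) (cong₂ (λ a b → (a ℕ.* b) DM.% 2) h (odd-power p k h))

  odd≥3 : ∀ {q} → FiniteField q → q DM.% 2 ≡ 1 → ∃ λ q′′ → q ≡ suc (suc (suc q′′))
  odd≥3 {1} F _ = ⊥-elim (FiniteField.0≢1 F (trans (sym (strictlyInverseʳ _)) (trans (cong from (one _ _)) (strictlyInverseʳ _))))
    where
    open Inverse (FiniteField.enumeration F) using (from; strictlyInverseʳ)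
    one : ∀ (i j : Fin.Fin 1) → i ≡ j
    one Fin.zero Fin.zero = refl
  odd≥3 {suc (suc (suc q′′))} _ _ = q′′ , refl

  -- The factor 9 comes from S ≤ 9 (S - R e²), m = 420 from `cubic`, d^d from the choice of distinct
  -- apexes, and 3^(d-1) from e ≤ 3 q² (R + 1).
  prism-constant : ℕ → ℕ → ℕ
  prism-constant m n = 9 ℕ.* m ℕ.* (3 ℕ.+ n) ℕ.^ (3 ℕ.+ n) ℕ.* 3 ℕ.^ (2 ℕ.+ n)

  module PopularPairs (m q n ℓ N₀ : ℕ) ⦃ _ : ℕ.NonZero q ⦄ (S : ℤ)
    (degenerate : + 9 * (+ (2 ℕ.+ n) * (+ ℓ * + ℓ)) ≤ + 8 * S)
    (moderate : ∀ R → + 3 * (+ q * + q) * R ≤ + ℓ → + 9 * (R * (+ ℓ * + ℓ)) ≤ + 8 * S)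
    (e³≤ : + ℓ * + ℓ * + ℓ ≤ + m * (+ q * + q) * S)
    (popular : ∀ R → 2 ℕ.+ n ℕ.≤ R → (+ suc R) ^ (2 ℕ.+ n) * (S - + R * (+ ℓ * + ℓ)) ≤ (+ (3 ℕ.+ n)) ^ (3 ℕ.+ n) * + N₀) where

    private
      instance
        s-nonZero : ℕ.NonZero (3 ℕ.* (q ℕ.* q))
        s-nonZero = ℕₚ.m*n≢0 3 (q ℕ.* q) ⦃ _ ⦄ ⦃ ℕₚ.m*n≢0 q q ⦄

      d : ℕ
      d = 3 ℕ.+ n

      e : ℤ
      e = + ℓ

      0≤e : 0ℤ ≤ e
      0≤e = +≤+ ℕ.z≤n

      d′ s j R : ℕ
      d′ = 2 ℕ.+ n
      s  = 3 ℕ.* (q ℕ.* q)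
      j  = ℓ DM./ s
      R  = d′ ℕ.⊔ j

      s≡ : + s ≡ + 3 * (+ q * + q)
      s≡ = trans (pos-* 3 (q ℕ.* q)) (cong (+ 3 *_) (pos-* q q))

      -- R is the larger of d - 1 and ⌊e/3q²⌋; `degenerate` and `moderate` treat the two
      -- possibilities.
      9R≤8S : + 9 * (+ R * (e * e)) ≤ + 8 * S
      9R≤8S with ℕₚ.⊔-sel d′ j
      ... | inj₁ h = subst (λ z → + 9 * (+ z * (e * e)) ≤ + 8 * S) (sym h) degenerate
      ... | inj₂ h = subst (λ z → + 9 * (+ z * (e * e)) ≤ + 8 * S) (sym h) (moderate (+ j)
              (subst₂ _≤_ (trans (pos-* s j) (cong (_* + j) s≡)) (refl) (+≤+ (subst (ℕ._≤ ℓ) (ℕₚ.*-comm j s) (DM.m/n*n≤m (ℓ) s)))))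

      e≤sT : e ≤ + s * + suc R
      e≤sT = subst₂ _≤_ (refl) (pos-* s (suc R)) (+≤+ (ℕₚ.≤-trans (ℕₚ.<⇒≤ e<) (ℕₚ.*-monoʳ-≤ s (ℕ.s≤s (ℕₚ.m≤n⊔m d′ j)))))
        where
        e< : ℓ ℕ.< s ℕ.* suc j
        e< = subst₂ ℕ._<_ (sym (DM.m≡m%n+[m/n]*n (ℓ) s)) (trans (cong (s ℕ.+_) (ℕₚ.*-comm j s)) (sym (ℕₚ.*-suc s j))) (ℕₚ.+-monoˡ-< (j ℕ.* s) (DM.m%n<n (ℓ) s))

      S≤9dN : (+ suc R) ^ d′ * S ≤ + 9 * ((+ d) ^ d * + N₀)
      S≤9dN = ≤-trans (*ˡ-≤ (0≤^ {+ suc R} (+≤+ ℕ.z≤n) d′) (≤-by-difference (+ 8 * S - + 9 * (+ R * (e * e))) (≤⇒0≤- 9R≤8S) (l S (+ R * (e * e)))))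
        (≤-trans (≤-reflexive (l′ ((+ suc R) ^ d′) (S - + R * (e * e)))) (*ˡ-≤ {+ 9} (+≤+ ℕ.z≤n) (popular R (ℕₚ.m≤m⊔n d′ j))))
        where
        l : ∀ S r → + 9 * (S - r) - S ≡ + 8 * S - + 9 * r
        l = solve-∀
        l′ : ∀ T x → T * (+ 9 * x) ≡ + 9 * (T * x)
        l′ = solve-∀

      -- Of the d + 2 factors e, d - 1 are traded for powers of R + 1 and the other three for S by
      -- `e³≤`; their product is what `popular` converts into prisms.
      chain : e ^ (d′ ℕ.+ 3) ≤ (+ s) ^ d′ * (+ m * (+ q * + q)) * (+ 9 * ((+ d) ^ d * + N₀))
      chain = ≤-trans (≤-reflexive (trans (^-distribˡ-+-* e d′ 3) (cong (e ^ d′ *_) (cube e))))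
        (≤-trans (*-≤-* {e ^ d′} (0≤^ 0≤e d′) (≤-trans (0≤* (0≤* 0≤e 0≤e) 0≤e) e³≤) (^-mono 0≤e e≤sT d′) e³≤)
        (≤-trans (≤-reflexive (trans (cong (_* (k * S)) (^-*-distrib (+ s) (+ suc R) d′)) (l ((+ s) ^ d′) ((+ suc R) ^ d′) k S)))
          (*ˡ-≤ {(+ s) ^ d′ * k} (0≤* {(+ s) ^ d′} {k} (0≤^ {+ s} (+≤+ ℕ.z≤n) d′) (0≤* {+ m} (+≤+ ℕ.z≤n) (0≤² (+ q)))) S≤9dN)))
        where
        k = + m * (+ q * + q)
        cube : ∀ e → e * (e * (e * 1ℤ)) ≡ e * e * e
        cube = solve-∀
        l : ∀ a b k S → a * b * (k * S) ≡ a * k * (b * S)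
        l = solve-∀

    bound : ℓ ℕ.^ (d ℕ.+ 2) ℕ.≤ prism-constant m n ℕ.* (N₀ ℕ.* q ℕ.^ (2 ℕ.* d))
    bound = drop‿+≤+ (subst₂ _≤_ lhs rhs chain)
      where
      lhs : e ^ (d′ ℕ.+ 3) ≡ + (ℓ ℕ.^ (d ℕ.+ 2))
      lhs = trans (cong (e ^_) (ex n)) (sym (pos-^ ℓ (d ℕ.+ 2)))
        where
        ex : ∀ n → 2 ℕ.+ n ℕ.+ 3 ≡ 3 ℕ.+ n ℕ.+ 2
        ex = ℕ-Solver.solve-∀
      q²ᵈ : (+ q * + q) ^ d′ * (+ q * + q) ≡ + (q ℕ.^ (2 ℕ.* d))
      q²ᵈ = trans (*-comm ((+ q * + q) ^ d′) (+ q * + q)) (trans (^-*-distrib (+ q) (+ q) (suc d′)) (trans (sym (^-distribˡ-+-* (+ q) d d))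
        (trans (cong ((+ q) ^_) (cong (d ℕ.+_) (sym (ℕₚ.+-identityʳ d)))) (sym (pos-^ q (2 ℕ.* d))))))
      rhs : (+ s) ^ d′ * (+ m * (+ q * + q)) * (+ 9 * ((+ d) ^ d * + N₀)) ≡ + (prism-constant m n ℕ.* (N₀ ℕ.* q ℕ.^ (2 ℕ.* d)))
      rhs = begin
        (+ s) ^ d′ * (c * Q) * (+ 9 * (D * + N₀)) ≡⟨ cong (λ z → z * (c * Q) * (+ 9 * (D * + N₀))) (trans (cong (_^ d′) s≡) (^-*-distrib (+ 3) Q d′)) ⟩
        (+ 3) ^ d′ * Q ^ d′ * (c * Q) * (+ 9 * (D * + N₀)) ≡⟨ l ((+ 3) ^ d′) (Q ^ d′) c Q (+ 9) D (+ N₀) ⟩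
        + 9 * c * D * (+ 3) ^ d′ * (+ N₀ * (Q ^ d′ * Q)) ≡⟨ cong₂ _*_ const (trans (cong (+ N₀ *_) q²ᵈ) (sym (pos-* (N₀) (q ℕ.^ (2 ℕ.* d))))) ⟩
        + prism-constant m n * + (N₀ ℕ.* q ℕ.^ (2 ℕ.* d)) ≡⟨ sym (pos-* (prism-constant m n) _) ⟩
        + (prism-constant m n ℕ.* (N₀ ℕ.* q ℕ.^ (2 ℕ.* d))) ∎
        where
        open ≡-Reasoning
        Q = + q * + q
        c = + m
        D = (+ d) ^ d
        l : ∀ a b c Q k D N → a * b * (c * Q) * (k * (D * N)) ≡ k * c * D * a * (N * (b * Q))
        l = solve-∀
        const : + 9 * c * D * (+ 3) ^ d′ ≡ + prism-constant m n
        const = sym (trans (pos-* (9 ℕ.* m ℕ.* d ℕ.^ d) (3 ℕ.^ d′)) (cong₂ _*_ (trans (pos-* (9 ℕ.* m) (d ℕ.^ d)) (cong₂ _*_ (pos-* 9 m) (pos-^ d d))) (pos-^ 3 d′)))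

  module Assembly (q′′ n : ℕ) (odd : suc (suc (suc q′′)) DM.% 2 ≡ 1) (F : FiniteField (suc (suc (suc q′′))))
                  {t : FiniteField.Carrier F} (t≢0 : ¬ t ≡ FiniteField.0# F)
                  (E : List (Defs.Point F (3 ℕ.+ n))) (uniq : Unique E) (above : AboveThreshold (suc (suc (suc q′′))) (3 ℕ.+ n) (length E)) where
    private
      q d : ℕ
      q = suc (suc (suc q′′))
      d = 3 ℕ.+ n

    open FromFiniteField F
    open Geometry enumField
    open Prisms F d t≢0 E uniq
    open DistanceCount enumField (𝟚≢𝟘 odd) using (distance-count)

    private
      e≡ : e ≡ + length E
      e≡ = ∑-length E

      weil : ∀ g → Σᶠ g ≡ 0ℤ → ∀ c → ¬ c ≡ 𝟘 →
             Correlation.kloosterman enumField g c * Correlation.kloosterman enumField g c ≤ + 4 * size * (Correlation.norm enumField g * Correlation.norm enumField g)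
      weil g Σg≡0 c c≢0 = subst (λ s → Correlation.kloosterman enumField g c * Correlation.kloosterman enumField g c ≤ + 4 * s * (Correlation.norm enumField g * Correlation.norm enumField g))
        (sym size≡q) (Weil.weil enumField q′′ (𝟚≢𝟘 odd) fermat size≡q g Σg≡0 c c≢0)

      count : (+ q * edges - e * e) * (+ q * edges - e * e) ≤ + 4 * (+ q * (+ q * (+ q) ^ (2 ℕ.+ n))) * (e * e)
      count = subst₂ (λ s v → (s * v - e * e) * (s * v - e * e) ≤ + 4 * (s * (s * s ^ (2 ℕ.+ n))) * (e * e)) size≡q (∑-swap E E _) (distance-count weil t≢0 d E uniq)

      threshold : + 20 * + 20 * + 4 * (+ q * (+ q * (+ q) ^ (2 ℕ.+ n))) < + 7 * + 7 * (e * e)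
      threshold = subst₂ _<_ l r (+<+ (above⇒1600< q d (length E) above))
        where
        l : + (1600 ℕ.* q ℕ.^ suc d) ≡ + 20 * + 20 * + 4 * (+ q * (+ q * (+ q) ^ (2 ℕ.+ n)))
        l = trans (pos-* 1600 (q ℕ.^ suc d)) (cong₂ _*_ {+ 1600} {+ 20 * + 20 * + 4} refl (pos-^ q (suc d)))
        r : + (49 ℕ.* (length E ℕ.* length E)) ≡ + 7 * + 7 * (e * e)
        r = trans (pos-* 49 (length E ℕ.* length E)) (cong₂ _*_ {+ 49} {+ 7 * + 7} refl (trans (pos-* (length E) (length E)) (sym (cong₂ _*_ e≡ e≡))))

      e≤q^d : e ≤ (+ q) ^ d
      e≤q^d = begin
        e ≡⟨ ∑-cong E (λ x → sym (trans (∑-cong V (λ v → χ-⇔ (x ≟ᵖ v) (v ≟ᵖ x) sym sym)) (Enum.once (ptEnum d) x))) ⟩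
        ∑[ x ∈ E ] ∑[ v ∈ V ] χ (x ≟ᵖ v) ≡⟨ ∑-swap E V _ ⟩
        ∑[ v ∈ V ] ∑[ x ∈ E ] χ (x ≟ᵖ v) ≤⟨ ∑-mono V (λ v → ∑-unique≤1 _≟ᵖ_ uniq v) ⟩
        ∑[ v ∈ V ] 1ℤ ≡⟨ trans (Σᵛ-1 d) (cong (_^ d) size≡q) ⟩
        (+ q) ^ d ∎
        where
        open ℤₚ.≤-Reasoning
        V = tuples d elems

      open Numerics (+ q) ((+ q) ^ (2 ℕ.+ n)) e edges S n refl (+≤+ (ℕ.s≤s (ℕ.s≤s (ℕ.s≤s ℕ.z≤n)))) 0≤e 0≤edges count threshold e≤q^d energy

      e³≤ : e * e * e ≤ + 20 * (+ 20 + 1ℤ) * (+ q * + q) * S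
      e³≤ = ≤-trans (≤-trans (≤-reflexive (sym (*-identityˡ _))) (*ʳ-≤ {e * e * e} {1ℤ} {+ 13 * + 13} (0≤* (0≤* 0≤e 0≤e) 0≤e) (+≤+ (ℕ.s≤s ℕ.z≤n)))) cubic

    bound : length E ℕ.^ (d ℕ.+ 2) ℕ.≤ prism-constant 420 n ℕ.* (prismCount F t d E ℕ.* q ℕ.^ (2 ℕ.* d))
    bound = PopularPairs.bound 420 q n (length E) (prismCount F t d E) S
      (subst (λ e → + 9 * (+ (2 ℕ.+ n) * (e * e)) ≤ + 8 * S) e≡ degenerate)
      (subst (λ e → ∀ R → + 3 * (+ q * + q) * R ≤ e → + 9 * (R * (e * e)) ≤ + 8 * S) e≡ moderate)
      (subst₂ (λ e k → e * e * e ≤ k * (+ q * + q) * S) {u = + 20 * (+ 20 + 1ℤ)} {v = + 420} e≡ refl e³≤)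
      (λ R h → subst (λ e → (+ suc R) ^ (2 ℕ.+ n) * (S - + R * (e * e)) ≤ (+ d) ^ d * + prismCount F t d E) e≡ (popular (2 ℕ.+ n) R refl h))

  ≤-suc-* : ∀ {a b} k → a ℕ.≤ k ℕ.* b → a ℕ.≤ suc k ℕ.* b
  ≤-suc-* {b = b} k h = ℕₚ.≤-trans h (ℕₚ.m≤n+m (k ℕ.* b) b)

  prism-bound : ∀ n {q} → q DM.% 2 ≡ 1 → (F : FiniteField q) {t : FiniteField.Carrier F} → ¬ t ≡ FiniteField.0# F →
                (E : List (Defs.Point F (3 ℕ.+ n))) → Unique E → AboveThreshold q (3 ℕ.+ n) (length E) →
                length E ℕ.^ (3 ℕ.+ n ℕ.+ 2) ℕ.≤ suc (prism-constant 420 n) ℕ.* (prismCount F t (3 ℕ.+ n) E ℕ.* q ℕ.^ (2 ℕ.* (3 ℕ.+ n)))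
  prism-bound n odd F t≢0 E uniq above = go (odd≥3 F odd) odd F t≢0 E uniq above
    where
    go : ∀ {q} → (∃ λ q′′ → q ≡ suc (suc (suc q′′))) → q DM.% 2 ≡ 1 → (F : FiniteField q) {t : FiniteField.Carrier F} → ¬ t ≡ FiniteField.0# F →
         (E : List (Defs.Point F (3 ℕ.+ n))) → Unique E → AboveThreshold q (3 ℕ.+ n) (length E) →
         length E ℕ.^ (3 ℕ.+ n ℕ.+ 2) ℕ.≤ suc (prism-constant 420 n) ℕ.* (prismCount F t (3 ℕ.+ n) E ℕ.* q ℕ.^ (2 ℕ.* (3 ℕ.+ n)))
    go (q′′ , refl) odd F t≢0 E uniq above = ≤-suc-* (prism-constant 420 n) (Assembly.bound q′′ n odd F t≢0 E uniq above)

open import Defs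
open import Data.Nat using (ℕ; _≥_; _%_; _^_; _*_; _+_; suc; s≤s)
open import Data.Nat.Primality using (Prime)
open import Data.Product using (Σ; _×_; _,_)
open import Data.List using (List; length)
open import Data.List.Relation.Unary.Unique.Propositional using (Unique)
open import Data.Integer.Base using () renaming (+_ to pos)
open import Data.Rational using (ℚ; _<_; _≤_; 0ℚ; _/_) renaming (_*_ to _*ℚ_)
open import Relation.Binary.PropositionalEquality using (_≡_; refl)
open import Relation.Nullary using (¬_)

theorem2 : (d : ℕ) → d ≥ 3 →
    Σ ℚ λ c → (0ℚ < c) ×
    ((q p k : ℕ) → Prime p → p % 2 ≡ 1 → q ≡ p ^ suc k →
    (F : FiniteField q) →
    (t : FiniteField.Carrier F) → ¬ (t ≡ FiniteField.0# F) →
    (E : List (Point F d)) → Unique E →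
    AboveThreshold q d (length E) →
    c *ℚ ℕ→ℚ (length E ^ (d + 2)) ≤ ℕ→ℚ (prismCount F t d E * q ^ (2 * d)))
theorem2 (suc (suc (suc n))) (s≤s (s≤s (s≤s _))) =
  -- Enlarging the constant K by one makes the denominator visibly positive.
  pos 1 / suc K , PrismBound.0<1/ K ,
  λ { q p k _ p-odd refl F t t≢0 E uniq above →
      PrismBound.1/-*-≤ K (length E ^ (3 + n + 2)) (prismCount F t (3 + n) E * q ^ (2 * (3 + n)))
        (PrismBound.prism-bound n (PrismBound.odd-power p (suc k) p-odd) F t≢0 E uniq above) }
  where
  K = PrismBound.prism-constant 420 n
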